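{- For every $n\geq 1$, the map $\Phi_2$ is a bijection between permutations of $\{1,\ldots,n\}$ and tree-like tableaux of size $n$, and it satisfies $tree(\sigma)=tree(\Phi_2(\sigma))$ for every permutation $\sigma$.
   Context: A Ferrers diagram is a finite set of unit cells of $\mathbb{Z}^2$ forming left-justified rows whose lengths weakly decrease from top to bottom, considered up to translation; its boundary edges are the unit edges on its Southeast border path, ordered Southwest to Northeast. A tree-like tableau is a Ferrers diagram in which each cell is empty or pointed, such that: (1) the top-left cell is pointed (root point); (2) every non-root pointed cell has either a pointed cell above it in its column or a pointed cell to its left in its row, but not both; (3) every row and column contains a pointed cell. Its size $n$ is its number of points (half-perimeter minus 1). The special point of $T$ is the rightmost among pointed cells that are lowest in their column. $\mathrm{Insertpoint}(T,e)$ for a boundary edge $e$: let $T'$ be obtained by inserting at $e$ a column (if $e$ is the right end of a row $r$: add a cell at the end of $r$ and every row above) or a row (if $e$ is the bottom of a column $c$: add a cell at the bottom of $c$ and every column to its left), with only the lowest cell of the new column (resp. rightmost cell of the new row) pointed. If $e$ lies Northeast of the special point of $T$ along the border path, the result is $T'$; otherwise add the ribbon of empty cells (connected, no $2\times2$ square, keeping a Ferrers diagram) from the cell immediately right of the new point to the cell immediately below the special point of $T$ (nothing if $e$ is the bottom edge of the special cell). A planar binary tree is a rooted tree in which every vertex has either no children (leaf) or an ordered pair (left, right) of children (node); its size is its number of nodes, and its leaves are ordered left to right. $tree(T)$ for a tree-like tableau $T$: nodes are the pointed cells, the root is the root point; the left child of a point $p$ is the nearest pointed cell below $p$ in its column,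 or if none the leaf given by the boundary edge at the bottom of that column; the right child of $p$ is the nearest pointed cell to the right of $p$ in its row, or if none the leaf given by the boundary edge at the end of that row. An increasing tree of size $n$ is a binary tree of size $n$ whose nodes are labelled bijectively by $1,\ldots,n$ with labels increasing along paths from the root. $inctree(\sigma)$ for a permutation $\sigma=\sigma_1\cdots\sigma_n$ is the unique increasing tree whose inorder traversal (left subtree, root, right subtree) reads $\sigma_1,\ldots,\sigma_n$; $tree(\sigma)$ is $inctree(\sigma)$ with labels forgotten. $\Phi_2$ is defined by induction: $\Phi_2(1)$ is the unique tableau of size 1. For $\sigma$ a permutation of $\{1,\ldots,n+1\}$ with $n+1$ in position $p$, let $\tau$ be $\sigma$ with $n+1$ deleted (so $inctree(\sigma)$ is obtained from $inctree(\tau)$ by replacing its $p$-th leaf $L$ from the left by a node labelled $n+1$ with two leaves). Let $e_L$ be the boundary edge of $\Phi_2(\tau)$ which is the $p$-th leaf from the left of $tree(\Phi_2(\tau))$, and set $\Phi_2(\sigma)=\mathrm{Insertpoint}(\Phi_2(\tau),e_L)$. -}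

module Defs where

open import Data.Nat using (ℕ; zero; suc; _+_; _∸_; _≤_; _<_; _≡ᵇ_; _<ᵇ_; _⊔_)
open import Data.Bool using (Bool; true; false; if_then_else_; _∧_; not)
open import Data.List using (List; []; _∷_; _++_; [_]; map; length; replicate; filter; upTo; last)
open import Data.Nat.ListAction using (sum)
open import Data.List.Relation.Unary.All using (All)
open import Data.List.Relation.Unary.Linked using (Linked)
open import Data.List.Relation.Binary.Permutation.Propositional using (_↭_)
open import Data.Maybe using (Maybe; just; nothing)
open import Data.Product using (_×_; _,_; ∃; proj₁; proj₂)
open import Data.Sum using (_⊎_)
open import Relation.Nullary using (¬_)
open import Relation.Binary.PropositionalEquality using (_≡_; _≢_)

lookupD : {A : Set} → List A → ℕ → A → A
lookupD []       _       d = d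
lookupD (x ∷ xs) zero    d = x
lookupD (x ∷ xs) (suc i) d = lookupD xs i d

imapFrom : {A B : Set} → ℕ → (ℕ → A → B) → List A → List B
imapFrom i f []       = []
imapFrom i f (x ∷ xs) = f i x ∷ imapFrom (suc i) f xs

imap : {A B : Set} → (ℕ → A → B) → List A → List B
imap = imapFrom 0

insertAt : {A : Set} → ℕ → A → List A → List A
insertAt zero    x xs       = x ∷ xs
insertAt (suc p) x []       = [ x ]
insertAt (suc p) x (y ∷ ys) = y ∷ insertAt p x ys

range : ℕ → ℕ → List ℕ
range a b = map (a +_) (upTo (b ∸ a))

-- Tableaux: a Ferrers diagram with empty (false) / pointed (true) cells,
-- given as its list of rows from top to bottom; row i is the list of its
-- cells from left to right.  Cell (i , j) = row i, column j (0-based);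
-- the top-left cell is (0 , 0).  This is a canonical representative of the
-- diagram up to translation.

Tab : Set
Tab = List (List Bool)

rowLen : Tab → ℕ → ℕ
rowLen T i = length (lookupD T i [])

-- value of cell (i , j); cells outside the diagram read as false
cell : Tab → ℕ → ℕ → Bool
cell T i j = lookupD (lookupD T i []) j false

Pointed : Tab → ℕ → ℕ → Set
Pointed T i j = cell T i j ≡ true

colHeight : Tab → ℕ → ℕ
colHeight T j = length (filter (λ r → j Data.Nat.<? length r) T)

IsFerrers : Tab → Set
IsFerrers T = (T ≢ []) × All (λ r → 0 < length r) T × Linked (λ r s → length s ≤ length r) T

PointAbove PointLeft : Tab → ℕ → ℕ → Set
PointAbove T i j = ∃ λ i' → i' < i × Pointed T i' j
PointLeft  T i j = ∃ λ j' → j' < j × Pointed T i j'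

IsTreeLike : Tab → Set
IsTreeLike T =
  IsFerrers T ×
  Pointed T 0 0 ×
  (∀ i j → Pointed T i j → ¬ (i ≡ 0 × j ≡ 0) →
      (PointAbove T i j × ¬ PointLeft T i j) ⊎ (¬ PointAbove T i j × PointLeft T i j)) ×
  (∀ i → i < length T → ∃ λ j → Pointed T i j) ×
  (∀ j → j < rowLen T 0 → ∃ λ i → Pointed T i j)

countTrue : List Bool → ℕ
countTrue []          = 0
countTrue (true ∷ bs)  = suc (countTrue bs)
countTrue (false ∷ bs) = countTrue bs

size : Tab → ℕ
size T = sum (map countTrue T)

data Edge : Set where
  colBot : ℕ → Edge   -- the edge at the bottom of column j
  rowEnd : ℕ → Edge   -- the edge at the right end of row i

headD : List ℕ → ℕ
headD []      = 0
headD (x ∷ _) = x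

-- border path of rows i, i+1, ... (given their lengths), Southwest to Northeast
borderAux : ℕ → List ℕ → List Edge
borderAux i []       = []
borderAux i (l ∷ ls) = borderAux (suc i) ls ++ map colBot (range (headD ls) l) ++ [ rowEnd i ]

border : Tab → List Edge
border T = borderAux 0 (map length T)

edgeEq : Edge → Edge → Bool
edgeEq (colBot a) (colBot b) = a ≡ᵇ b
edgeEq (rowEnd a) (rowEnd b) = a ≡ᵇ b
edgeEq _ _ = false

-- 0-based position of an edge in a list (length of the list if absent)
posOf : Edge → List Edge → ℕ
posOf e []       = 0
posOf e (x ∷ xs) = if edgeEq e x then 0 else suc (posOf e xs)

isBottomPointCol : Tab → ℕ → Bool
isBottomPointCol T j = cell T (colHeight T j ∸ 1) j

special : Tab → Maybe (ℕ × ℕ)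
special T with last (filter (λ j → Data.Bool.T? (isBottomPointCol T j)) (upTo (rowLen T 0)))
... | nothing = nothing
... | just j  = just (colHeight T j ∸ 1 , j)

insertCol : Tab → ℕ → Tab
insertCol T r = imap (λ i row → if i Data.Nat.≤ᵇ r then insertAt (rowLen T r) (i ≡ᵇ r) row else row) T

insertRow : Tab → ℕ → Tab
insertRow T c = insertAt (colHeight T c) (replicate c false ++ [ true ]) T

extendTo : ℕ → List Bool → List Bool
extendTo n row = row ++ replicate (n ∸ length row) false

-- add the ribbon of empty cells whose Southwest end is the cell at the end of
-- row ra (the cell right of the new point) and whose Northeast end is the cell
-- (rb , cb): row rb is extended up to column cb, and each row i with
-- rb < i ≤ ra is extended by the cells below the last cell of row i-1
addRibbon : Tab → ℕ → ℕ → ℕ → Tab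
addRibbon T ra rb cb =
  imap (λ i row → if i ≡ᵇ rb then extendTo (suc cb) row
                  else if (rb Data.Nat.<ᵇ i) ∧ (i Data.Nat.≤ᵇ ra)
                       then extendTo (suc (rowLen T (i ∸ 1))) row
                       else row) T

insertAtEdge : Tab → Edge → Tab
insertAtEdge T (rowEnd r) = insertCol T r
insertAtEdge T (colBot c) = insertRow T c

newPointRow : Tab → Edge → ℕ
newPointRow T (rowEnd r) = r
newPointRow T (colBot c) = colHeight T c

-- position in T' of the cell (is , js) of T
shiftedCell : Tab → Edge → ℕ × ℕ → ℕ × ℕ
shiftedCell T (rowEnd r) (is , js) =
  is , (if (rowLen T r Data.Nat.≤ᵇ js) ∧ (is Data.Nat.≤ᵇ r) then suc js else js)
shiftedCell T (colBot c) (is , js) =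
  (if colHeight T c Data.Nat.≤ᵇ is then suc is else is) , js

insertpoint : Tab → Edge → Tab
insertpoint T e with special T
... | nothing = T
... | just (is , js) =
  if posOf (colBot js) (border T) Data.Nat.<ᵇ posOf e (border T)
  then insertAtEdge T e                       -- e lies Northeast of the special point
  else addRibbon (insertAtEdge T e) (newPointRow T e)
                 (suc (proj₁ (shiftedCell T e (is , js)))) (proj₂ (shiftedCell T e (is , js)))

data BTree : Set where
  leaf : BTree
  node : BTree → BTree → BTree

data ETree : Set where
  eleaf : Edge → ETree
  enode : ETree → ETree → ETree

eshape : ETree → BTree
eshape (eleaf _)   = leaf
eshape (enode l r) = node (eshape l) (eshape r)

leaves : ETree → List Edge
leaves (eleaf e)   = [ e ]
leaves (enode l r) = leaves l ++ leaves r

firstPointed : (ℕ → Bool) → List ℕ → Maybe ℕ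
firstPointed p []       = nothing
firstPointed p (k ∷ ks) = if p k then just k else firstPointed p ks

nextBelow nextRight : Tab → ℕ → ℕ → Maybe ℕ
nextBelow T i j = firstPointed (λ i' → cell T i' j) (range (suc i) (length T))
nextRight T i j = firstPointed (λ j' → cell T i j') (range (suc j) (rowLen T i))

-- the tree rooted at the point (i , j); the fuel bounds the depth
treeFrom : Tab → ℕ → ℕ → ℕ → ETree
treeFrom T zero i j = eleaf (colBot j)
treeFrom T (suc f) i j = enode left right
  where
    left : ETree
    left with nextBelow T i j
    ... | nothing = eleaf (colBot j)
    ... | just i' = treeFrom T f i' j
    right : ETree
    right with nextRight T i j
    ... | nothing = eleaf (rowEnd i)
    ... | just j' = treeFrom T f i j'

-- tree(T), with leaves labelled by their boundary edges
-- (fuel = half-perimeter, which exceeds the depth)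
treeE : Tab → ETree
treeE T = treeFrom T (length T + rowLen T 0) 0 0

treeTab : Tab → BTree
treeTab T = eshape (treeE T)

IsPerm : ℕ → List ℕ → Set
IsPerm n w = w ↭ map suc (upTo n)

data ITree : Set where
  ileaf : ITree
  inode : ITree → ℕ → ITree → ITree

forget : ITree → BTree
forget ileaf         = leaf
forget (inode l _ r) = node (forget l) (forget r)

minimum : List ℕ → ℕ
minimum []       = 0
minimum (x ∷ []) = x
minimum (x ∷ xs) = Data.Nat._⊓_ x (minimum xs)

splitAt : ℕ → List ℕ → List ℕ × List ℕ
splitAt m [] = [] , []
splitAt m (x ∷ xs) with x ≡ᵇ m
... | true  = [] , xs
... | false = (x ∷ proj₁ (splitAt m xs)) , proj₂ (splitAt m xs)

inctreeF : ℕ → List ℕ → ITree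
inctreeF _ [] = ileaf
inctreeF zero (_ ∷ _) = ileaf
inctreeF (suc f) w@(_ ∷ _) =
  inode (inctreeF f (proj₁ (splitAt (minimum w) w)))
        (minimum w)
        (inctreeF f (proj₂ (splitAt (minimum w) w)))

inctree : List ℕ → ITree
inctree w = inctreeF (length w) w

treePerm : List ℕ → BTree
treePerm w = forget (inctree w)

position : ℕ → List ℕ → ℕ
position m [] = 0
position m (x ∷ xs) = if x ≡ᵇ m then 0 else suc (position m xs)

unitTab : Tab
unitTab = [ [ true ] ]

-- Φ₂ on words of length k (the fuel argument is the length):
-- for σ a permutation of {1..n+1}, n+1 is at (1-based) position p = position + 1,
-- τ = σ without n+1, and e_L is the p-th leaf of tree(Φ₂ τ)
deleteLetter : ℕ → List ℕ → List ℕ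
deleteLetter m w = filter (λ x → Relation.Nullary.¬? (x Data.Nat.≟ m)) w

insertAtLeaf : Tab → ℕ → Tab
insertAtLeaf T p = insertpoint T (lookupD (leaves (treeE T)) p (rowEnd 0))

phi2F : ℕ → List ℕ → Tab
phi2F zero w = unitTab
phi2F (suc zero) w = unitTab
phi2F (suc (suc k)) w =
  insertAtLeaf (phi2F (suc k) (deleteLetter (suc (suc k)) w)) (position (suc (suc k)) w)

Φ₂ : List ℕ → Tab
Φ₂ w = phi2F (length w) w

{-# OPTIONS --safe #-}

-- The leaves of tree(T) are the boundary edges of T, each exactly once.
-- Inserting a row or column at an edge e turns the leaf e into a node and
-- leaves the rest of the tree alone, and adding empty cells does not affect the
-- tree; on the side of permutations, inserting n + 1 at position p likewise
-- replaces leaf p.  So both trees agree by induction, and bijectivity reduces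
-- to: (T , e) ↦ Insertpoint(T , e) is a bijection onto the tableaux other than
-- the unit one.  The ribbon makes the new point special, so the new point can be
-- found again.  Its ribbon begins to its right and, followed upwards, ends in
-- the first row whose last cell lies just below a point; once it is removed,
-- the new point is alone in its column if it has a point to its left and alone
-- in its row if it has a point above, which tells what to delete.

module Submission where

open import Defs
open import Data.Nat using (ℕ; zero; suc; _+_; _∸_; _≤_; _<_; _≤ᵇ_; _<ᵇ_; _≡ᵇ_; _⊓_; z≤n; s≤s; s≤s⁻¹; pred; _≟_; _≤?_; _<?_)
open import Data.Nat.Properties
open import Data.Bool using (Bool; true; false; if_then_else_; _∧_; T; T?)
open import Data.Bool.Properties using (T-≡; ¬-not)
open import Data.List using (List; []; _∷_; _++_; [_]; map; length; replicate; filter; upTo; applyUpTo; last; concatMap)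
open import Data.List.Properties using (length-++; length-filter; filter-accept; filter-reject; filter-++; filter-all; map-++; upTo-∷ʳ; map-upTo; length-upTo; ++-identityʳ; concatMap-++; length-map; length-replicate)
open import Data.Product using (_×_; _,_; ∃; ∃₂; proj₁; proj₂)
open import Data.Sum using (_⊎_; inj₁; inj₂; swap)
open import Data.List.Relation.Unary.All as All using (All; []; _∷_)
open import Data.List.Relation.Unary.All.Properties using (all-upTo) renaming (++⁺ to All-++⁺; ++⁻ to All-++⁻; map⁺ to All-map⁺)
open import Data.Nat.Tactic.RingSolver using (solve-∀)
open import Data.List.Relation.Unary.Linked using (Linked; []; [-]; _∷_)
open import Data.Empty using (⊥; ⊥-elim)
open import Data.Maybe using (just; nothing)
open import Function using (flip; _∘_)
open import Function.Bundles using (Equivalence)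
open import Relation.Nullary using (¬_; ¬?; Dec; yes; no; contradiction)
open import Relation.Binary using (tri<; tri≈; tri>)
open import Relation.Binary.PropositionalEquality using (_≡_; _≢_; refl; sym; trans; cong; cong₂; subst; subst₂; module ≡-Reasoning)
open import Data.List.Relation.Unary.Any using (here; there)
open import Data.List.Relation.Unary.AllPairs using ([]; _∷_)
open import Data.List.Relation.Unary.Unique.Propositional using (Unique)
open import Data.List.Relation.Unary.Unique.Propositional.Properties using () renaming (++⁺ to Unique-++⁺)
open import Data.List.Membership.Propositional using (_∈_; find; lose)
open import Data.List.Membership.Propositional.Properties using (∈-++⁺ˡ; ∈-++⁺ʳ; ∈-concatMap⁺; ∈-concatMap⁻; ∈-∃++)
open import Data.List.Relation.Binary.Permutation.Propositional using (_↭_; prep; ↭-refl; ↭-sym; ↭-trans; ↭-swap)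
open import Data.List.Relation.Binary.Permutation.Propositional.Properties using (↭-length; ↭-singleton-inv; ∷↭∷ʳ; All-resp-↭; ∈-resp-↭; drop-mid)

-- A list of rows records lengths and points at once, but the ribbon changes only lengths. The
-- combinatorics is therefore done on pairs `(l , P)` of a row length function and an infinite
-- Boolean matrix: empty cells change `l` alone, and `flip` reduces rows to columns. Lists return
-- only where `insertpoint` is shown to meet the resulting specification. `insertpoint` decides by
-- positions on the border path whether to add a ribbon. The specification uses a condition on the
-- outcome instead: a ribbon is due exactly when some column right of the new point still ends in a
-- point. `Inserted` and `Completed` express the two stages in this way, and both are injective and
-- functional relations. Injectivity yields that of Insertpoint; functionality recognises a tableau
-- that has been taken apart as a value of `insertpoint` without evaluating it. A permutation
-- supplies the number of a leaf, whereas insertion takes an edge. Passing from one to the other and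
-- back requires that the leaves be distinct and exhaust the boundary edges, so this is carried
-- through the induction along with the shape of the tree.

true≢false : {b : Bool} → b ≡ true → b ≡ false → ⊥
true≢false refl ()

-- Data.Fin.punchIn on ℕ
skip : ℕ → ℕ → ℕ
skip zero    j       = suc j
skip (suc c) zero    = zero
skip (suc c) (suc j) = suc (skip c j)

data SkipView (c : ℕ) : ℕ → Set where
  at  : SkipView c c
  off : ∀ j → SkipView c (skip c j)

skipView : ∀ c j → SkipView c j
skipView zero    zero    = at
skipView zero    (suc j) = off j
skipView (suc c) zero    = off zero
skipView (suc c) (suc j) with skipView c j
... | at    = at
... | off k = off (suc k)

skip-< : ∀ c {j} → j < c → skip c j ≡ j
skip-< (suc c) {zero}  _         = refl
skip-< (suc c) {suc j} (s≤s j<c) = cong suc (skip-< c j<c)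

skip-≥ : ∀ c {j} → c ≤ j → skip c j ≡ suc j
skip-≥ zero    _             = refl
skip-≥ (suc c) (s≤s c≤j) = cong suc (skip-≥ c c≤j)

skip-≢ : ∀ c {j} → skip c j ≢ c
skip-≢ zero    ()
skip-≢ (suc c) {zero}  ()
skip-≢ (suc c) {suc j} eq = skip-≢ c (suc-injective eq)

skip-injective : ∀ c {j k} → skip c j ≡ skip c k → j ≡ k
skip-injective zero    eq = suc-injective eq
skip-injective (suc c) {zero}  {zero}  eq = refl
skip-injective (suc c) {suc j} {suc k} eq = cong suc (skip-injective c (suc-injective eq))

skip-mono-< : ∀ c {j k} → j < k → skip c j < skip c k
skip-mono-< zero    j<k = s≤s j<k
skip-mono-< (suc c) {zero}  {suc k} _         = s≤s z≤n
skip-mono-< (suc c) {suc j} {suc k} (s≤s j<k) = s≤s (skip-mono-< c j<k)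

skip-cancel-< : ∀ c {j k} → skip c j < skip c k → j < k
skip-cancel-< zero    (s≤s j<k) = j<k
skip-cancel-< (suc c) {zero}  {suc k} _        = s≤s z≤n
skip-cancel-< (suc c) {suc j} {suc k} (s≤s lt) = s≤s (skip-cancel-< c lt)

skip-<⁻ : ∀ c {j} → skip c j < c → j < c
skip-<⁻ (suc c) {zero}  _        = s≤s z≤n
skip-<⁻ (suc c) {suc j} (s≤s lt) = s≤s (skip-<⁻ c lt)

skip->⁻ : ∀ c {j} → c < skip c j → c ≤ j
skip->⁻ zero    _ = z≤n
skip->⁻ (suc c) {suc j} (s≤s lt) = s≤s (skip->⁻ c lt)

skip->⁺ : ∀ c {j} → c ≤ j → c < skip c j
skip->⁺ c c≤j = subst (c <_) (sym (skip-≥ c c≤j)) (s≤s c≤j)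

skip-≤suc : ∀ c j → skip c j ≤ suc j
skip-≤suc zero    j       = ≤-refl
skip-≤suc (suc c) zero    = z≤n
skip-≤suc (suc c) (suc j) = s≤s (skip-≤suc c j)

skip-suc⁻ : ∀ c {j k} → c ≤ k → skip c j < suc k → j < k
skip-suc⁻ c {j} c≤k lt = skip-cancel-< c (subst (skip c j <_) (sym (skip-≥ c c≤k)) lt)

skip-suc⁺ : ∀ c {j k} → j < k → skip c j < suc k
skip-suc⁺ c {j} j<k = s≤s (≤-trans (skip-≤suc c j) j<k)

-- Points as an infinite matrix, and the insertion of a column with one point

Matrix : Set
Matrix = ℕ → ℕ → Bool

Above Left : Matrix → ℕ → ℕ → Set
Above P i j = ∃ λ i' → i' < i × P i' j ≡ true
Left  P i j = ∃ λ j' → j' < j × P i j' ≡ true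

-- Conditions (1) and (2) of a tree-like tableau. They mention points alone, so they survive the
-- addition of empty cells.
record Points (P : Matrix) : Set where
  field
    root   : P 0 0 ≡ true
    parent : ∀ i j → P i j ≡ true → ¬ (i ≡ 0 × j ≡ 0) →
             (Above P i j × ¬ Left P i j) ⊎ (¬ Above P i j × Left P i j)

-- The two alternatives for the parent change places under transposition. Thus the insertion of a
-- row is the insertion of a column into the transpose, and only columns have to be treated.
Points-flip : ∀ {P} → Points P → Points (flip P)
Points-flip pts = record
  { root   = root
  ; parent = λ i j p nr → Data.Sum.map Data.Product.swap Data.Product.swap
                            (swap (parent j i p (nr ∘ Data.Product.swap)))
  } where open Points pts

-- Insertions are relations, so that the same lemmas also serve for deletions.
record ColInserted (a b : ℕ) (P P′ : Matrix) : Set where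
  field
    old     : ∀ i j → P′ i (skip b j) ≡ P i j
    new     : P′ a b ≡ true
    new-≢   : ∀ i → i ≢ a → P′ i b ≡ false
    no-right : ∀ j → b ≤ j → P a j ≡ false

  row≡ : ∀ {i} → P′ i b ≡ true → i ≡ a
  row≡ {i} p with i ≟ a
  ... | yes eq = eq
  ... | no neq = contradiction (new-≢ i neq) (true≢false p)

  no-right′ : ∀ j → b < j → P′ a j ≡ false
  no-right′ j b<j with skipView b j
  ... | at    = contradiction b<j (<-irrefl refl)
  ... | off k = trans (old a k) (no-right k (skip->⁻ b b<j))

  new-¬Above : ¬ Above P′ a b
  new-¬Above (i , i<a , p) = <-irrefl (row≡ p) i<a

  Above⁺ : ∀ {i j} → Above P i j → Above P′ i (skip b j)
  Above⁺ {i} {j} (i' , lt , p) = i' , lt , trans (old i' j) p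

  Above⁻ : ∀ {i j} → Above P′ i (skip b j) → Above P i j
  Above⁻ {i} {j} (i' , lt , p) = i' , lt , trans (sym (old i' j)) p

  Left⁺ : ∀ {i j} → Left P i j → Left P′ i (skip b j)
  Left⁺ {i} (j' , lt , p) = skip b j' , skip-mono-< b lt , trans (old i j') p

  -- A point in the new column can only be the new one, in row a. An old point to its right would
  -- then lie in row a beyond b, which `no-right` excludes.
  Left⁻ : ∀ {i j} → P i j ≡ true → Left P′ i (skip b j) → Left P i j
  Left⁻ {i} {j} p (j' , lt , q) with skipView b j'
  ... | off k = k , skip-cancel-< b lt , trans (sym (old i k)) q
  ... | at    = contradiction (no-right j (skip->⁻ b lt))
                              (true≢false (subst (λ i → P i j ≡ true) (row≡ q) p))

  point⁺ : ∀ {i j} → P i j ≡ true → P′ i (skip b j) ≡ true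
  point⁺ {i} {j} p = trans (old i j) p

  point⁻ : ∀ {i j} → P′ i (skip b j) ≡ true → P i j ≡ true
  point⁻ {i} {j} p = trans (sym (old i j)) p

  point-left : ∀ {j} → P a j ≡ true → j < b
  point-left {j} p with j <? b
  ... | yes lt = lt
  ... | no ≮   = contradiction (no-right j (≮⇒≥ ≮)) (true≢false p)

  root-cond : ∀ {i j} → 0 < b → ¬ (i ≡ 0 × j ≡ 0) → ¬ (i ≡ 0 × skip b j ≡ 0)
  root-cond 0<b nr (i≡0 , eq) =
    nr (i≡0 , skip-injective b (trans eq (sym (skip-< b 0<b))))

  root-cond⁻ : ∀ {i j} → 0 < b → ¬ (i ≡ 0 × skip b j ≡ 0) → ¬ (i ≡ 0 × j ≡ 0)
  root-cond⁻ 0<b nr (i≡0 , refl) = nr (i≡0 , skip-< b 0<b)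

  new-Left : (∃ λ j → P a j ≡ true) → Left P′ a b
  new-Left (j , p) = j , point-left p , subst (λ k → P′ a k ≡ true) (skip-< b (point-left p)) (point⁺ p)

  -- An old point of row a lies left of b. It becomes the parent of the new point, and it shows that
  -- b is positive, so that the root keeps its place.
  Points⁺ : (∃ λ j → P a j ≡ true) → Points P → Points P′
  Points⁺ row pts = record { root = root′ ; parent = parent′ }
    where
    open Points pts
    0<b : 0 < b
    0<b = ≤-trans (s≤s z≤n) (point-left (proj₂ row))
    root′ : P′ 0 0 ≡ true
    root′ = subst (λ k → P′ 0 k ≡ true) (skip-< b 0<b) (point⁺ root)
    parent′ : ∀ i j → P′ i j ≡ true → ¬ (i ≡ 0 × j ≡ 0) →
             (Above P′ i j × ¬ Left P′ i j) ⊎ (¬ Above P′ i j × Left P′ i j)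
    parent′ i j p nr with skipView b j
    parent′ i .b p nr | at with row≡ p
    ... | refl = inj₂ (new-¬Above , new-Left row)
    parent′ i .(skip b k) p nr | off k with parent i k (point⁻ p) (root-cond⁻ 0<b nr)
    ... | inj₁ (u , v) = inj₁ (Above⁺ u , v ∘ Left⁻ (point⁻ p))
    ... | inj₂ (u , v) = inj₂ (u ∘ Above⁻ , Left⁺ v)

  -- The point left of the new one forces b to be positive, so the removed column is not that of the
  -- root.
  Points⁻ : Left P′ a b → Points P′ → Points P
  Points⁻ (j₀ , j₀<b , p₀) pts = record
    { root = point⁻ (subst (λ k → P′ 0 k ≡ true) (sym (skip-< b 0<b)) root)
    ; parent = parent′ }
    where
    open Points pts
    0<b : 0 < b
    0<b = ≤-trans (s≤s z≤n) j₀<b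
    parent′ : ∀ i j → P i j ≡ true → ¬ (i ≡ 0 × j ≡ 0) →
             (Above P i j × ¬ Left P i j) ⊎ (¬ Above P i j × Left P i j)
    parent′ i j p nr with parent i (skip b j) (point⁺ p) (root-cond 0<b nr)
    ... | inj₁ (u , v) = inj₁ (Above⁻ u , v ∘ Left⁺)
    ... | inj₂ (u , v) = inj₂ (u ∘ Above⁺ , Left⁻ p v)

RowInserted : ℕ → ℕ → Matrix → Matrix → Set
RowInserted a b P P′ = ColInserted b a (flip P) (flip P′)

-- Shapes: row lengths as a function of the row index, zero below the diagram.

Decreasing : (ℕ → ℕ) → Set
Decreasing l = ∀ i → l (suc i) ≤ l i

antitone : ∀ {l} → Decreasing l → ∀ {i j} → i ≤ j → l j ≤ l i
antitone {l} dec {i} {zero}  z≤n = ≤-refl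
antitone {l} dec {i} {suc j} i≤j with m≤n⇒m<n∨m≡n i≤j
... | inj₁ (s≤s lt) = ≤-trans (dec j) (antitone dec lt)
... | inj₂ refl     = ≤-refl

antitone-cancel : ∀ {l} → Decreasing l → ∀ {i j} → l i < l j → j < i
antitone-cancel dec {i} {j} lt with j <? i
... | yes j<i = j<i
... | no j≮i  = contradiction (antitone dec (≮⇒≥ j≮i)) (<⇒≱ lt)

Supported : (ℕ → ℕ) → Matrix → Set
Supported l P = ∀ i j → P i j ≡ true → j < l i

unsupported : ∀ {l P} → Supported l P → ∀ {i j} → l i ≤ j → P i j ≡ false
unsupported sup {i} {j} le = ¬-not λ p → <⇒≱ (sup i j p) le

Bottom : (ℕ → ℕ) → ℕ → ℕ → Set
Bottom l i j = j < l i × l (suc i) ≤ j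

bottom-row-unique : ∀ {l} → Decreasing l → ∀ {i i' j} → Bottom l i j → Bottom l i' j → i ≡ i'
bottom-row-unique dec (u , v) (u' , v') =
  ≤-antisym (s≤s⁻¹ (antitone-cancel dec (≤-<-trans v' u)))
            (s≤s⁻¹ (antitone-cancel dec (≤-<-trans v u')))

NoBottomPointAfter : (ℕ → ℕ) → Matrix → ℕ → Set
NoBottomPointAfter l P b = ∀ i j → b < j → Bottom l i j → P i j ≡ false

record Special (l : ℕ → ℕ) (P : Matrix) (i j : ℕ) : Set where
  constructor special-at
  field
    bottom    : Bottom l i j
    pointed   : P i j ≡ true
    rightmost : NoBottomPointAfter l P j

special-unique : ∀ {l P} → Decreasing l → ∀ {i j i' j'} →
                 Special l P i j → Special l P i' j' → i ≡ i' × j ≡ j'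
special-unique {l} {P} dec {i} {j} {i'} {j'} (special-at bt p r) (special-at bt' p' r') with <-cmp j j'
... | tri< lt _ _ = contradiction (r i' j' lt bt') (true≢false p')
... | tri> _ _ gt = contradiction (r' i j gt bt) (true≢false p)
... | tri≈ _ refl _ = bottom-row-unique dec bt bt' , refl

-- l′ arises from l by adding a ribbon whose Southwest end lies in row a and
-- whose Northeast end is the cell (suc i₀ , j₀).
record Ribbon (l l′ : ℕ → ℕ) (a i₀ j₀ : ℕ) : Set where
  field
    above   : ∀ i → i ≤ i₀ → l′ i ≡ l i
    end     : l′ (suc i₀) ≡ suc j₀
    between : ∀ i → i₀ < i → i < a → l′ (suc i) ≡ suc (l i)
    below   : ∀ i → a < i → l′ i ≡ l i

-- l′ arises from l by the ribbon, if any, that turns the corner (a , b) into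
-- the special point.
data Completed (l : ℕ → ℕ) (P : Matrix) (a b : ℕ) (l′ : ℕ → ℕ) : Set where
  none   : NoBottomPointAfter l P b → (∀ i → l′ i ≡ l i) → Completed l P a b l′
  ribbon : ∀ i₀ j₀ → b < j₀ → Special l P i₀ j₀ → Ribbon l l′ a i₀ j₀ → Completed l P a b l′

-- The cell `(a , b)` ends both its row and its column. The new point is in this position before the
-- ribbon is added.
Corner : (ℕ → ℕ) → ℕ → ℕ → Set
Corner l a b = l a ≡ suc b × l (suc a) ≤ b

corner-above : ∀ {l a b} → Decreasing l → Corner l a b → ∀ {i j} → b < j → j < l i → i < a
corner-above dec (la , _) b<j j<li = antitone-cancel dec (≤-<-trans (≤-trans (≤-reflexive la) b<j) j<li)

-- Completion determines the new shape, makes the new point special, and is injective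

module _ {l : ℕ → ℕ} {P : Matrix} {a b : ℕ} (dec : Decreasing l) (sup : Supported l P) (corner : Corner l a b) where

  -- Whether a ribbon is due depends on the presence of a bottom point right of b, and its upper end
  -- is the special point, which is unique. The equations of `Ribbon` then fix every row.
  completed-functional : ∀ {l₁ l₂} → Completed l P a b l₁ → Completed l P a b l₂ → ∀ i → l₁ i ≡ l₂ i
  completed-functional (none _ e₁) (none _ e₂) i = trans (e₁ i) (sym (e₂ i))
  completed-functional (none n _) (ribbon i₀ j₀ b<j₀ (special-at bt p _) _) =
    contradiction (n i₀ j₀ b<j₀ bt) (true≢false p)
  completed-functional (ribbon i₀ j₀ b<j₀ (special-at bt p _) _) (none n _) =
    contradiction (n i₀ j₀ b<j₀ bt) (true≢false p)
  completed-functional {l₁} {l₂} (ribbon i₀ j₀ _ sp₁ r₁) (ribbon i₁ j₁ _ sp₂ r₂)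
    with special-unique dec sp₁ sp₂
  ... | refl , refl = go
    where
    module R₁ = Ribbon r₁
    module R₂ = Ribbon r₂
    go : ∀ i → l₁ i ≡ l₂ i
    go zero = trans (R₁.above 0 z≤n) (sym (R₂.above 0 z≤n))
    go (suc i) with <-cmp i i₀
    ... | tri< lt _ _ = trans (R₁.above _ lt) (sym (R₂.above _ lt))
    ... | tri≈ _ refl _ = trans R₁.end (sym R₂.end)
    ... | tri> _ _ gt with i <? a
    ...   | yes i<a = trans (R₁.between i gt i<a) (sym (R₂.between i gt i<a))
    ...   | no i≮a  = trans (R₁.below _ (s≤s (≮⇒≥ i≮a))) (sym (R₂.below _ (s≤s (≮⇒≥ i≮a))))

  module _ {l′ : ℕ → ℕ} {i₀ j₀ : ℕ} (b<j₀ : b < j₀) (sp : Special l P i₀ j₀) (r : Ribbon l l′ a i₀ j₀) where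
    open Ribbon r
    open Special sp

    i₀<a : i₀ < a
    i₀<a = corner-above dec corner b<j₀ (proj₁ bottom)

    ribbon-grows : ∀ i → l i ≤ l′ i
    ribbon-grows zero = ≤-reflexive (sym (above 0 z≤n))
    ribbon-grows (suc i) with <-cmp i i₀
    ... | tri< lt _ _ = ≤-reflexive (sym (above _ lt))
    ... | tri≈ _ refl _ = ≤-trans (proj₂ bottom) (≤-trans (n≤1+n _) (≤-reflexive (sym end)))
    ... | tri> _ _ gt with i <? a
    ...   | yes i<a = ≤-trans (dec i) (≤-trans (n≤1+n _) (≤-reflexive (sym (between i gt i<a))))
    ...   | no i≮a  = ≤-reflexive (sym (below _ (s≤s (≮⇒≥ i≮a))))

    ribbon-decreasing : Decreasing l′
    ribbon-decreasing i with <-cmp i i₀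
    ... | tri< lt _ _ = subst₂ _≤_ (sym (above _ lt)) (sym (above _ (<⇒≤ lt))) (dec i)
    ... | tri≈ _ refl _ = subst₂ _≤_ (sym end) (sym (above _ ≤-refl)) (proj₁ bottom)
    ... | tri> _ _ gt with i <? a
    ribbon-decreasing (suc i) | tri> _ _ (s≤s i₀≤i) | yes i<a with m≤n⇒m<n∨m≡n i₀≤i
    ... | inj₂ refl = subst₂ _≤_ (sym (between _ ≤-refl i<a)) (sym end) (s≤s (proj₂ bottom))
    ... | inj₁ lt   = subst₂ _≤_ (sym (between _ (s≤s i₀≤i) i<a)) (sym (between _ lt (<⇒≤ i<a))) (s≤s (dec i))
    ribbon-decreasing i | tri> _ _ gt | no i≮a =
      ≤-trans (≤-reflexive (below _ (s≤s (≮⇒≥ i≮a)))) (≤-trans (dec i) (ribbon-grows i))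

    -- Columns right of b that end in row i₀ or above lie right of the old special point or end as
    -- before, so they have no bottom point. Those ending further down, in rows up to a, end in a
    -- cell of the ribbon, which is empty.
    ribbon-special : P a b ≡ true → Special l′ P a b
    ribbon-special p = special-at
      ( ≤-trans (≤-reflexive (sym (proj₁ corner))) (ribbon-grows a)
      , ≤-trans (≤-reflexive (below _ ≤-refl)) (proj₂ corner)) p no-after
      where
      no-after : NoBottomPointAfter l′ P b
      no-after i j b<j (u , v) with <-cmp i i₀
      ... | tri< lt _ _ = rightmost i j
              (<-≤-trans (proj₁ bottom) (≤-trans (antitone dec lt) v'))
              (subst (j <_) (above _ (<⇒≤ lt)) u , v')
              where v' = subst (_≤ j) (above _ lt) v
      ... | tri≈ _ refl _ = rightmost i j j₀<j
              (subst (j <_) (above _ ≤-refl) u , ≤-trans (proj₂ bottom) (<⇒≤ j₀<j))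
              where j₀<j = subst (_≤ j) end v
      ... | tri> _ _ gt with <-cmp i a
      ...   | tri< i<a _ _ = unsupported sup (<⇒≤ (subst (_≤ j) (between i gt i<a) v))
      ...   | tri≈ _ refl _ = unsupported sup (subst (_≤ j) (sym (proj₁ corner)) b<j)
      ...   | tri> _ _ a<i = ⊥-elim (<-irrefl refl (<-≤-trans u
              (≤-trans (≤-reflexive (below i a<i)) (≤-trans (antitone dec a<i) (≤-trans (proj₂ corner) (<⇒≤ b<j))))))

    -- Tells `ribbon` from `none` in the result: without a ribbon, row a ends at the new point.
    ribbon-row : suc b < l′ a
    ribbon-row = go a refl i₀<a
      where
      go : ∀ k → k ≡ a → i₀ < k → suc b < l′ k
      go (suc k) refl (s≤s i₀≤k) with m≤n⇒m<n∨m≡n i₀≤k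
      ... | inj₂ refl = ≤-trans (s≤s b<j₀) (≤-reflexive (sym end))
      ... | inj₁ lt   = ≤-trans (s≤s (≤-trans (≤-reflexive (sym (proj₁ corner))) (dec k)))
                                (≤-reflexive (sym (between k lt ≤-refl)))

  completed-special : ∀ {l′} → P a b ≡ true → Completed l P a b l′ → Special l′ P a b
  completed-special p (none n e) = special-at
    ( ≤-reflexive (trans (sym (proj₁ corner)) (sym (e a)))
    , ≤-trans (≤-reflexive (e _)) (proj₂ corner)) p
    λ i j b<j (u , v) → n i j b<j (subst (j <_) (e i) u , subst (_≤ j) (e _) v)
  completed-special p (ribbon i₀ j₀ b<j₀ sp r) = ribbon-special b<j₀ sp r p

  completed-decreasing : ∀ {l′} → Completed l P a b l′ → Decreasing l′
  completed-decreasing (none _ e) i = subst₂ _≤_ (sym (e _)) (sym (e i)) (dec i)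
  completed-decreasing (ribbon i₀ j₀ b<j₀ sp r) = ribbon-decreasing b<j₀ sp r

  completed-grows : ∀ {l′} → Completed l P a b l′ → ∀ i → l i ≤ l′ i
  completed-grows (none _ e) i = ≤-reflexive (sym (e i))
  completed-grows (ribbon i₀ j₀ b<j₀ sp r) = ribbon-grows b<j₀ sp r

  completed-0 : ∀ {l′} → Completed l P a b l′ → l′ 0 ≡ l 0
  completed-0 (none _ e) = e 0
  completed-0 (ribbon i₀ j₀ b<j₀ sp r) = Ribbon.above r 0 z≤n

-- The Northeast end of the ribbon is read off the result: going up from row
-- a, it is the first row whose last cell has a point just above it.
ribbon-end-≮ : ∀ {l m l′ P a b i₀ j₀ i₁ j₁} → Supported l P → Decreasing m → Corner m a b →
               Ribbon l l′ a i₀ j₀ → b < j₁ → Special m P i₁ j₁ → Ribbon m l′ a i₁ j₁ → ¬ (i₀ < i₁)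
ribbon-end-≮ {i₁ = i₁} {j₁} sup dec corner r b<j₁ (special-at bt p _) r′ lt =
  <-irrefl (suc-injective (trans (sym R′.end) (R.between i₁ lt (corner-above dec corner b<j₁ (proj₁ bt)))))
           (sup i₁ j₁ p)
  where
  module R = Ribbon r
  module R′ = Ribbon r′

module _ {l m : ℕ → ℕ} {P : Matrix} {a b : ℕ} (dec : Decreasing l) (sup : Supported l P) (corner : Corner l a b)
         (dec′ : Decreasing m) (sup′ : Supported m P) (corner′ : Corner m a b) where

  -- The length of row a reveals whether there is a ribbon, and `ribbon-end-≮`, used in both
  -- directions, shows that two ribbons have the same upper end. Then `Ribbon` can be solved for the
  -- old rows, except for row a, whose length both corners prescribe.
  completed-injective : ∀ {l′} → Completed l P a b l′ → Completed m P a b l′ → ∀ i → l i ≡ m i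
  completed-injective (none _ e₁) (none _ e₂) i = trans (sym (e₁ i)) (e₂ i)
  completed-injective (none _ e) (ribbon i₀ j₀ b<j₀ sp r) =
    ⊥-elim (<-irrefl (sym (trans (e a) (proj₁ corner))) (ribbon-row dec′ sup′ corner′ b<j₀ sp r))
  completed-injective (ribbon i₀ j₀ b<j₀ sp r) (none _ e) =
    ⊥-elim (<-irrefl (sym (trans (e a) (proj₁ corner′))) (ribbon-row dec sup corner b<j₀ sp r))
  completed-injective (ribbon i₀ j₀ b<j₀ sp r) (ribbon i₁ j₁ b<j₁ sp′ r′) with <-cmp i₀ i₁
  ... | tri< lt _ _ = ⊥-elim (ribbon-end-≮ sup dec′ corner′ r b<j₁ sp′ r′ lt)
  ... | tri> _ _ gt = ⊥-elim (ribbon-end-≮ sup′ dec corner r′ b<j₀ sp r gt)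
  ... | tri≈ _ refl _ = go
    where
    module R = Ribbon r
    module R′ = Ribbon r′
    go : ∀ i → l i ≡ m i
    go i with i ≤? i₀
    ... | yes le = trans (sym (R.above i le)) (R′.above i le)
    ... | no ≰ with <-cmp i a
    ...   | tri< lt _ _ = suc-injective (trans (sym (R.between i (≰⇒> ≰) lt)) (R′.between i (≰⇒> ≰) lt))
    ...   | tri≈ _ refl _ = trans (proj₁ corner) (sym (proj₁ corner′))
    ...   | tri> _ _ gt = trans (sym (R.below i gt)) (R′.below i gt)

-- Removing the ribbon

search-last : (Q : ℕ → Bool) (n : ℕ) →
  (∃ λ i → i < n × Q i ≡ true × (∀ k → i < k → k < n → Q k ≡ false)) ⊎ (∀ k → k < n → Q k ≡ false)
search-last Q zero = inj₂ λ k ()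
search-last Q (suc n) with Q n in eq
... | true = inj₁ (n , ≤-refl , eq , λ k lt lt' → ⊥-elim (<-irrefl refl (<-≤-trans lt (s≤s⁻¹ lt'))))
... | false with search-last Q n
...   | inj₁ (i , lt , q , max) = inj₁ (i , m≤n⇒m≤1+n lt , q , max′)
  where
  max′ : ∀ k → i < k → k < suc n → Q k ≡ false
  max′ k i<k k<n+1 with m≤n⇒m<n∨m≡n (s≤s⁻¹ k<n+1)
  ... | inj₁ k<n = max k i<k k<n
  ... | inj₂ refl = eq
...   | inj₂ all = inj₂ all′
  where
  all′ : ∀ k → k < suc n → Q k ≡ false
  all′ k k<n+1 with m≤n⇒m<n∨m≡n (s≤s⁻¹ k<n+1)
  ... | inj₁ k<n = all k k<n
  ... | inj₂ refl = eq

suc-pred-< : ∀ {k n} → k < n → suc (pred n) ≡ n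
suc-pred-< (s≤s _) = refl

-- The solution of the equations of `Ribbon` for the old shape. Since `between` relates row `suc i`
-- of the new shape to row i of the old one, the index moves by one; the length of row a comes from
-- `Corner`.
unribbon : (ℕ → ℕ) → ℕ → ℕ → ℕ → ℕ → ℕ
unribbon m a b i₀ i with i ≤? i₀ | <-cmp i a
... | yes _ | _ = m i
... | no _  | tri< _ _ _ = pred (m (suc i))
... | no _  | tri≈ _ _ _ = suc b
... | no _  | tri> _ _ _ = m i

module _ {m : ℕ → ℕ} {a b i₀ : ℕ} where

  unribbon-above : ∀ i → i ≤ i₀ → unribbon m a b i₀ i ≡ m i
  unribbon-above i le with i ≤? i₀ | <-cmp i a
  ... | yes _ | _ = refl
  ... | no ≰  | _ = contradiction le ≰

  unribbon-between : ∀ i → i₀ < i → i < a → unribbon m a b i₀ i ≡ pred (m (suc i))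
  unribbon-between i lt lt' with i ≤? i₀ | <-cmp i a
  ... | yes le | _ = contradiction lt (≤⇒≯ le)
  ... | no _  | tri< _ _ _ = refl
  ... | no _  | tri≈ ≮ _ _ = contradiction lt' ≮
  ... | no _  | tri> ≮ _ _ = contradiction lt' ≮

  unribbon-corner : i₀ < a → unribbon m a b i₀ a ≡ suc b
  unribbon-corner i₀<a with a ≤? i₀ | <-cmp a a
  ... | yes le | _ = contradiction i₀<a (≤⇒≯ le)
  ... | no _  | tri< _ ≢ _ = contradiction refl ≢
  ... | no _  | tri≈ _ _ _ = refl
  ... | no _  | tri> _ ≢ _ = contradiction refl ≢

  unribbon-below : ∀ i → a < i → unribbon m a b i₀ i ≡ m i
  unribbon-below i lt with i ≤? i₀ | <-cmp i a
  ... | yes _ | _ = refl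
  ... | no _  | tri< _ _ ≯ = contradiction lt ≯
  ... | no _  | tri≈ _ _ ≯ = contradiction lt ≯
  ... | no _  | tri> _ _ _ = refl

record Uncompleted (m : ℕ → ℕ) (P : Matrix) (a b : ℕ) : Set where
  field
    l          : ℕ → ℕ
    decreasing : Decreasing l
    supported  : Supported l P
    corner     : Corner l a b
    completed  : Completed l P a b m

module _ {m : ℕ → ℕ} {P : Matrix} {a b : ℕ} (dec : Decreasing m) (sup : Supported m P) (sp : Special m P a b)
         (columns : ∀ j → j < m 0 → ∃ λ i → P i j ≡ true) where
  open Special sp

  private
    not-bottom : ∀ {i j} → b < j → j < m i → P i j ≡ true → j < m (suc i)
    not-bottom {i} {j} b<j j<mi p = ≰⇒> λ le → true≢false p (rightmost i j b<j (j<mi , le))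

  module _ (long : suc b < m a) where

    private
      long-row : ∀ {i} → i ≤ a → suc b < m i
      long-row le = <-≤-trans long (antitone dec le)

      pred-row : ∀ {i} → i ≤ a → suc (pred (m i)) ≡ m i
      pred-row le = suc-pred-< (long-row le)

      b<pred : ∀ {i} → i ≤ a → b < pred (m i)
      b<pred {i} le = s≤s⁻¹ (subst (suc b <_) (sym (pred-row le)) (long-row le))

    -- Otherwise the last column would contain no point.
    ribbon-end-exists : ¬ (∀ k → k < a → P k (pred (m (suc k))) ≡ false)
    ribbon-end-exists no-end with columns (pred (m 0)) (≤-reflexive (pred-row z≤n))
    ... | i , p = true≢false p (trans (cong (P i) (cong pred (sym full))) (no-end i i<a))
      where
      below : pred (m 0) < m (suc i)
      below = not-bottom (b<pred z≤n) (sup i _ p) p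
      full : m (suc i) ≡ m 0
      full = ≤-antisym (antitone dec z≤n) (subst (_≤ m (suc i)) (pred-row z≤n) below)
      i<a : i < a
      i<a = s≤s⁻¹ (antitone-cancel dec (≤-<-trans (proj₂ bottom) (<-trans (b<pred z≤n) below)))

    -- The shape is given by its four equations instead of as `unribbon`, so that the arguments use
    -- these equations and never meet the case distinction in its definition.
    module _ (i₀ : ℕ) (i₀<a : i₀ < a) (end : P i₀ (pred (m (suc i₀))) ≡ true)
             (max : ∀ k → i₀ < k → k < a → P k (pred (m (suc k))) ≡ false)
             (l : ℕ → ℕ) (l-above : ∀ i → i ≤ i₀ → l i ≡ m i)
             (l-between : ∀ i → i₀ < i → i < a → l i ≡ pred (m (suc i)))
             (l-corner : l a ≡ suc b) (l-below : ∀ i → a < i → l i ≡ m i) where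

      private
        j₀ : ℕ
        j₀ = pred (m (suc i₀))

        l-suc : ∀ i → i₀ < i → i ≤ a → l i ≤ pred (m i)
        l-suc i lt le with m≤n⇒m<n∨m≡n le
        ... | inj₁ i<a  = subst (_≤ pred (m i)) (sym (l-between i lt i<a)) (pred-mono-≤ (dec i))
        ... | inj₂ refl = subst (_≤ pred (m i)) (sym l-corner) (b<pred ≤-refl)

        suc-j₀ : suc j₀ ≡ m (suc i₀)
        suc-j₀ = pred-row i₀<a

        l-decreasing : Decreasing l
        l-decreasing i with <-cmp i i₀
        ... | tri< lt _ _ = subst₂ _≤_ (sym (l-above _ lt)) (sym (l-above _ (<⇒≤ lt))) (dec i)
        ... | tri≈ _ refl _ = ≤-trans (l-suc _ ≤-refl i₀<a)
                (subst (pred (m (suc i)) ≤_) (sym (l-above _ ≤-refl)) (≤-trans pred[n]≤n (dec i)))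
        ... | tri> _ _ gt with <-cmp i a
        ...   | tri< i<a _ _ = subst (l (suc i) ≤_) (sym (l-between i gt i<a)) (l-suc (suc i) (m≤n⇒m≤1+n gt) i<a)
        ...   | tri≈ _ refl _ = subst₂ _≤_ (sym (l-below _ ≤-refl)) (sym l-corner) (m≤n⇒m≤1+n (proj₂ bottom))
        ...   | tri> _ _ a<i = subst₂ _≤_ (sym (l-below _ (m≤n⇒m≤1+n a<i))) (sym (l-below _ a<i)) (dec i)

        -- No removed cell is pointed. In row i between i₀ and a, the removed cell in column
        -- `pred (m (suc i))` is empty because i₀ is the last row with a point there; a point
        -- further right would be lowest in its column and lie right of the special point. The
        -- latter also excludes points of row a beyond b.
        l-supported : Supported l P
        l-supported i j p with i ≤? i₀
        ... | yes le = subst (j <_) (sym (l-above i le)) (sup i j p)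
        ... | no ≰ with <-cmp i a
        ...   | tri> _ _ a<i = subst (j <_) (sym (l-below i a<i)) (sup i j p)
        ...   | tri≈ _ refl _ = subst (j <_) (sym l-corner) (s≤s (≮⇒≥ λ b<j →
                  <⇒≱ b<j (≤-trans (<⇒≤ (not-bottom b<j (sup i j p) p)) (proj₂ bottom))))
        ...   | tri< i<a _ _ = subst (j <_) (sym (l-between i (≰⇒> ≰) i<a)) j<pred
          where
          j<pred : j < pred (m (suc i))
          j<pred with <-cmp j (pred (m (suc i)))
          ... | tri< lt _ _ = lt
          ... | tri≈ _ refl _ = contradiction (max i (≰⇒> ≰) i<a) (true≢false p)
          ... | tri> _ _ gt = ⊥-elim (<⇒≱ (not-bottom (<-trans (b<pred i<a) gt) (sup i j p) p)
                                (subst (_≤ j) (pred-row i<a) gt))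

        -- Rows up to i₀ are untouched, so a bottom point right of j₀ in them would also be one of m
        -- beyond b. The lower rows of l do not reach column j₀ at all.
        l-special : Special l P i₀ j₀
        l-special = special-at
          ( subst (j₀ <_) (sym (l-above i₀ ≤-refl)) (≤-trans (≤-reflexive suc-j₀) (dec i₀))
          , l-suc (suc i₀) ≤-refl i₀<a) end no-after
          where
          no-after : NoBottomPointAfter l P j₀
          no-after i j j₀<j (u , v) with <-cmp i i₀
          ... | tri< lt _ _ = rightmost i j (<-trans (b<pred i₀<a) j₀<j)
                  (subst (j <_) (l-above i (<⇒≤ lt)) u , subst (_≤ j) (l-above _ lt) v)
          ... | tri≈ _ refl _ = rightmost i j (<-trans (b<pred i₀<a) j₀<j)
                  (subst (j <_) (l-above i ≤-refl) u , subst (_≤ j) suc-j₀ j₀<j)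
          ... | tri> _ _ gt = ⊥-elim (<⇒≱ (≤-<-trans (≤-trans (antitone l-decreasing gt) (l-suc _ ≤-refl i₀<a)) j₀<j) (<⇒≤ u))

        l-ribbon : Ribbon l m a i₀ j₀
        l-ribbon = record
          { above   = λ i le → sym (l-above i le)
          ; end     = sym suc-j₀
          ; between = λ i lt lt' → trans (sym (pred-row lt')) (cong suc (sym (l-between i lt lt')))
          ; below   = λ i lt → sym (l-below i lt) }

      uncompleted-ribbon : Uncompleted m P a b
      uncompleted-ribbon = record
        { l = l
        ; decreasing = l-decreasing
        ; supported = l-supported
        ; corner = l-corner , subst (_≤ b) (sym (l-below _ ≤-refl)) (proj₂ bottom)
        ; completed = ribbon i₀ j₀ (b<pred i₀<a) l-special l-ribbon }

  uncompleted : Uncompleted m P a b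
  uncompleted with m≤n⇒m<n∨m≡n (proj₁ bottom)
  ... | inj₂ eq = record
    { l = m ; decreasing = dec ; supported = sup ; corner = sym eq , proj₂ bottom
    ; completed = none rightmost (λ _ → refl) }
  -- The index k is the row of the point; the ribbon would end one row lower, in row `suc k`. Taking
  -- the last such k is the search upwards from row a.
  ... | inj₁ long with search-last (λ k → P k (pred (m (suc k)))) a
  ...   | inj₂ no-end = ⊥-elim (ribbon-end-exists long no-end)
  ...   | inj₁ (i₀ , i₀<a , end , max) = uncompleted-ribbon long i₀ i₀<a end max
    (unribbon m a b i₀) (unribbon-above {m}) (unribbon-between {m}) (unribbon-corner {m} i₀<a) (unribbon-below {m})

-- Tree-like tableaux as pairs of shape and points: insertion and deletion without the ribbon

record TreeLike (l : ℕ → ℕ) (P : Matrix) : Set where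
  field
    decreasing : Decreasing l
    supported  : Supported l P
    points     : Points P
    rows       : ∀ i → 0 < l i → ∃ λ j → P i j ≡ true
    columns    : ∀ j → j < l 0 → ∃ λ i → P i j ≡ true

-- Insertion at an edge without the ribbon; the new point is (a , b).
data Inserted (l : ℕ → ℕ) (P : Matrix) (l₀ : ℕ → ℕ) (P₀ : Matrix) (a b : ℕ) : Edge → Set where
  column : 0 < b → l a ≡ b → (∀ i → i ≤ a → l₀ i ≡ suc (l i)) → (∀ i → a < i → l₀ i ≡ l i) →
           ColInserted a b P P₀ → Inserted l P l₀ P₀ a b (rowEnd a)
  row    : 0 < a → l a ≤ b → (∀ i → i < a → b < l i) → (∀ i → l₀ (skip a i) ≡ l i) → l₀ a ≡ suc b →
           RowInserted a b P P₀ → Inserted l P l₀ P₀ a b (colBot b)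

inserted-point : ∀ {l P l₀ P₀ a b e} → Inserted l P l₀ P₀ a b e → P₀ a b ≡ true
inserted-point (column _ _ _ _ ins) = ColInserted.new ins
inserted-point (row _ _ _ _ _ ins)  = ColInserted.new ins

row-before : ∀ {l : ℕ → ℕ} {a} (l₀ : ℕ → ℕ) → (∀ i → l₀ (skip a i) ≡ l i) → ∀ {i} → i < a → l₀ i ≡ l i
row-before {a = a} l₀ eq {i} lt = trans (cong l₀ (sym (skip-< a lt))) (eq i)

row-after : ∀ {l : ℕ → ℕ} {a} (l₀ : ℕ → ℕ) → (∀ i → l₀ (skip a i) ≡ l i) → ∀ {i} → a ≤ i → l₀ (suc i) ≡ l i
row-after {a = a} l₀ eq {i} le = trans (cong l₀ (sym (skip-≥ a le))) (eq i)

inserted-corner : ∀ {l P l₀ P₀ a b e} → Decreasing l → Inserted l P l₀ P₀ a b e → Corner l₀ a b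
inserted-corner {a = a} dec (column _ refl le gt _) =
  le a ≤-refl , ≤-trans (≤-reflexive (gt _ ≤-refl)) (dec a)
inserted-corner {l₀ = l₀} dec (row _ la _ old new _) = new , ≤-trans (≤-reflexive (row-after l₀ old ≤-refl)) la

module _ {l l₀ : ℕ → ℕ} {P P₀ : Matrix} {a b : ℕ} (tl : TreeLike l P) where
  open TreeLike tl

  inserted-decreasing : ∀ {e} → Inserted l P l₀ P₀ a b e → Decreasing l₀
  inserted-decreasing (column _ _ le gt _) i with <-cmp i a
  ... | tri< lt _ _ = subst₂ _≤_ (sym (le _ lt)) (sym (le _ (<⇒≤ lt))) (s≤s (decreasing i))
  ... | tri≈ _ refl _ = subst₂ _≤_ (sym (gt _ ≤-refl)) (sym (le _ ≤-refl)) (m≤n⇒m≤1+n (decreasing i))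
  ... | tri> _ _ a<i = subst₂ _≤_ (sym (gt _ (m≤n⇒m≤1+n a<i))) (sym (gt _ a<i)) (decreasing i)
  inserted-decreasing ins@(row _ la long old new _) i with <-cmp i a
  inserted-decreasing ins@(row _ la long old new _) i | tri< lt _ _ with m≤n⇒m<n∨m≡n lt
  ... | inj₁ lt′ = subst₂ _≤_ (sym (row-before l₀ old lt′)) (sym (row-before l₀ old lt)) (decreasing i)
  ... | inj₂ refl = subst₂ _≤_ (sym new) (sym (row-before l₀ old lt)) (long i lt)
  inserted-decreasing ins@(row _ la long old new _) i | tri≈ _ refl _ =
    subst₂ _≤_ (sym (row-after l₀ old ≤-refl)) (sym new) (m≤n⇒m≤1+n la)
  inserted-decreasing ins@(row _ la long old new _) (suc i) | tri> _ _ (s≤s a≤i) =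
    subst₂ _≤_ (sym (row-after l₀ old (m≤n⇒m≤1+n a≤i))) (sym (row-after l₀ old a≤i)) (decreasing i)

  inserted-supported : ∀ {e} → Inserted l P l₀ P₀ a b e → Supported l₀ P₀
  inserted-supported (column _ refl le gt ins) i j p with skipView b j
  ... | at with ColInserted.row≡ ins p
  ...   | refl = ≤-reflexive (sym (le a ≤-refl))
  inserted-supported (column _ refl le gt ins) i j p | off k with i ≤? a | supported i k (ColInserted.point⁻ ins p)
  ... | yes i≤a | lt = subst (skip b k <_) (sym (le i i≤a)) (skip-suc⁺ b lt)
  ... | no i≰a  | lt = subst₂ _<_ (sym (skip-< b (<-≤-trans lt (antitone decreasing (<⇒≤ (≰⇒> i≰a))))))
                                  (sym (gt i (≰⇒> i≰a))) lt
  inserted-supported (row _ _ _ old new ins) i j p with skipView a i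
  ... | at with ColInserted.row≡ ins p
  ...   | refl = ≤-reflexive (sym new)
  inserted-supported (row _ _ _ old new ins) i j p | off k =
    subst (j <_) (sym (old k)) (supported k j (ColInserted.point⁻ ins p))

  inserted-treeLike : ∀ {e} → Inserted l P l₀ P₀ a b e → TreeLike l₀ P₀
  inserted-treeLike ins = record
    { decreasing = inserted-decreasing ins
    ; supported  = inserted-supported ins
    ; points     = pts ins
    ; rows       = rws ins
    ; columns    = cols ins }
    where
    pts : ∀ {e} → Inserted l P l₀ P₀ a b e → Points P₀
    pts (column 0<b refl _ _ ci) = ColInserted.Points⁺ ci (rows a 0<b) points
    pts (row 0<a _ long _ _ ci) = Points-flip
      (ColInserted.Points⁺ ci (columns b (long 0 0<a)) (Points-flip points))
    rws : ∀ {e} → Inserted l P l₀ P₀ a b e → ∀ i → 0 < l₀ i → ∃ λ j → P₀ i j ≡ true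
    rws (column 0<b refl le gt ci) i pos with i ≤? a
    ... | yes i≤a with rows i (<-≤-trans 0<b (antitone decreasing i≤a))
    ...   | j , p = skip b j , ColInserted.point⁺ ci p
    rws (column 0<b refl le gt ci) i pos | no i≰a with rows i (subst (0 <_) (gt i (≰⇒> i≰a)) pos)
    ...   | j , p = skip b j , ColInserted.point⁺ ci p
    rws (row _ _ _ old new ci) i pos with skipView a i
    ... | at = b , ColInserted.new ci
    ... | off k with rows k (subst (0 <_) (old k) pos)
    ...   | j , p = j , ColInserted.point⁺ ci p
    cols : ∀ {e} → Inserted l P l₀ P₀ a b e → ∀ j → j < l₀ 0 → ∃ λ i → P₀ i j ≡ true
    cols (column 0<b refl le gt ci) j lt with skipView b j
    ... | at = a , ColInserted.new ci
    ... | off k with columns k (skip-suc⁻ b (antitone decreasing z≤n) (subst (skip b k <_) (le 0 z≤n) lt))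
    ...   | i , p = i , ColInserted.point⁺ ci p
    cols (row 0<a _ _ old _ ci) j lt with columns j (subst (j <_) (row-before l₀ old 0<a) lt)
    ... | i , p = skip a i , ColInserted.point⁺ ci p

  module _ {s t : ℕ} (sp : Special l P s t) where
    open Special sp

    private
      column-shift : l a ≡ b → (∀ i → i ≤ a → l₀ i ≡ suc (l i)) → (∀ i → a < i → l₀ i ≡ l i) →
        ∀ {i j} → b ≤ j → Bottom l₀ i (suc j) → Bottom l i j
      column-shift refl le gt {i} {j} b≤j (u , v) with <-cmp i a
      ... | tri< lt _ _ = s≤s⁻¹ (subst (suc j <_) (le i (<⇒≤ lt)) u) , s≤s⁻¹ (subst (_≤ suc j) (le _ lt) v)
      ... | tri≈ _ refl _ = s≤s⁻¹ (subst (suc j <_) (le i ≤-refl) u) , ≤-trans (decreasing i) b≤j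
      ... | tri> _ _ a<i = ⊥-elim (<-irrefl refl (<-≤-trans (subst (suc j <_) (gt i a<i) u)
                              (≤-trans (antitone decreasing (<⇒≤ a<i)) (m≤n⇒m≤1+n b≤j))))

      row-shift : Decreasing l → l a ≤ b → (∀ i → l₀ (skip a i) ≡ l i) → l₀ a ≡ suc b →
        ∀ {i j} → b < j → Bottom l₀ i j → i < a × Bottom l i j
      row-shift dec la old new {i} {j} b<j (u , v) with <-cmp i a
      ... | tri≈ _ refl _ = ⊥-elim (<-irrefl refl (<-≤-trans (subst (j <_) new u) b<j))
      row-shift dec la old new {suc i} {j} b<j (u , v) | tri> _ _ (s≤s a≤i) =
        ⊥-elim (<-irrefl refl (<-trans b<j (<-≤-trans (subst (j <_) (row-after l₀ old a≤i) u)
          (≤-trans (antitone dec a≤i) la))))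
      row-shift dec la old new {i} {j} b<j (u , v) | tri< lt _ _ =
        lt , subst (j <_) (row-before l₀ old lt) u , v′
        where
        v′ : l (suc i) ≤ j
        v′ with m≤n⇒m<n∨m≡n lt
        ... | inj₁ lt′ = subst (_≤ j) (row-before l₀ old lt′) v
        ... | inj₂ refl = ≤-trans la (<⇒≤ b<j)

      row-point : RowInserted a b P P₀ → ∀ {i j} → i < a → P i j ≡ false → P₀ i j ≡ false
      row-point ci {i} {j} lt p = trans (cong (λ k → P₀ k j) (sym (skip-< a lt))) (trans (ColInserted.old ci j i) p)

      col-point : ColInserted a b P P₀ → ∀ {i j} → b ≤ j → P₀ i (suc j) ≡ P i j
      col-point ci {i} {j} le = trans (cong (P₀ i) (sym (skip-≥ b le))) (ColInserted.old ci i j)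

    -- Here `t < l s ≤ l a = b`, so every column beyond the new one was already beyond the special
    -- point.
    inserted-column-NE : Inserted l P l₀ P₀ a b (rowEnd a) → a ≤ s → NoBottomPointAfter l₀ P₀ b
    inserted-column-NE (column 0<b refl le gt ci) a≤s i (suc j) (s≤s b≤j) bt =
      trans (col-point ci b≤j)
        (rightmost i j (<-≤-trans (proj₁ bottom) (≤-trans (antitone decreasing a≤s) b≤j))
           (column-shift refl le gt b≤j bt))

    -- Now `b ≤ t`: the old special point moves one column to the right and is still the rightmost
    -- bottom point of the tableau without ribbon. The ribbon has to end below it.
    inserted-column-SW : Inserted l P l₀ P₀ a b (rowEnd a) → s < a → b < suc t × Special l₀ P₀ s (suc t)
    inserted-column-SW (column 0<b refl le gt ci) s<a = s≤s b≤t , special-at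
      ( subst (suc t <_) (sym (le s (<⇒≤ s<a))) (s≤s (proj₁ bottom))
      , subst (_≤ suc t) (sym (le _ s<a)) (s≤s (proj₂ bottom)))
      (trans (col-point ci b≤t) pointed) no-after
      where
      b≤t : b ≤ t
      b≤t = ≤-trans (antitone decreasing s<a) (proj₂ bottom)
      no-after : NoBottomPointAfter l₀ P₀ (suc t)
      no-after i (suc j) (s≤s t<j) bt = trans (col-point ci b≤j) (rightmost i j t<j (column-shift refl le gt b≤j bt))
        where b≤j = ≤-trans b≤t (<⇒≤ t<j)

    -- The case `t ≡ b` is the bottom edge of the special cell. It is not Northeast of the special
    -- point, but its ribbon is empty, so it belongs with the insertions that add none.
    inserted-row-NE : Inserted l P l₀ P₀ a b (colBot b) → t ≤ b → NoBottomPointAfter l₀ P₀ b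
    inserted-row-NE (row _ la _ old new ci) t≤b i j b<j bt with row-shift decreasing la old new b<j bt
    ... | i<a , bt′ = row-point ci i<a (rightmost i j (≤-<-trans t≤b b<j) bt′)

    inserted-row-SW : Inserted l P l₀ P₀ a b (colBot b) → b < t → Special l₀ P₀ s t
    inserted-row-SW (row _ la long old new ci) b<t = special-at
      (subst (t <_) (sym (row-before l₀ old s<a)) (proj₁ bottom) , below)
      (trans (cong (λ k → P₀ k t) (sym (skip-< a s<a))) (ColInserted.point⁺ ci pointed)) no-after
      where
      s<a : s < a
      s<a = antitone-cancel decreasing (≤-<-trans la (<-trans b<t (proj₁ bottom)))
      below : l₀ (suc s) ≤ t
      below with m≤n⇒m<n∨m≡n s<a
      ... | inj₁ lt = subst (_≤ t) (sym (row-before l₀ old lt)) (proj₂ bottom)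
      ... | inj₂ refl = subst (_≤ t) (sym new) b<t
      no-after : NoBottomPointAfter l₀ P₀ t
      no-after i j t<j bt with row-shift decreasing la old new (<-trans b<t t<j) bt
      ... | i<a , bt′ = row-point ci i<a (rightmost i j t<j bt′)

-- In the mixed cases the insertion of a column gives the new point a point to its left, while the
-- insertion of a row leaves it alone in its row.
inserted-injective : ∀ {l m P Q l₀ m₀ P₀ a b e e′} → TreeLike l P → TreeLike m Q → (∀ i → l₀ i ≡ m₀ i) →
  Inserted l P l₀ P₀ a b e → Inserted m Q m₀ P₀ a b e′ →
  e ≡ e′ × (∀ i → l i ≡ m i) × (∀ i j → P i j ≡ Q i j)
inserted-injective {l} {m} {a = a} tl tm eq (column _ refl le gt ci) (column _ _ le′ gt′ ci′) =
  refl , same , λ i j → trans (sym (ColInserted.old ci i j)) (ColInserted.old ci′ i j)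
  where
  same : ∀ i → l i ≡ m i
  same i with i ≤? a
  ... | yes i≤a = suc-injective (trans (sym (le i i≤a)) (trans (eq i) (le′ i i≤a)))
  ... | no i≰a  = trans (sym (gt i (≰⇒> i≰a))) (trans (eq i) (gt′ i (≰⇒> i≰a)))
inserted-injective {a = a} tl tm eq (row _ _ _ old _ ci) (row _ _ _ old′ _ ci′) =
  refl , (λ i → trans (sym (old i)) (trans (eq _) (old′ i))) ,
  λ i j → trans (sym (ColInserted.old ci j i)) (ColInserted.old ci′ j i)
inserted-injective {a = a} tl tm eq (column 0<b refl _ _ ci) (row _ _ _ _ _ ci′) =
  ⊥-elim (ColInserted.new-¬Above ci′ (ColInserted.new-Left ci (TreeLike.rows tl a 0<b)))
inserted-injective {a = a} tl tm eq (row _ _ _ _ _ ci) (column 0<b refl _ _ ci′) =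
  ⊥-elim (ColInserted.new-¬Above ci (ColInserted.new-Left ci′ (TreeLike.rows tm a 0<b)))

record Uninserted (l₀ : ℕ → ℕ) (P₀ : Matrix) (a b : ℕ) : Set where
  field
    l        : ℕ → ℕ
    P        : Matrix
    e        : Edge
    treeLike : TreeLike l P
    inserted : Inserted l P l₀ P₀ a b e

module _ {l₀ : ℕ → ℕ} {P₀ : Matrix} {a b : ℕ} (tl : TreeLike l₀ P₀) (corner : Corner l₀ a b) (new : P₀ a b ≡ true) where
  open TreeLike tl

  private
    beyond : ∀ {i j} → a < i → b ≤ j → P₀ i j ≡ false
    beyond a<i b≤j = unsupported supported (≤-trans (antitone decreasing a<i) (≤-trans (proj₂ corner) b≤j))

    beyond-row : ∀ {j} → b < j → P₀ a j ≡ false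
    beyond-row b<j = unsupported supported (≤-trans (≤-reflexive (proj₁ corner)) b<j)

  -- Row a contains no point besides `(a , b)`, so only column b loses a point, and it keeps the one
  -- above.
  uninserted-row : Above P₀ a b → ¬ Left P₀ a b → Uninserted l₀ P₀ a b
  uninserted-row (s , s<a , ps) ¬left = record
    { l = l ; P = P ; e = colBot b
    ; treeLike = record
      { decreasing = λ i → antitone decreasing (skip-mono-≤ i)
      ; supported  = λ i j → supported (skip a i) j
      ; points     = Points-flip (ColInserted.Points⁻ ci (s , s<a , ps) (Points-flip points))
      ; rows       = λ i → rows (skip a i)
      ; columns    = cols }
    ; inserted = row (≤-trans (s≤s z≤n) s<a)
        (subst (_≤ b) (cong l₀ (sym (skip-≥ a ≤-refl))) (proj₂ corner)) long (λ _ → refl) (proj₁ corner) ci }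
    where
    l : ℕ → ℕ
    l i = l₀ (skip a i)
    P : Matrix
    P i j = P₀ (skip a i) j
    skip-mono-≤ : ∀ i → skip a i ≤ skip a (suc i)
    skip-mono-≤ i = <⇒≤ (skip-mono-< a ≤-refl)
    new-≢ : ∀ j → j ≢ b → P₀ a j ≡ false
    new-≢ j neq with <-cmp j b
    ... | tri< lt _ _ = ¬-not λ p → ¬left (j , lt , p)
    ... | tri≈ _ eq _ = contradiction eq neq
    ... | tri> _ _ gt = beyond-row gt
    ci : RowInserted a b P P₀
    ci = record { old = λ _ _ → refl ; new = new ; new-≢ = new-≢
                ; no-right = λ i a≤i → beyond (skip->⁺ a a≤i) ≤-refl }
    long : ∀ i → i < a → b < l i
    long i lt = subst (b <_) (cong l₀ (sym (skip-< a lt)))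
                  (≤-trans (≤-reflexive (sym (proj₁ corner))) (antitone decreasing (<⇒≤ lt)))
    cols : ∀ j → j < l 0 → ∃ λ i → P i j ≡ true
    cols j lt with columns j (<-≤-trans lt (antitone decreasing z≤n))
    ... | i , p with skipView a i
    ...   | off k = k , p
    ...   | at with ColInserted.row≡ ci p
    ...     | refl = s , subst (λ k → P₀ k b ≡ true) (sym (skip-< a s<a)) ps

  -- Column b contains no point besides `(a , b)`, and row a keeps the point to its left. Only rows
  -- up to a are shortened, since the lower ones do not reach column b.
  uninserted-column : ¬ Above P₀ a b → Left P₀ a b → Uninserted l₀ P₀ a b
  uninserted-column ¬above left@(t , t<b , pt) = record
    { l = l ; P = P ; e = rowEnd a
    ; treeLike = record
      { decreasing = dec
      ; supported  = sup
      ; points     = ColInserted.Points⁻ ci left points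
      ; rows       = rws
      ; columns    = λ j lt → columns (skip b j)
                       (subst (skip b j <_) (sym (l-≤ 0 z≤n)) (skip-suc⁺ b lt)) }
    ; inserted = column 0<b (suc-injective (trans (sym (l-≤ a ≤-refl)) (proj₁ corner)))
                   l-≤ l-> ci }
    where
    0<b : 0 < b
    0<b = ≤-trans (s≤s z≤n) t<b
    l : ℕ → ℕ
    l i with i ≤? a
    ... | yes _ = pred (l₀ i)
    ... | no _  = l₀ i
    P : Matrix
    P i j = P₀ i (skip b j)
    long : ∀ {i} → i ≤ a → b < l₀ i
    long le = ≤-trans (≤-reflexive (sym (proj₁ corner))) (antitone decreasing le)
    l-≤ : ∀ i → i ≤ a → l₀ i ≡ suc (l i)
    l-≤ i le with i ≤? a
    ... | yes le = sym (suc-pred-< (long le))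
    ... | no ≰  = contradiction le ≰
    l-> : ∀ i → a < i → l₀ i ≡ l i
    l-> i a<i with i ≤? a
    ... | yes le = contradiction a<i (≤⇒≯ le)
    ... | no _   = refl
    dec : Decreasing l
    dec i with <-cmp i a
    ... | tri< lt _ _ = s≤s⁻¹ (subst₂ _≤_ (l-≤ _ lt) (l-≤ _ (<⇒≤ lt)) (decreasing i))
    ... | tri≈ _ refl _ = subst₂ _≤_ (l-> _ ≤-refl) (suc-injective (trans (sym (proj₁ corner)) (l-≤ a ≤-refl))) (proj₂ corner)
    ... | tri> _ _ a<i = subst₂ _≤_ (l-> _ (m≤n⇒m≤1+n a<i)) (l-> _ a<i) (decreasing i)
    sup : Supported l P
    sup i j p with supported i (skip b j) p | i ≤? a
    ... | lt | yes le = skip-suc⁻ b (s≤s⁻¹ (subst (b <_) (sym (suc-pred-< (long le))) (long le)))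
                          (subst (skip b j <_) (sym (suc-pred-< (long le))) lt)
    ... | lt | no ≰ = subst (_< l₀ i) (skip-< b (skip-<⁻ b (<-≤-trans lt (≤-trans (antitone decreasing (≰⇒> ≰)) (proj₂ corner))))) lt
    new-≢ : ∀ i → i ≢ a → P₀ i b ≡ false
    new-≢ i neq with <-cmp i a
    ... | tri< lt _ _ = ¬-not λ p → ¬above (i , lt , p)
    ... | tri≈ _ eq _ = contradiction eq neq
    ... | tri> _ _ gt = beyond gt ≤-refl
    ci : ColInserted a b P P₀
    ci = record { old = λ _ _ → refl ; new = new ; new-≢ = new-≢
                ; no-right = λ j b≤j → beyond-row (skip->⁺ b b≤j) }
    pos : ∀ i → 0 < l i → 0 < l₀ i
    pos i lt with i ≤? a
    ... | yes _ = <-≤-trans lt pred[n]≤n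
    ... | no _  = lt
    rws : ∀ i → 0 < l i → ∃ λ j → P i j ≡ true
    rws i lt with rows i (pos i lt)
    ... | j , p with skipView b j
    ...   | off k = k , p
    ...   | at with ColInserted.row≡ ci p
    ...     | refl = t , subst (λ k → P₀ a k ≡ true) (sym (skip-< b t<b)) pt

  uninserted : ¬ (a ≡ 0 × b ≡ 0) → Uninserted l₀ P₀ a b
  uninserted non-root with Points.parent points a b new non-root
  ... | inj₁ (u , v) = uninserted-row u v
  ... | inj₂ (u , v) = uninserted-column u v

completed-below : ∀ {l P a b l′} → Completed l P a b l′ → ∀ i → a < i → l′ i ≡ l i
completed-below (none _ e) i _ = e i
completed-below (ribbon _ _ _ _ r) = Ribbon.below r

completed-treeLike : ∀ {l P a b l′} → TreeLike l P → Corner l a b → Completed l P a b l′ → TreeLike l′ P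
completed-treeLike {l} {P} {a} {b} {l′} tl corner c = record
  { decreasing = completed-decreasing decreasing supported corner c
  ; supported  = λ i j p → <-≤-trans (supported i j p) (completed-grows decreasing supported corner c i)
  ; points     = points
  ; rows       = rws
  ; columns    = λ j lt → columns j (subst (j <_) (completed-0 decreasing supported corner c) lt) }
  where
  open TreeLike tl
  rws : ∀ i → 0 < l′ i → ∃ λ j → P i j ≡ true
  rws i pos with i ≤? a
  ... | yes le = rows i (≤-trans (s≤s z≤n) (≤-trans (≤-reflexive (sym (proj₁ corner))) (antitone decreasing le)))
  ... | no ≰   = rows i (subst (0 <_) (completed-below c i (≰⇒> ≰)) pos)

uncompleted-treeLike : ∀ {l P a b m} → TreeLike m P → Decreasing l → Supported l P → Corner l a b →
                       Completed l P a b m → TreeLike l P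
uncompleted-treeLike tl dec sup corner c = record
  { decreasing = dec
  ; supported  = sup
  ; points     = points
  ; rows       = λ i pos → rows i (<-≤-trans pos (completed-grows dec sup corner c i))
  ; columns    = λ j lt → columns j (subst (j <_) (sym (completed-0 dec sup corner c)) lt) }
  where open TreeLike tl

-- The tree of a point configuration, and how an insertion changes it

-- The fuel-free version of treeFrom.
data Tree (P : Matrix) : ℕ → ℕ → ETree → Set
data LeftSubtree (P : Matrix) (i j : ℕ) : ETree → Set
data RightSubtree (P : Matrix) (i j : ℕ) : ETree → Set

data Tree P where
  tree : ∀ {i j s t} → LeftSubtree P i j s → RightSubtree P i j t → Tree P i j (enode s t)

data LeftSubtree P i j where
  no-more : (∀ k → i < k → P k j ≡ false) → LeftSubtree P i j (eleaf (colBot j))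
  next : ∀ k {t} → i < k → P k j ≡ true → (∀ h → i < h → h < k → P h j ≡ false) →
          Tree P k j t → LeftSubtree P i j t

data RightSubtree P i j where
  no-more : (∀ k → j < k → P i k ≡ false) → RightSubtree P i j (eleaf (rowEnd i))
  next : ∀ k {t} → j < k → P i k ≡ true → (∀ h → j < h → h < k → P i h ≡ false) →
          Tree P i k t → RightSubtree P i j t

first-unique : ∀ {Q : ℕ → Bool} {i k k'} → i < k → Q k ≡ true → (∀ h → i < h → h < k → Q h ≡ false) →
               i < k' → Q k' ≡ true → (∀ h → i < h → h < k' → Q h ≡ false) → k ≡ k'
first-unique {k = k} {k'} lt q m lt' q' m' with <-cmp k k'
... | tri< u _ _ = contradiction (m' k lt u) (true≢false q)
... | tri≈ _ eq _ = eq
... | tri> _ _ u = contradiction (m k' lt' u) (true≢false q')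

-- Identifies `treeE` of a tableau: any derivation of `Tree` from its root yields the same tree.
Tree-functional  : ∀ {P i j s t} → Tree P i j s → Tree P i j t → s ≡ t
Left-functional  : ∀ {P i j s t} → LeftSubtree P i j s → LeftSubtree P i j t → s ≡ t
Right-functional : ∀ {P i j s t} → RightSubtree P i j s → RightSubtree P i j t → s ≡ t
Tree-functional (tree l r) (tree l' r') = cong₂ enode (Left-functional l l') (Right-functional r r')
Left-functional (no-more _) (no-more _) = refl
Left-functional (no-more empty) (next k lt p _ _) = contradiction (empty k lt) (true≢false p)
Left-functional (next k lt p _ _) (no-more empty) = contradiction (empty k lt) (true≢false p)
Left-functional {P} {j = j} (next k lt p m t) (next k' lt' p' m' t')
  with first-unique {λ h → P h j} lt p m lt' p' m'
... | refl = Tree-functional t t'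
Right-functional (no-more _) (no-more _) = refl
Right-functional (no-more empty) (next k lt p _ _) = contradiction (empty k lt) (true≢false p)
Right-functional (next k lt p _ _) (no-more empty) = contradiction (empty k lt) (true≢false p)
Right-functional {P} {i} (next k lt p m t) (next k' lt' p' m' t')
  with first-unique {P i} lt p m lt' p' m'
... | refl = Tree-functional t t'

bind : ETree → (Edge → ETree) → ETree
bind (eleaf e)   f = f e
bind (enode s t) f = enode (bind s f) (bind t f)

-- Two effects in one substitution: edges are renumbered past the inserted line, and the leaf of the
-- insertion edge becomes the new point, with the bottom of its column and the end of its row as
-- leaves.
columnLeaf rowLeaf : ℕ → ℕ → Edge → ETree
columnLeaf a b (colBot j) = eleaf (colBot (skip b j))
columnLeaf a b (rowEnd i) with i ≟ a
... | yes _ = enode (eleaf (colBot b)) (eleaf (rowEnd a))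
... | no _  = eleaf (rowEnd i)
rowLeaf a b (rowEnd i) = eleaf (rowEnd (skip a i))
rowLeaf a b (colBot j) with j ≟ b
... | yes _ = enode (eleaf (colBot b)) (eleaf (rowEnd a))
... | no _  = eleaf (colBot j)

insertLeaf : ℕ → ℕ → Edge → Edge → ETree
insertLeaf a b (rowEnd _) = columnLeaf a b
insertLeaf a b (colBot _) = rowLeaf a b

module _ {a b : ℕ} {P P₀ : Matrix} (ins : ColInserted a b P P₀) where
  open ColInserted ins

  -- Searches down an old column never meet the new column. Searches along a row cross it, but find
  -- a point there only in row a, and after all old points of that row; so only the search that
  -- ended in the leaf `rowEnd a` changes. That the search starts at a point guarantees that it
  -- starts left of b.
  Tree-column  : ∀ {i j t} → P i j ≡ true → Tree P i j t → Tree P₀ i (skip b j) (bind t (columnLeaf a b))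
  Left-column  : ∀ {i j t} → LeftSubtree P i j t → LeftSubtree P₀ i (skip b j) (bind t (columnLeaf a b))
  Right-column : ∀ {i j t} → P i j ≡ true → RightSubtree P i j t → RightSubtree P₀ i (skip b j) (bind t (columnLeaf a b))
  Tree-column p (tree l r) = tree (Left-column l) (Right-column p r)
  Left-column {i} {j} (no-more empty) = no-more λ k lt → trans (old k j) (empty k lt)
  Left-column {i} {j} (next k lt p m t) =
    next k lt (point⁺ p) (λ h u v → trans (old h j) (m h u v)) (Tree-column p t)
  Right-column {i} {j} p (no-more empty) with i ≟ a
  ... | no neq = no-more empty′
    where
    empty′ : ∀ k → skip b j < k → P₀ i k ≡ false
    empty′ k lt with skipView b k
    ... | at    = new-≢ i neq
    ... | off h = trans (old i h) (empty h (skip-cancel-< b lt))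
  ... | yes refl = next b (subst (_< b) (sym (skip-< b (point-left p))) (point-left p)) new between
                     (tree (no-more λ k a<k → new-≢ k (>⇒≢ a<k)) (no-more no-right′))
    where
    between : ∀ h → skip b j < h → h < b → P₀ i h ≡ false
    between h u v with skipView b h
    ... | at    = contradiction v (<-irrefl refl)
    ... | off k = trans (old i k) (empty k (skip-cancel-< b u))
  Right-column {i} {j} p (next k lt q m t) =
    next (skip b k) (skip-mono-< b lt) (point⁺ q) between (Tree-column q t)
    where
    between : ∀ h → skip b j < h → h < skip b k → P₀ i h ≡ false
    between h u v with skipView b h
    ... | off h' = trans (old i h') (m h' (skip-cancel-< b u) (skip-cancel-< b v))
    ... | at with i ≟ a
    ...   | no neq = new-≢ i neq
    ...   | yes refl = contradiction (no-right k (skip->⁻ b v)) (true≢false q)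

mirrorEdge : Edge → Edge
mirrorEdge (colBot j) = rowEnd j
mirrorEdge (rowEnd i) = colBot i

mirror : ETree → ETree
mirror (eleaf e)   = eleaf (mirrorEdge e)
mirror (enode s t) = enode (mirror t) (mirror s)

Tree-flip  : ∀ {P i j t} → Tree P i j t → Tree (flip P) j i (mirror t)
Left-flip  : ∀ {P i j t} → LeftSubtree P i j t → RightSubtree (flip P) j i (mirror t)
Right-flip : ∀ {P i j t} → RightSubtree P i j t → LeftSubtree (flip P) j i (mirror t)
Tree-flip (tree l r) = tree (Right-flip r) (Left-flip l)
Left-flip (no-more empty) = no-more empty
Left-flip (next k lt p m t) = next k lt p m (Tree-flip t)
Right-flip (no-more empty) = no-more empty
Right-flip (next k lt p m t) = next k lt p m (Tree-flip t)

-- Transposing, substituting for a column and transposing back is the substitution for a row, so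
-- `Tree-row` follows from `Tree-column`.
mirror-bind : ∀ a b t → mirror (bind (mirror t) (columnLeaf b a)) ≡ bind t (rowLeaf a b)
mirror-bind a b (eleaf (rowEnd i)) = refl
mirror-bind a b (eleaf (colBot j)) with j ≟ b
... | yes _ = refl
... | no _  = refl
mirror-bind a b (enode s t) = cong₂ enode (mirror-bind a b s) (mirror-bind a b t)

Tree-row : ∀ {a b P P₀} → RowInserted a b P P₀ → ∀ {i j t} → P i j ≡ true → Tree P i j t →
           Tree P₀ (skip a i) j (bind t (rowLeaf a b))
Tree-row {a} {b} {P₀ = P₀} ins {i} {j} {t} p tr =
  subst (Tree P₀ (skip a i) j) (mirror-bind a b t) (Tree-flip (Tree-column ins p (Tree-flip tr)))

Tree-inserted : ∀ {l P l₀ P₀ a b e t} → Points P → Inserted l P l₀ P₀ a b e →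
                Tree P 0 0 t → Tree P₀ 0 0 (bind t (insertLeaf a b e))
Tree-inserted {P₀ = P₀} {a} {b} {t = t} pts (column 0<b _ _ _ ci) tr =
  subst (λ k → Tree P₀ 0 k (bind t (columnLeaf a b))) (skip-< b 0<b) (Tree-column ci (Points.root pts) tr)
Tree-inserted {P₀ = P₀} {a} {b} {t = t} pts (row 0<a _ _ _ _ ci) tr =
  subst (λ k → Tree P₀ k 0 (bind t (rowLeaf a b))) (skip-< a 0<a) (Tree-row ci (Points.root pts) tr)

-- Tableaux as lists of rows

lookupD-≥ : ∀ {A : Set} (xs : List A) {i d} → length xs ≤ i → lookupD xs i d ≡ d
lookupD-≥ []       _        = refl
lookupD-≥ (x ∷ xs) (s≤s le) = lookupD-≥ xs le

lookupD-map : ∀ {A B : Set} (f : A → B) xs i d → lookupD (map f xs) i (f d) ≡ f (lookupD xs i d)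
lookupD-map f []       i       d = refl
lookupD-map f (x ∷ xs) zero    d = refl
lookupD-map f (x ∷ xs) (suc i) d = lookupD-map f xs i d

lookupD-imapFrom : ∀ {A B : Set} k (f : ℕ → A → B) xs {i} d d' → i < length xs →
                   lookupD (imapFrom k f xs) i d' ≡ f (k + i) (lookupD xs i d)
lookupD-imapFrom k f (x ∷ xs) {zero}  d d' _        rewrite +-identityʳ k = refl
lookupD-imapFrom k f (x ∷ xs) {suc i} d d' (s≤s lt) rewrite +-suc k i = lookupD-imapFrom (suc k) f xs d d' lt

length-imapFrom : ∀ {A B : Set} k (f : ℕ → A → B) xs → length (imapFrom k f xs) ≡ length xs
length-imapFrom k f []       = refl
length-imapFrom k f (x ∷ xs) = cong suc (length-imapFrom (suc k) f xs)

lookupD-insertAt : ∀ {A : Set} p (x : A) xs {d} → p ≤ length xs → lookupD (insertAt p x xs) p d ≡ x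
lookupD-insertAt zero    x xs       _        = refl
lookupD-insertAt (suc p) x (y ∷ ys) (s≤s le) = lookupD-insertAt p x ys le

lookupD-insertAt-skip : ∀ {A : Set} p (x : A) xs i {d} → p ≤ length xs →
                        lookupD (insertAt p x xs) (skip p i) d ≡ lookupD xs i d
lookupD-insertAt-skip zero    x xs       i       _        = refl
lookupD-insertAt-skip (suc p) x (y ∷ ys) zero    (s≤s le) = refl
lookupD-insertAt-skip (suc p) x (y ∷ ys) (suc i) (s≤s le) = lookupD-insertAt-skip p x ys i le

length-insertAt : ∀ {A : Set} p (x : A) xs → length (insertAt p x xs) ≡ suc (length xs)
length-insertAt zero    x xs       = refl
length-insertAt (suc p) x []       = refl
length-insertAt (suc p) x (y ∷ ys) = cong suc (length-insertAt p x ys)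

lookupD-replicate : ∀ n j → lookupD (replicate n false) j false ≡ false
lookupD-replicate zero    j       = refl
lookupD-replicate (suc n) zero    = refl
lookupD-replicate (suc n) (suc j) = lookupD-replicate n j

lookupD-pad : ∀ xs n j → lookupD (xs ++ replicate n false) j false ≡ lookupD xs j false
lookupD-pad []       n j       = lookupD-replicate n j
lookupD-pad (x ∷ xs) n zero    = refl
lookupD-pad (x ∷ xs) n (suc j) = lookupD-pad xs n j

length-extendTo : ∀ {n} xs → length xs ≤ n → length (extendTo n xs) ≡ n
length-extendTo {n} xs le = trans (length-++ xs) (trans (cong (length xs +_) (length-replicate (n ∸ length xs))) (m+[n∸m]≡n le))

newRow : ℕ → List Bool
newRow c = replicate c false ++ [ true ]

lookupD-newRow : ∀ c → lookupD (newRow c) c false ≡ true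
lookupD-newRow zero    = refl
lookupD-newRow (suc c) = lookupD-newRow c

lookupD-newRow-≢ : ∀ c j → j ≢ c → lookupD (newRow c) j false ≡ false
lookupD-newRow-≢ zero    zero    neq = contradiction refl neq
lookupD-newRow-≢ zero    (suc j) neq = refl
lookupD-newRow-≢ (suc c) zero    neq = refl
lookupD-newRow-≢ (suc c) (suc j) neq = lookupD-newRow-≢ c j (neq ∘ cong suc)

length-newRow : ∀ c → length (newRow c) ≡ suc c
length-newRow zero    = refl
length-newRow (suc c) = cong suc (length-newRow c)

T⇒≡true : ∀ {b} → T b → b ≡ true
T⇒≡true = Equivalence.to T-≡

≡true⇒T : ∀ {b} → b ≡ true → T b
≡true⇒T = Equivalence.from T-≡

≤ᵇ-true : ∀ {m n} → m ≤ n → (m ≤ᵇ n) ≡ true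
≤ᵇ-true = T⇒≡true ∘ ≤⇒≤ᵇ

≤ᵇ-false : ∀ {m n} → n < m → (m ≤ᵇ n) ≡ false
≤ᵇ-false {m} {n} lt = ¬-not (<⇒≱ lt ∘ ≤ᵇ⇒≤ m n ∘ ≡true⇒T)

<ᵇ-true : ∀ {m n} → m < n → (m <ᵇ n) ≡ true
<ᵇ-true = T⇒≡true ∘ <⇒<ᵇ

<ᵇ-false : ∀ {m n} → n ≤ m → (m <ᵇ n) ≡ false
<ᵇ-false {m} {n} le = ¬-not (≤⇒≯ le ∘ <ᵇ⇒< m n ∘ ≡true⇒T)

≡ᵇ-true : ∀ n → (n ≡ᵇ n) ≡ true
≡ᵇ-true n = T⇒≡true (≡⇒≡ᵇ n n refl)

≡ᵇ-false : ∀ {m n} → m ≢ n → (m ≡ᵇ n) ≡ false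
≡ᵇ-false {m} {n} neq = ¬-not (neq ∘ ≡ᵇ⇒≡ m n ∘ ≡true⇒T)

PositiveRows : Tab → Set
PositiveRows T = ∀ i → i < length T → 0 < rowLen T i

rowLen-≥ : ∀ T {i} → length T ≤ i → rowLen T i ≡ 0
rowLen-≥ T le = cong length (lookupD-≥ T le)

rowLen-pos : ∀ T {i k} → k < rowLen T i → i < length T
rowLen-pos T {i} {k} pos with i <? length T
... | yes lt = lt
... | no ≮   = contradiction (subst (k <_) (rowLen-≥ T (≮⇒≥ ≮)) pos) λ ()

cell-≥ : ∀ T {i j} → rowLen T i ≤ j → cell T i j ≡ false
cell-≥ T {i} = lookupD-≥ (lookupD T i [])

cell-supported : ∀ T → Supported (rowLen T) (cell T)
cell-supported T i j p = ≰⇒> λ le → true≢false p (cell-≥ T {i} le)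

All⇒PositiveRows : ∀ {T} → All (λ r → 0 < length r) T → PositiveRows T
All⇒PositiveRows (p ∷ ps) zero    _        = p
All⇒PositiveRows (p ∷ ps) (suc i) (s≤s lt) = All⇒PositiveRows ps i lt

PositiveRows⇒All : ∀ T → PositiveRows T → All (λ r → 0 < length r) T
PositiveRows⇒All []      pos = []
PositiveRows⇒All (r ∷ T) pos = pos 0 (s≤s z≤n) ∷ PositiveRows⇒All T (λ i lt → pos (suc i) (s≤s lt))

Linked⇒Decreasing : ∀ {T} → Linked (λ r s → length s ≤ length r) T → Decreasing (rowLen T)
Linked⇒Decreasing []        i       = z≤n
Linked⇒Decreasing [-]       i       = z≤n
Linked⇒Decreasing (le ∷ ls) zero    = le
Linked⇒Decreasing (le ∷ ls) (suc i) = Linked⇒Decreasing ls i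

Decreasing⇒Linked : ∀ T → Decreasing (rowLen T) → Linked (λ r s → length s ≤ length r) T
Decreasing⇒Linked []          dec = []
Decreasing⇒Linked (r ∷ [])    dec = [-]
Decreasing⇒Linked (r ∷ s ∷ T) dec = dec 0 ∷ Decreasing⇒Linked (s ∷ T) (dec ∘ suc)

treeLike⁺ : ∀ {T} → IsTreeLike T → TreeLike (rowLen T) (cell T)
treeLike⁺ {T} ((_ , pos , linked) , root , parent , rows , columns) = record
  { decreasing = Linked⇒Decreasing linked
  ; supported  = cell-supported T
  ; points     = record { root = root ; parent = parent }
  ; rows       = λ i lt → rows i (rowLen-pos T lt)
  ; columns    = columns }

positiveRows : ∀ {T} → IsTreeLike T → PositiveRows T
positiveRows ((_ , pos , _) , _) = All⇒PositiveRows pos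

treeLike⁻ : ∀ {T} → TreeLike (rowLen T) (cell T) → PositiveRows T → IsTreeLike T
treeLike⁻ {T} tl pos =
  ((λ { refl → contradiction (Points.root points) λ () }) , PositiveRows⇒All T pos , Decreasing⇒Linked T decreasing) ,
  Points.root points , Points.parent points , (λ i lt → rows i (pos i lt)) , columns
  where open TreeLike tl

-- A trailing empty row is invisible to `rowLen` and `cell`; positivity of the rows excludes it.
Tab-ext : ∀ {S T} → PositiveRows S → PositiveRows T → (∀ i → rowLen S i ≡ rowLen T i) →
          (∀ i j → cell S i j ≡ cell T i j) → S ≡ T
Tab-ext {[]} {[]} _ _ _ _ = refl
Tab-ext {[]} {t ∷ T} _ pos len _ = contradiction (pos 0 (s≤s z≤n)) (<-irrefl (len 0))
Tab-ext {s ∷ S} {[]} pos _ len _ = contradiction (pos 0 (s≤s z≤n)) (<-irrefl (sym (len 0)))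
Tab-ext {s ∷ S} {t ∷ T} pos pos' len eq = cong₂ _∷_ (row-ext s t (len 0) (eq 0))
  (Tab-ext (λ i lt → pos (suc i) (s≤s lt)) (λ i lt → pos' (suc i) (s≤s lt)) (len ∘ suc) (eq ∘ suc))
  where
  row-ext : ∀ r s → length r ≡ length s → (∀ j → lookupD r j false ≡ lookupD s j false) → r ≡ s
  row-ext []      []      _  _ = refl
  row-ext (x ∷ r) (y ∷ s) le e = cong₂ _∷_ (e 0) (row-ext r s (suc-injective le) (e ∘ suc))

buildRow : (ℕ → Bool) → ℕ → List Bool
buildRow Q zero    = []
buildRow Q (suc n) = Q 0 ∷ buildRow (Q ∘ suc) n

-- The fuel n bounds the number of rows.
build : ℕ → (ℕ → ℕ) → Matrix → Tab
build zero    l P = []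
build (suc n) l P with l 0
... | zero  = []
... | suc k = buildRow (P 0) (suc k) ∷ build n (l ∘ suc) (P ∘ suc)

length-buildRow : ∀ Q n → length (buildRow Q n) ≡ n
length-buildRow Q zero    = refl
length-buildRow Q (suc n) = cong suc (length-buildRow (Q ∘ suc) n)

lookupD-buildRow : ∀ Q n → (∀ j → Q j ≡ true → j < n) → ∀ j → lookupD (buildRow Q n) j false ≡ Q j
lookupD-buildRow Q zero    sup j       = sym (¬-not λ q → contradiction (sup j q) λ ())
lookupD-buildRow Q (suc n) sup zero    = refl
lookupD-buildRow Q (suc n) sup (suc j) = lookupD-buildRow (Q ∘ suc) n (λ k q → s≤s⁻¹ (sup (suc k) q)) j

rowLen-build : ∀ n l P → Decreasing l → l n ≡ 0 → ∀ i → rowLen (build n l P) i ≡ l i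
rowLen-build zero    l P dec ln i = sym (n≤0⇒n≡0 (subst (l i ≤_) ln (antitone dec z≤n)))
rowLen-build (suc n) l P dec ln i with l 0 in eq
rowLen-build (suc n) l P dec ln i       | zero = sym (n≤0⇒n≡0 (subst (l i ≤_) eq (antitone dec z≤n)))
rowLen-build (suc n) l P dec ln zero    | suc k = trans (length-buildRow (P 0) (suc k)) (sym eq)
rowLen-build (suc n) l P dec ln (suc i) | suc k = rowLen-build n (l ∘ suc) (P ∘ suc) (dec ∘ suc) ln i

cell-build : ∀ n l P → Decreasing l → Supported l P → l n ≡ 0 → ∀ i j → cell (build n l P) i j ≡ P i j
cell-build zero    l P dec sup ln i j =
  sym (unsupported sup (≤-trans (subst (l i ≤_) ln (antitone dec z≤n)) z≤n))
cell-build (suc n) l P dec sup ln i j with l 0 in eq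
cell-build (suc n) l P dec sup ln i j | zero =
  sym (unsupported sup (≤-trans (subst (l i ≤_) eq (antitone dec z≤n)) z≤n))
cell-build (suc n) l P dec sup ln zero j | suc k =
  lookupD-buildRow (P 0) (suc k) (λ j p → subst (j <_) eq (sup 0 j p)) j
cell-build (suc n) l P dec sup ln (suc i) j | suc k =
  cell-build n (l ∘ suc) (P ∘ suc) (dec ∘ suc) (sup ∘ suc) ln i j

positiveRows-build : ∀ n l P → PositiveRows (build n l P)
positiveRows-build (suc n) l P i lt with l 0
positiveRows-build (suc n) l P i       () | zero
positiveRows-build (suc n) l P zero    lt | suc k = s≤s z≤n
positiveRows-build (suc n) l P (suc i) lt | suc k = positiveRows-build n (l ∘ suc) (P ∘ suc) i (s≤s⁻¹ lt)

colHeight-∷-< : ∀ r T {c} → c < length r → colHeight (r ∷ T) c ≡ suc (colHeight T c)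
colHeight-∷-< r T {c} lt = cong length (filter-accept (λ r → c <? length r) {r} {T} lt)

colHeight-∷-≮ : ∀ r T {c} → ¬ (c < length r) → colHeight (r ∷ T) c ≡ colHeight T c
colHeight-∷-≮ r T {c} ≮ = cong length (filter-reject (λ r → c <? length r) {r} {T} ≮)

colHeight-0 : ∀ c T → Decreasing (rowLen T) → rowLen T 0 ≤ c → colHeight T c ≡ 0
colHeight-0 c [] dec le = refl
colHeight-0 c (r ∷ T) dec le =
  trans (colHeight-∷-≮ r T (≤⇒≯ le)) (colHeight-0 c T (dec ∘ suc) (≤-trans (dec 0) le))

-- `colHeight` counts the rows longer than c wherever they stand. As lengths decrease these are the
-- topmost ones, so the count is also the index of the first row that does not reach column c.
colHeight-sound : ∀ T → Decreasing (rowLen T) → ∀ {c i} → i < colHeight T c → c < rowLen T i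
colHeight-sound (r ∷ T) dec {c} {i} lt = go i lt (c <? length r)
  where
  go : ∀ i → i < colHeight (r ∷ T) c → Dec (c < length r) → c < rowLen (r ∷ T) i
  go zero    lt (yes c<r) = c<r
  go (suc i) lt (yes c<r) =
    colHeight-sound T (dec ∘ suc) (s≤s⁻¹ (subst (suc i <_) (colHeight-∷-< r T c<r) lt))
  go i       lt (no c≮r)  =
    contradiction (subst (i <_) (colHeight-0 c (r ∷ T) dec (≮⇒≥ c≮r)) lt) λ ()

colHeight-complete : ∀ T → Decreasing (rowLen T) → ∀ {c i} → c < rowLen T i → i < colHeight T c
colHeight-complete (r ∷ T) dec {c} {i} lt = subst (i <_) (sym (colHeight-∷-< r T c<r)) (go i lt)
  where
  c<r : c < length r
  c<r = <-≤-trans lt (antitone dec {0} {i} z≤n)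
  go : ∀ i → c < rowLen (r ∷ T) i → i < suc (colHeight T c)
  go zero    lt = s≤s z≤n
  go (suc i) lt = s≤s (colHeight-complete T (dec ∘ suc) lt)

colHeight-≤ : ∀ T c → colHeight T c ≤ length T
colHeight-≤ T c = length-filter (λ r → c <? length r) T

colHeight-row : ∀ T → Decreasing (rowLen T) → ∀ c → rowLen T (colHeight T c) ≤ c
colHeight-row T dec c = ≮⇒≥ λ lt → <-irrefl refl (colHeight-complete T dec {c} {colHeight T c} lt)

colHeight-bottom : ∀ T → Decreasing (rowLen T) → ∀ {i j} → Bottom (rowLen T) i j → colHeight T j ≡ suc i
colHeight-bottom T dec {i} {j} (u , v) = ≤-antisym
  (≮⇒≥ λ lt → <⇒≱ (colHeight-sound T dec {j} {suc i} lt) v) (colHeight-complete T dec {j} {i} u)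

column-bottom : ∀ T → Decreasing (rowLen T) → ∀ {j} → j < rowLen T 0 → ∃ λ i → Bottom (rowLen T) i j
column-bottom T dec {j} lt with colHeight T j in eq
... | zero  = contradiction (subst (0 <_) eq (colHeight-complete T dec {j} {0} lt)) λ ()
... | suc i = i , colHeight-sound T dec {j} {i} (≤-reflexive (sym eq)) ,
              subst (λ h → rowLen T h ≤ j) eq (colHeight-row T dec j)

ValidEdge : (ℕ → ℕ) → Edge → Set
ValidEdge l (rowEnd i) = 0 < l i
ValidEdge l (colBot j) = j < l 0

-- The operations on lists of rows realise the insertions and the ribbon

module _ (T : Tab) (dec : Decreasing (rowLen T)) (r : ℕ) where
  private
    b : ℕ
    b = rowLen T r

    f : ℕ → List Bool → List Bool
    f i cs = if i ≤ᵇ r then insertAt b (i ≡ᵇ r) cs else cs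

    row-≤ : r < length T → ∀ {i} → i ≤ r → lookupD (insertCol T r) i [] ≡ insertAt b (i ≡ᵇ r) (lookupD T i [])
    row-≤ r<n {i} le = trans (lookupD-imapFrom 0 f T [] [] (≤-<-trans le r<n))
      (cong (λ x → if x then insertAt b (i ≡ᵇ r) (lookupD T i []) else lookupD T i []) (≤ᵇ-true le))

    row-> : ∀ {i} → r < i → lookupD (insertCol T r) i [] ≡ lookupD T i []
    row-> {i} gt with i <? length T
    ... | yes lt = trans (lookupD-imapFrom 0 f T [] [] lt)
      (cong (λ x → if x then insertAt b (i ≡ᵇ r) (lookupD T i []) else lookupD T i []) (≤ᵇ-false gt))
    ... | no ≮ = trans (lookupD-≥ (insertCol T r) (subst (_≤ i) (sym (length-imapFrom 0 f T)) (≮⇒≥ ≮)))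
                       (sym (lookupD-≥ T (≮⇒≥ ≮)))

  insertCol-inserted : 0 < rowLen T r →
    Inserted (rowLen T) (cell T) (rowLen (insertCol T r)) (cell (insertCol T r)) r b (rowEnd r)
  insertCol-inserted 0<b = column 0<b refl
    (λ i le → trans (cong length (row-≤ r<n le)) (length-insertAt b (i ≡ᵇ r) (lookupD T i [])))
    (λ i gt → cong length (row-> gt))
    record { old = old ; new = new ; new-≢ = new-≢ ; no-right = λ j le → cell-≥ T {r} le }
    where
    r<n : r < length T
    r<n = rowLen-pos T 0<b
    short : ∀ {i} → r < i → rowLen T i ≤ b
    short gt = antitone dec (<⇒≤ gt)
    old : ∀ i j → cell (insertCol T r) i (skip b j) ≡ cell T i j
    old i j with i ≤? r
    ... | yes le = trans (cong (λ cs → lookupD cs (skip b j) false) (row-≤ r<n le))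
                         (lookupD-insertAt-skip b (i ≡ᵇ r) (lookupD T i []) j (antitone dec le))
    -- Rows below r are not changed and end at or before column b: entries left of b keep their
    -- index, and from b on both sides read as false.
    ... | no ≰ with j <? b
    ...   | yes lt = trans (cong (λ cs → lookupD cs (skip b j) false) (row-> (≰⇒> ≰)))
                           (cong (cell T i) (skip-< b lt))
    ...   | no ≮ = trans (cong (λ cs → lookupD cs (skip b j) false) (row-> (≰⇒> ≰)))
                     (trans (cell-≥ T {i} (≤-trans (short (≰⇒> ≰)) (<⇒≤ (skip->⁺ b (≮⇒≥ ≮)))))
                            (sym (cell-≥ T {i} (≤-trans (short (≰⇒> ≰)) (≮⇒≥ ≮)))))
    at-b : ∀ {i} → i ≤ r → cell (insertCol T r) i b ≡ (i ≡ᵇ r)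
    at-b {i} le = trans (cong (λ cs → lookupD cs b false) (row-≤ r<n le))
                        (lookupD-insertAt b (i ≡ᵇ r) (lookupD T i []) (antitone dec le))
    new : cell (insertCol T r) r b ≡ true
    new = trans (at-b ≤-refl) (≡ᵇ-true r)
    new-≢ : ∀ i → i ≢ r → cell (insertCol T r) i b ≡ false
    new-≢ i neq with i ≤? r
    ... | yes le = trans (at-b le) (≡ᵇ-false neq)
    ... | no ≰ = trans (cong (λ cs → lookupD cs b false) (row-> (≰⇒> ≰))) (cell-≥ T {i} (short (≰⇒> ≰)))

  insertCol-positive : 0 < rowLen T r → PositiveRows T → PositiveRows (insertCol T r)
  insertCol-positive 0<b pos i lt with i ≤? r
  ... | yes le = subst (0 <_) (sym (trans (cong length (row-≤ (rowLen-pos T 0<b) le))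
                                          (length-insertAt b (i ≡ᵇ r) (lookupD T i [])))) (s≤s z≤n)
  ... | no ≰   = subst (0 <_) (cong length (sym (row-> (≰⇒> ≰)))) (pos i (subst (i <_) (length-imapFrom 0 f T) lt))

module _ (T : Tab) (dec : Decreasing (rowLen T)) (c : ℕ) where
  private
    a : ℕ
    a = colHeight T c

    a≤n : a ≤ length T
    a≤n = colHeight-≤ T c

    row-old : ∀ i → lookupD (insertRow T c) (skip a i) [] ≡ lookupD T i []
    row-old i = lookupD-insertAt-skip a (newRow c) T i a≤n

    row-new : lookupD (insertRow T c) a [] ≡ newRow c
    row-new = lookupD-insertAt a (newRow c) T a≤n

  insertRow-inserted : c < rowLen T 0 →
    Inserted (rowLen T) (cell T) (rowLen (insertRow T c)) (cell (insertRow T c)) a c (colBot c)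
  insertRow-inserted lt = row (colHeight-complete T dec {c} {0} lt) (colHeight-row T dec c)
    (λ i → colHeight-sound T dec {c} {i}) (λ i → cong length (row-old i))
    (trans (cong length row-new) (length-newRow c))
    record
      { old      = λ j i → cong (λ r → lookupD r j false) (row-old i)
      ; new      = trans (cong (λ r → lookupD r c false) row-new) (lookupD-newRow c)
      ; new-≢    = λ j neq → trans (cong (λ r → lookupD r j false) row-new) (lookupD-newRow-≢ c j neq)
      ; no-right = λ i le → cell-≥ T {i} (≤-trans (antitone dec le) (colHeight-row T dec c)) }

  insertRow-positive : PositiveRows T → PositiveRows (insertRow T c)
  insertRow-positive pos i lt with skipView a i
  ... | at    = subst (0 <_) (sym (trans (cong length row-new) (length-newRow c))) (s≤s z≤n)
  ... | off k = subst (0 <_) (cong length (sym (row-old k)))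
                  (pos k (skip-suc⁻ a a≤n (subst (skip a k <_) (length-insertAt a (newRow c) T) lt)))

module _ (T : Tab) (ra i₀ j₀ : ℕ) where
  private
    f : ℕ → List Bool → List Bool
    f i cs = if i ≡ᵇ suc i₀ then extendTo (suc j₀) cs
              else if (suc i₀ <ᵇ i) ∧ (i ≤ᵇ ra) then extendTo (suc (rowLen T (i ∸ 1))) cs else cs

    T′ : Tab
    T′ = addRibbon T ra (suc i₀) j₀

    at-row : ∀ {i} → i < length T → lookupD T′ i [] ≡ f i (lookupD T i [])
    at-row = lookupD-imapFrom 0 f T [] []

    f-above : ∀ {i} cs → i ≤ i₀ → f i cs ≡ cs
    f-above {i} cs le rewrite ≡ᵇ-false (<⇒≢ (s≤s le)) | <ᵇ-false {suc i₀} {i} (m≤n⇒m≤1+n le) = refl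

    f-end : ∀ cs → f (suc i₀) cs ≡ extendTo (suc j₀) cs
    f-end cs rewrite ≡ᵇ-true i₀ = refl

    f-between : ∀ {i} cs → i₀ < i → i < ra → f (suc i) cs ≡ extendTo (suc (rowLen T i)) cs
    f-between {i} cs u v rewrite ≡ᵇ-false (>⇒≢ u) | <ᵇ-true u | ≤ᵇ-true v = refl

    f-below : ∀ {i} cs → i₀ < ra → ra < i → f i cs ≡ cs
    f-below {i} cs u v rewrite ≡ᵇ-false (>⇒≢ (≤-<-trans u v)) | <ᵇ-true (≤-<-trans u v) | ≤ᵇ-false v = refl

    outside : ∀ {i} → (i < length T → f i (lookupD T i []) ≡ lookupD T i []) → lookupD T′ i [] ≡ lookupD T i []
    outside {i} same with i <? length T
    ... | yes lt = trans (at-row lt) (same lt)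
    ... | no ≮ = trans (lookupD-≥ T′ (subst (_≤ i) (sym (length-imapFrom 0 f T)) (≮⇒≥ ≮)))
                       (sym (lookupD-≥ T (≮⇒≥ ≮)))

    f-cell : ∀ i cs j → lookupD (f i cs) j false ≡ lookupD cs j false
    f-cell i cs j with i ≡ᵇ suc i₀ | (suc i₀ <ᵇ i) ∧ (i ≤ᵇ ra)
    ... | true  | _     = lookupD-pad cs (suc j₀ ∸ length cs) j
    ... | false | true  = lookupD-pad cs (suc (rowLen T (i ∸ 1)) ∸ length cs) j
    ... | false | false = refl

  addRibbon-cell : ∀ i j → cell T′ i j ≡ cell T i j
  addRibbon-cell i j with i <? length T
  ... | yes lt = trans (cong (λ r → lookupD r j false) (at-row lt)) (f-cell i (lookupD T i []) j)
  ... | no ≮ = cong (λ r → lookupD r j false) (outside {i} λ lt → contradiction lt ≮)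

  -- `extendTo` never shortens a row, whence the bound on row `suc i₀`. It is `suc j₀` so as to
  -- cover the bottom edge of the special cell, where the new row already has this length.
  addRibbon-ribbon : Decreasing (rowLen T) → i₀ < ra → ra < length T → rowLen T (suc i₀) ≤ suc j₀ →
                     Ribbon (rowLen T) (rowLen T′) ra i₀ j₀
  addRibbon-ribbon dec i₀<ra ra<n short = record
    { above   = λ i le → cong length (outside {i} λ _ → f-above (lookupD T i []) le)
    ; end     = trans (cong length (trans (at-row (≤-<-trans i₀<ra ra<n)) (f-end row₁))) (length-extendTo row₁ short)
    ; between = λ i u v → trans
        (cong length (trans (at-row (≤-<-trans v ra<n)) (f-between (lookupD T (suc i) []) u v)))
        (length-extendTo (lookupD T (suc i) []) (m≤n⇒m≤1+n (dec i)))
    ; below   = λ i gt → cong length (outside {i} λ _ → f-below (lookupD T i []) i₀<ra gt) }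
    where
    row₁ : List Bool
    row₁ = lookupD T (suc i₀) []

  addRibbon-length : length T′ ≡ length T
  addRibbon-length = length-imapFrom 0 f T

-- `special` finds the special point

last-∷ʳ : ∀ {A : Set} (xs : List A) {x} → last (xs ++ [ x ]) ≡ just x
last-∷ʳ []           = refl
last-∷ʳ (y ∷ [])     = refl
last-∷ʳ (y ∷ z ∷ xs) = last-∷ʳ (z ∷ xs)

last-filter-upTo : (Q : ℕ → Bool) (n : ℕ) →
  (∃ λ j → last (filter (λ j → T? (Q j)) (upTo n)) ≡ just j × j < n × Q j ≡ true ×
           (∀ k → j < k → k < n → Q k ≡ false))
  ⊎ (∀ k → k < n → Q k ≡ false)
last-filter-upTo Q n with search-last Q n
... | inj₂ empty = inj₂ empty
... | inj₁ (j , lt , q , max) = inj₁ (j , go n lt max , lt , q , max)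
  where
  Q? : ∀ j → Dec (T (Q j))
  Q? j = T? (Q j)
  go : ∀ n → j < n → (∀ k → j < k → k < n → Q k ≡ false) → last (filter Q? (upTo n)) ≡ just j
  go (suc n) lt max with trans (cong (filter Q?) (sym (upTo-∷ʳ n))) (filter-++ Q? (upTo n) [ n ]) | m≤n⇒m<n∨m≡n (s≤s⁻¹ lt)
  ... | eq | inj₂ refl = trans (cong last (trans eq (cong (filter Q? (upTo n) ++_) (filter-accept Q? (≡true⇒T q)))))
                               (last-∷ʳ (filter Q? (upTo n)))
  ... | eq | inj₁ j<n = trans (cong last (trans eq (trans (cong (filter Q? (upTo n) ++_)
                                (filter-reject Q? λ q → true≢false (T⇒≡true q) (max n j<n ≤-refl))) (++-identityʳ _))))
                              (go n j<n λ k u v → max k u (m≤n⇒m≤1+n v))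

module _ {T : Tab} (tl : TreeLike (rowLen T) (cell T)) where
  open TreeLike tl

  private
    bottom-cell : ∀ {i j} → Bottom (rowLen T) i j → isBottomPointCol T j ≡ cell T i j
    bottom-cell {i} {j} bt = cong (λ h → cell T (h ∸ 1) j) (colHeight-bottom T decreasing bt)

  last-row : ∃ λ i → 0 < rowLen T i × rowLen T (suc i) ≡ 0
  last-row with column-bottom T decreasing (supported 0 0 (Points.root points))
  ... | i , pos , le = i , pos , n≤0⇒n≡0 le

  special-exists : ∃₂ λ s t → special T ≡ just (s , t) × Special (rowLen T) (cell T) s t
  special-exists with last-filter-upTo (isBottomPointCol T) (rowLen T 0)
  -- Some column does end in a point: the last row contains one, and every column meeting that row
  -- ends in it.
  ... | inj₂ empty with last-row
  ...   | i , pos , le with rows i pos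
  ...     | j , p = ⊥-elim (true≢false p (trans (sym (bottom-cell bt))
                      (empty j (<-≤-trans (supported i j p) (antitone decreasing z≤n)))))
    where
    bt : Bottom (rowLen T) i j
    bt = supported i j p , subst (_≤ j) (sym le) z≤n
  special-exists | inj₁ (t , eq , lt , q , max) with column-bottom T decreasing lt
  ... | s , bt = s , t , special-eq , special-at bt (trans (sym (bottom-cell bt)) q)
      λ i j t<j bt' → trans (sym (bottom-cell bt')) (max j t<j (<-≤-trans (proj₁ bt') (antitone decreasing z≤n)))
    where
    special-eq : special T ≡ just (s , t)
    special-eq rewrite eq = cong (λ h → just (h ∸ 1 , t)) (colHeight-bottom T decreasing bt)

-- The border path

rangeFrom : ℕ → ℕ → List ℕ
rangeFrom a zero    = []
rangeFrom a (suc n) = a ∷ rangeFrom (suc a) n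

applyUpTo-rangeFrom : ∀ a n (f : ℕ → ℕ) → (∀ x → f x ≡ a + x) → applyUpTo f n ≡ rangeFrom a n
applyUpTo-rangeFrom a zero    f eq = refl
applyUpTo-rangeFrom a (suc n) f eq = cong₂ _∷_ (trans (eq 0) (+-identityʳ a))
  (applyUpTo-rangeFrom (suc a) n (f ∘ suc) λ x → trans (eq (suc x)) (+-suc a x))

range≡rangeFrom : ∀ a b → range a b ≡ rangeFrom a (b ∸ a)
range≡rangeFrom a b = trans (map-upTo (a +_) (b ∸ a)) (applyUpTo-rangeFrom a (b ∸ a) (a +_) λ _ → refl)

length-range : ∀ a b → length (range a b) ≡ b ∸ a
length-range a b = trans (length-map (a +_) (upTo (b ∸ a))) (length-upTo (b ∸ a))

Absent : Edge → List Edge → Set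
Absent e = All λ x → edgeEq e x ≡ false

posOf-absent : ∀ {e} xs ys → Absent e xs → posOf e (xs ++ ys) ≡ length xs + posOf e ys
posOf-absent []       ys []       = refl
posOf-absent (x ∷ xs) ys (p ∷ ps) rewrite p = cong suc (posOf-absent xs ys ps)

posOf-present : ∀ e xs ys → posOf e xs < length xs → posOf e (xs ++ ys) ≡ posOf e xs
posOf-present e (x ∷ xs) ys lt with edgeEq e x
... | true  = refl
... | false = cong suc (posOf-present e xs ys (s≤s⁻¹ lt))

absent-row-range : ∀ i ks → Absent (rowEnd i) (map colBot ks)
absent-row-range i []       = []
absent-row-range i (k ∷ ks) = refl ∷ absent-row-range i ks

absent-row : ∀ {i} k ls → i < k → Absent (rowEnd i) (borderAux k ls)
absent-row k []       lt = []
absent-row {i} k (l ∷ ls) lt = All-++⁺ (absent-row (suc k) ls (m≤n⇒m≤1+n lt))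
  (All-++⁺ (absent-row-range i (range (headD ls) l)) (≡ᵇ-false (<⇒≢ lt) ∷ []))

absent-col-rangeFrom : ∀ {j} a n → a + n ≤ j → Absent (colBot j) (map colBot (rangeFrom a n))
absent-col-rangeFrom a zero    le = []
absent-col-rangeFrom {j} a (suc n) le =
  ≡ᵇ-false (>⇒≢ (≤-trans (s≤s (m≤m+n a n)) le′)) ∷ absent-col-rangeFrom (suc a) n le′
  where
  le′ : suc a + n ≤ j
  le′ = subst (_≤ j) (+-suc a n) le

Row : List ℕ → ℕ → ℕ
Row ls i = lookupD ls i 0

headD≡ : ∀ ls → headD ls ≡ Row ls 0
headD≡ []      = refl
headD≡ (_ ∷ _) = refl

module _ (l : ℕ) (ls : List ℕ) (dec : Decreasing (Row (l ∷ ls))) where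
  head-≤ : headD ls ≤ l
  head-≤ = subst (_≤ l) (sym (headD≡ ls)) (dec 0)

  range-head : range (headD ls) l ≡ rangeFrom (headD ls) (l ∸ headD ls)
  range-head = range≡rangeFrom (headD ls) l

absent-col : ∀ {j} k ls → Decreasing (Row ls) → Row ls 0 ≤ j → Absent (colBot j) (borderAux k ls)
absent-col k []       dec le = []
absent-col {j} k (l ∷ ls) dec le = All-++⁺ (absent-col (suc k) ls (dec ∘ suc) (≤-trans (dec 0) le))
  (All-++⁺ (subst (λ r → Absent (colBot j) (map colBot r)) (sym (range-head l ls dec))
             (absent-col-rangeFrom (headD ls) (l ∸ headD ls) (subst (_≤ j) (sym (m+[n∸m]≡n (head-≤ l ls dec))) le)))
           (refl ∷ []))

length-segment : ∀ k l ls → length (map colBot (range (headD ls) l) ++ [ rowEnd k ]) ≡ suc (l ∸ headD ls)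
length-segment k l ls = trans (length-++ (map colBot (range (headD ls) l))) (trans (+-comm _ 1)
  (cong suc (trans (length-map colBot (range (headD ls) l)) (length-range (headD ls) l))))

length-borderAux : ∀ k ls → Decreasing (Row ls) → length (borderAux k ls) ≡ Row ls 0 + length ls
length-borderAux k []       dec = refl
length-borderAux k (l ∷ ls) dec = begin
  length (borderAux (suc k) ls ++ segment)          ≡⟨ length-++ (borderAux (suc k) ls) ⟩
  length (borderAux (suc k) ls) + length segment    ≡⟨ cong₂ _+_ (length-borderAux (suc k) ls (dec ∘ suc)) (length-segment k l ls) ⟩
  (Row ls 0 + length ls) + suc (l ∸ headD ls)       ≡⟨ cong (λ h → (h + length ls) + suc (l ∸ headD ls)) (sym (headD≡ ls)) ⟩
  (headD ls + length ls) + suc (l ∸ headD ls)       ≡⟨ swap-sum (headD ls) (length ls) (l ∸ headD ls) ⟩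
  (headD ls + (l ∸ headD ls)) + suc (length ls)     ≡⟨ cong (_+ suc (length ls)) (m+[n∸m]≡n (head-≤ l ls dec)) ⟩
  l + suc (length ls)                               ∎
  where
  open ≡-Reasoning
  segment : List Edge
  segment = map colBot (range (headD ls) l) ++ [ rowEnd k ]
  swap-sum : ∀ x y z → (x + y) + suc z ≡ (x + z) + suc y
  swap-sum = solve-∀

posOf-rangeFrom : ∀ a n d ys → d < n → posOf (colBot (a + d)) (map colBot (rangeFrom a n) ++ ys) ≡ d
posOf-rangeFrom a (suc n) zero    ys lt rewrite +-identityʳ a | ≡ᵇ-true a = refl
posOf-rangeFrom a (suc n) (suc d) ys (s≤s lt) rewrite +-suc a d | ≡ᵇ-false {suc (a + d)} {a} (>⇒≢ (s≤s (m≤m+n a d))) =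
  cong suc (posOf-rangeFrom (suc a) n d ys lt)

-- The path begins at the Southwest, so lower rows come first. For the top row of the list they
-- contribute `headD ls` horizontal and `length ls` vertical edges, and `l ∸ headD ls` horizontal
-- edges precede the row end itself.
posOf-row : ∀ k ls i → Decreasing (Row ls) → i < length ls →
            posOf (rowEnd (k + i)) (borderAux k ls) ≡ Row ls i + (length ls ∸ suc i)
posOf-row k (l ∷ ls) zero dec lt rewrite +-identityʳ k = begin
  posOf (rowEnd k) (borderAux (suc k) ls ++ map colBot r ++ [ rowEnd k ])
    ≡⟨ posOf-absent (borderAux (suc k) ls) _ (absent-row (suc k) ls ≤-refl) ⟩
  length (borderAux (suc k) ls) + posOf (rowEnd k) (map colBot r ++ [ rowEnd k ])
    ≡⟨ cong₂ _+_ (trans (length-borderAux (suc k) ls (dec ∘ suc)) (cong (_+ length ls) (sym (headD≡ ls)))) (begin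
         posOf (rowEnd k) (map colBot r ++ [ rowEnd k ])    ≡⟨ posOf-absent (map colBot r) _ (absent-row-range k r) ⟩
         length (map colBot r) + posOf (rowEnd k) [ rowEnd k ] ≡⟨ cong₂ _+_ (trans (length-map colBot r) (length-range (headD ls) l))
                                                                   (cong (λ b → if b then 0 else 1) (≡ᵇ-true k)) ⟩
         (l ∸ headD ls) + 0                                 ≡⟨ +-identityʳ _ ⟩
         l ∸ headD ls                                       ∎) ⟩
  (headD ls + length ls) + (l ∸ headD ls)   ≡⟨ swap-sum (headD ls) (length ls) (l ∸ headD ls) ⟩
  (headD ls + (l ∸ headD ls)) + length ls   ≡⟨ cong (_+ length ls) (m+[n∸m]≡n (head-≤ l ls dec)) ⟩
  l + length ls ∎
  where
  open ≡-Reasoning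
  r : List ℕ
  r = range (headD ls) l
  swap-sum : ∀ x y z → (x + y) + z ≡ (x + z) + y
  swap-sum = solve-∀
posOf-row k (l ∷ ls) (suc i) dec (s≤s lt) =
  trans (posOf-present (rowEnd (k + suc i)) (borderAux (suc k) ls) _
           (subst₂ _<_ (sym ih) (sym (length-borderAux (suc k) ls (dec ∘ suc)))
             (+-mono-≤-< (antitone {Row ls} (dec ∘ suc) {0} {i} z≤n) (∸-monoʳ-< {length ls} {suc i} {0} (s≤s z≤n) lt)))) ih
  where
  ih : posOf (rowEnd (k + suc i)) (borderAux (suc k) ls) ≡ Row ls i + (length ls ∸ suc i)
  ih = trans (cong (λ m → posOf (rowEnd m) (borderAux (suc k) ls)) (+-suc k i)) (posOf-row (suc k) ls i (dec ∘ suc) lt)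

posOf-col : ∀ k ls i {j} → Decreasing (Row ls) → Bottom (Row ls) i j →
            posOf (colBot j) (borderAux k ls) ≡ j + (length ls ∸ suc i)
posOf-col k (l ∷ ls) zero {j} dec (u , v) = begin
  posOf (colBot j) (borderAux (suc k) ls ++ map colBot (range h l) ++ [ rowEnd k ])
    ≡⟨ posOf-absent (borderAux (suc k) ls) _ (absent-col (suc k) ls (dec ∘ suc) v) ⟩
  length (borderAux (suc k) ls) + posOf (colBot j) (map colBot (range h l) ++ [ rowEnd k ])
    ≡⟨ cong₂ _+_ (trans (length-borderAux (suc k) ls (dec ∘ suc)) (cong (_+ length ls) (sym (headD≡ ls)))) offset ⟩
  (h + length ls) + (j ∸ h)   ≡⟨ swap-sum h (length ls) (j ∸ h) ⟩
  (h + (j ∸ h)) + length ls   ≡⟨ cong (_+ length ls) (m+[n∸m]≡n h≤j) ⟩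
  j + length ls ∎
  where
  open ≡-Reasoning
  h : ℕ
  h = headD ls
  h≤j : h ≤ j
  h≤j = subst (_≤ j) (sym (headD≡ ls)) v
  swap-sum : ∀ x y z → (x + y) + z ≡ (x + z) + y
  swap-sum = solve-∀
  offset : posOf (colBot j) (map colBot (range h l) ++ [ rowEnd k ]) ≡ j ∸ h
  offset = subst₂ (λ x r → posOf (colBot x) (map colBot r ++ [ rowEnd k ]) ≡ j ∸ h)
    (m+[n∸m]≡n h≤j) (sym (range-head l ls dec))
    (posOf-rangeFrom h (l ∸ h) (j ∸ h) [ rowEnd k ] (∸-monoˡ-< u h≤j))
posOf-col k (l ∷ ls) (suc i) {j} dec (u , v) =
  trans (posOf-present (colBot j) (borderAux (suc k) ls) _
           (subst₂ _<_ (sym ih) (sym (length-borderAux (suc k) ls (dec ∘ suc)))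
             (+-mono-<-≤ (<-≤-trans u (antitone {Row ls} (dec ∘ suc) {0} {i} z≤n)) (m∸n≤m (length ls) (suc i))))) ih
  where
  ih : posOf (colBot j) (borderAux (suc k) ls) ≡ j + (length ls ∸ suc i)
  ih = posOf-col (suc k) ls i (dec ∘ suc) (u , v)

module _ (T : Tab) (dec : Decreasing (rowLen T)) where
  private
    row≡ : ∀ i → Row (map length T) i ≡ rowLen T i
    row≡ i = lookupD-map length T i []

    dec′ : Decreasing (Row (map length T))
    dec′ i = subst₂ _≤_ (sym (row≡ (suc i))) (sym (row≡ i)) (dec i)

    n≡ : length (map length T) ≡ length T
    n≡ = length-map length T

  -- Each edge of the border path is preceded by one edge for every column to
  -- the left of it and every row below it.
  border-row : ∀ {i} → i < length T → posOf (rowEnd i) (border T) ≡ rowLen T i + (length T ∸ suc i)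
  border-row {i} lt = trans (posOf-row 0 (map length T) i dec′ (subst (i <_) (sym n≡) lt))
                            (cong₂ _+_ (row≡ i) (cong (_∸ suc i) n≡))

  border-col : ∀ {i j} → Bottom (rowLen T) i j → posOf (colBot j) (border T) ≡ j + (length T ∸ suc i)
  border-col {i} {j} (u , v) = trans
    (posOf-col 0 (map length T) i dec′ (subst (j <_) (sym (row≡ i)) u , subst (_≤ j) (sym (row≡ (suc i))) v))
    (cong (λ n → j + (n ∸ suc i)) n≡)

  northeast : ℕ → Edge → Bool
  northeast t e = posOf (colBot t) (border T) <ᵇ posOf e (border T)

  module _ {s t : ℕ} (bt : Bottom (rowLen T) s t) where

    -- This and the next three lemmas replace the comparison on the border by one of indices: a row
    -- end is Northeast of the special point when `r ≤ s`, a column bottom when `t < c`. Both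
    -- summands of the position, columns to the left and rows below, are compared separately.
    northeast-row : ∀ {r} → r ≤ s → northeast t (rowEnd r) ≡ true
    northeast-row {r} le = <ᵇ-true (subst₂ _<_ (sym (border-col bt)) (sym (border-row (≤-<-trans le (rowLen-pos T (proj₁ bt)))))
      (+-mono-<-≤ (<-≤-trans (proj₁ bt) (antitone dec le)) (∸-monoʳ-≤ (length T) (s≤s le))))

    ¬northeast-row : ∀ {r} → s < r → r < length T → northeast t (rowEnd r) ≡ false
    ¬northeast-row {r} lt r<n = <ᵇ-false (subst₂ _≤_ (sym (border-row r<n)) (sym (border-col bt))
      (+-mono-≤ (≤-trans (antitone dec lt) (proj₂ bt)) (∸-monoʳ-≤ (length T) (s≤s (<⇒≤ lt)))))

    private
      bottom-order : ∀ {i j i' j'} → Bottom (rowLen T) i j → Bottom (rowLen T) i' j' → j ≤ j' → i' ≤ i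
      bottom-order (u , v) (u' , v') le = s≤s⁻¹ (antitone-cancel dec (≤-<-trans (≤-trans v le) u'))

    northeast-col : ∀ {c} → c < rowLen T 0 → t < c → northeast t (colBot c) ≡ true
    northeast-col {c} valid t<c with column-bottom T dec valid
    ... | i , bt' = <ᵇ-true (subst₂ _<_ (sym (border-col bt)) (sym (border-col bt'))
      (+-mono-<-≤ t<c (∸-monoʳ-≤ (length T) (s≤s (bottom-order bt bt' (<⇒≤ t<c))))))

    ¬northeast-col : ∀ {c} → c < rowLen T 0 → c ≤ t → northeast t (colBot c) ≡ false
    ¬northeast-col {c} valid c≤t with column-bottom T dec valid
    ... | i , bt' = <ᵇ-false (subst₂ _≤_ (sym (border-col bt')) (sym (border-col bt))
      (+-mono-≤ c≤t (∸-monoʳ-≤ (length T) (s≤s (bottom-order bt' bt c≤t)))))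

-- The number of points

countTrue-insertAt-true : ∀ p xs → countTrue (insertAt p true xs) ≡ suc (countTrue xs)
countTrue-insertAt-true zero    xs           = refl
countTrue-insertAt-true (suc p) []           = refl
countTrue-insertAt-true (suc p) (true ∷ xs)  = cong suc (countTrue-insertAt-true p xs)
countTrue-insertAt-true (suc p) (false ∷ xs) = countTrue-insertAt-true p xs

countTrue-insertAt-false : ∀ p xs → countTrue (insertAt p false xs) ≡ countTrue xs
countTrue-insertAt-false zero    xs           = refl
countTrue-insertAt-false (suc p) []           = refl
countTrue-insertAt-false (suc p) (true ∷ xs)  = cong suc (countTrue-insertAt-false p xs)
countTrue-insertAt-false (suc p) (false ∷ xs) = countTrue-insertAt-false p xs

countTrue-extendTo : ∀ n xs → countTrue (extendTo n xs) ≡ countTrue xs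
countTrue-extendTo n xs = go xs (n ∸ length xs)
  where
  go : ∀ xs m → countTrue (xs ++ replicate m false) ≡ countTrue xs
  go []           zero    = refl
  go []           (suc m) = go [] m
  go (true ∷ xs)  m       = cong suc (go xs m)
  go (false ∷ xs) m       = go xs m

countTrue-newRow : ∀ c → countTrue (newRow c) ≡ 1
countTrue-newRow zero    = refl
countTrue-newRow (suc c) = countTrue-newRow c

size-imap-same : ∀ k f T → (∀ i r → k ≤ i → countTrue (f i r) ≡ countTrue r) → size (imapFrom k f T) ≡ size T
size-imap-same k f []      same = refl
size-imap-same k f (r ∷ T) same = cong₂ _+_ (same k r ≤-refl)
  (size-imap-same (suc k) f T λ i r le → same i r (<⇒≤ le))

size-imap-suc : ∀ k f T m → m < length T → (∀ i r → i ≢ k + m → countTrue (f i r) ≡ countTrue r) →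
                (∀ r → countTrue (f (k + m) r) ≡ suc (countTrue r)) → size (imapFrom k f T) ≡ suc (size T)
size-imap-suc k f (r ∷ T) zero _ same one rewrite +-identityʳ k =
  cong₂ _+_ (one r) (size-imap-same (suc k) f T λ i r lt → same i r (>⇒≢ lt))
size-imap-suc k f (r ∷ T) (suc m) (s≤s lt) same one rewrite +-suc k m =
  trans (cong₂ _+_ (same k r (<⇒≢ (s≤s (m≤m+n k m)))) (size-imap-suc (suc k) f T m lt same one)) (+-suc _ _)

size-insertCol : ∀ T r → r < length T → size (insertCol T r) ≡ suc (size T)
size-insertCol T r lt = size-imap-suc 0 f T r lt same one
  where
  f : ℕ → List Bool → List Bool
  f i xs = if i ≤ᵇ r then insertAt (rowLen T r) (i ≡ᵇ r) xs else xs
  same : ∀ i xs → i ≢ r → countTrue (f i xs) ≡ countTrue xs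
  same i xs neq with i ≤ᵇ r
  ... | false = refl
  ... | true rewrite ≡ᵇ-false neq = countTrue-insertAt-false (rowLen T r) xs
  one : ∀ xs → countTrue (f r xs) ≡ suc (countTrue xs)
  one xs rewrite ≤ᵇ-true (≤-refl {r}) | ≡ᵇ-true r = countTrue-insertAt-true (rowLen T r) xs

size-insertAt : ∀ p r T → size (insertAt p r T) ≡ countTrue r + size T
size-insertAt zero    r T       = refl
size-insertAt (suc p) r []      = refl
size-insertAt (suc p) r (s ∷ T) = trans (cong (countTrue s +_) (size-insertAt p r T)) (x∙yz≈y∙xz (countTrue s) (countTrue r) (size T))
  where
  x∙yz≈y∙xz : ∀ x y z → x + (y + z) ≡ y + (x + z)
  x∙yz≈y∙xz = solve-∀

size-insertRow : ∀ T c → size (insertRow T c) ≡ suc (size T)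
size-insertRow T c = trans (size-insertAt (colHeight T c) (newRow c) T) (cong (_+ size T) (countTrue-newRow c))

size-addRibbon : ∀ T ra rb cb → size (addRibbon T ra rb cb) ≡ size T
size-addRibbon T ra rb cb = size-imap-same 0 f T λ i xs _ → same i xs
  where
  f : ℕ → List Bool → List Bool
  f i xs = if i ≡ᵇ rb then extendTo (suc cb) xs
            else if (rb <ᵇ i) ∧ (i ≤ᵇ ra) then extendTo (suc (rowLen T (i ∸ 1))) xs else xs
  same : ∀ i xs → countTrue (f i xs) ≡ countTrue xs
  same i xs with i ≡ᵇ rb | (rb <ᵇ i) ∧ (i ≤ᵇ ra)
  ... | true  | _     = countTrue-extendTo (suc cb) xs
  ... | false | true  = countTrue-extendTo (suc (rowLen T (i ∸ 1))) xs
  ... | false | false = refl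

-- `insertpoint` is an insertion followed by a completion

ColInserted-resp : ∀ {a b P P₀ Q₀} → (∀ i j → Q₀ i j ≡ P₀ i j) → ColInserted a b P P₀ → ColInserted a b P Q₀
ColInserted-resp eq ci = record
  { old      = λ i j → trans (eq i _) (old i j)
  ; new      = trans (eq _ _) new
  ; new-≢    = λ i neq → trans (eq i _) (new-≢ i neq)
  ; no-right = no-right }
  where open ColInserted ci

Inserted-resp : ∀ {l P l₀ P₀ Q₀ a b e} → (∀ i j → Q₀ i j ≡ P₀ i j) → Inserted l P l₀ P₀ a b e → Inserted l P l₀ Q₀ a b e
Inserted-resp eq (column x y z w ci) = column x y z w (ColInserted-resp eq ci)
Inserted-resp eq (row x y z w v ci)  = row x y z w v (ColInserted-resp (λ j i → eq i j) ci)

Special-resp : ∀ {l P Q i j} → (∀ i j → Q i j ≡ P i j) → Special l P i j → Special l Q i j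
Special-resp eq (special-at bt p r) = special-at bt (trans (eq _ _) p) λ i j lt bt → trans (eq i j) (r i j lt bt)

-- One specification for both branches of `insertpoint`. The tableau before the ribbon appears only
-- as a shape `l₀`: its points are those of `T′`, as the ribbon is empty.
record Insertion (T : Tab) (e : Edge) (T′ : Tab) : Set where
  field
    {a b}     : ℕ
    {l₀}      : ℕ → ℕ
    inserted  : Inserted (rowLen T) (cell T) l₀ (cell T′) a b e
    completed : Completed l₀ (cell T′) a b (rowLen T′)
    positive  : PositiveRows T′
    size-suc  : size T′ ≡ suc (size T)

module _ {T : Tab} (treeLike : IsTreeLike T) where
  private
    tl : TreeLike (rowLen T) (cell T)
    tl = treeLike⁺ treeLike
  open TreeLike tl

  plain-insertion : ∀ {e a b T₀} → Inserted (rowLen T) (cell T) (rowLen T₀) (cell T₀) a b e → PositiveRows T₀ →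
    size T₀ ≡ suc (size T) → NoBottomPointAfter (rowLen T₀) (cell T₀) b → Insertion T e T₀
  plain-insertion ins pos sz clear = record
    { inserted = ins ; completed = none clear (λ _ → refl) ; positive = pos ; size-suc = sz }

  ribbon-insertion : ∀ {e a b T₀ s t} → Inserted (rowLen T) (cell T) (rowLen T₀) (cell T₀) a b e → PositiveRows T₀ →
    size T₀ ≡ suc (size T) → b < t → Special (rowLen T₀) (cell T₀) s t → Insertion T e (addRibbon T₀ a (suc s) t)
  ribbon-insertion {e} {a} {b} {T₀} {s} {t} ins pos sz b<t sp = record
    { inserted  = Inserted-resp same ins
    ; completed = ribbon s t b<t (Special-resp same sp) rib
    ; positive  = λ i lt → <-≤-trans (pos i (subst (i <_) (addRibbon-length T₀ a s t) lt))
                    (completed-grows dec₀ (cell-supported T₀) corner (ribbon s t b<t sp rib) i)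
    ; size-suc  = trans (size-addRibbon T₀ a (suc s) t) sz }
    where
    same : ∀ i j → cell (addRibbon T₀ a (suc s) t) i j ≡ cell T₀ i j
    same = addRibbon-cell T₀ a s t
    dec₀ : Decreasing (rowLen T₀)
    dec₀ = inserted-decreasing tl ins
    corner : Corner (rowLen T₀) a b
    corner = inserted-corner decreasing ins
    rib : Ribbon (rowLen T₀) (rowLen (addRibbon T₀ a (suc s) t)) a s t
    rib = addRibbon-ribbon T₀ a s t dec₀
      (corner-above dec₀ corner b<t (proj₁ (Special.bottom sp)))
      (rowLen-pos T₀ (≤-reflexive (sym (proj₁ corner))))
      (m≤n⇒m≤1+n (proj₂ (Special.bottom sp)))

  -- The edge at the bottom of the special cell (s , b): the ribbon is empty.
  trivial-insertion : ∀ {e a b T₀ s} → a ≡ suc s → Inserted (rowLen T) (cell T) (rowLen T₀) (cell T₀) a b e →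
    PositiveRows T₀ → size T₀ ≡ suc (size T) → NoBottomPointAfter (rowLen T₀) (cell T₀) b →
    Insertion T e (addRibbon T₀ a (suc s) b)
  trivial-insertion {e} {_} {b} {T₀} {s} refl ins pos sz clear = record
    { inserted  = Inserted-resp same ins
    ; completed = none (λ i j lt bt → trans (same i j) (clear i j lt bt)) len
    ; positive  = λ i lt → subst (0 <_) (sym (len i)) (pos i (subst (i <_) (addRibbon-length T₀ (suc s) s b) lt))
    ; size-suc  = trans (size-addRibbon T₀ (suc s) (suc s) b) sz }
    where
    same : ∀ i j → cell (addRibbon T₀ (suc s) (suc s) b) i j ≡ cell T₀ i j
    same = addRibbon-cell T₀ (suc s) s b
    corner : Corner (rowLen T₀) (suc s) b
    corner = inserted-corner decreasing ins
    open Ribbon (addRibbon-ribbon T₀ (suc s) s b (inserted-decreasing tl ins) ≤-refl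
      (rowLen-pos T₀ (≤-reflexive (sym (proj₁ corner)))) (≤-reflexive (proj₁ corner)))
    len : ∀ i → rowLen (addRibbon T₀ (suc s) (suc s) b) i ≡ rowLen T₀ i
    len i with <-cmp i (suc s)
    ... | tri< lt _ _ = above i (s≤s⁻¹ lt)
    ... | tri≈ _ refl _ = trans end (sym (proj₁ corner))
    ... | tri> _ _ gt = below i gt

  insertpoint-insertion : ∀ {e} → ValidEdge (rowLen T) e → Insertion T e (insertpoint T e)
  insertpoint-insertion {e} valid with special-exists {T} tl
  ... | s , t , eq , sp = subst (Insertion T e) (sym (unfold eq)) (go e valid)
    where
    completion : ∀ e → Bool → Tab
    completion e b = if b then insertAtEdge T e
      else addRibbon (insertAtEdge T e) (newPointRow T e)
             (suc (proj₁ (shiftedCell T e (s , t)))) (proj₂ (shiftedCell T e (s , t)))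
    unfold : ∀ {e} → special T ≡ just (s , t) → insertpoint T e ≡ completion e (northeast T decreasing t e)
    unfold eq rewrite eq = refl
    bt : Bottom (rowLen T) s t
    bt = Special.bottom sp
    go : ∀ e → ValidEdge (rowLen T) e → Insertion T e (completion e (northeast T decreasing t e))
    go (rowEnd r) valid with r ≤? s
    ... | yes r≤s rewrite northeast-row T decreasing bt r≤s =
      plain-insertion ins (insertCol-positive T decreasing r valid (positiveRows treeLike)) (size-insertCol T r (rowLen-pos T valid))
        (inserted-column-NE tl sp ins r≤s)
      where ins = insertCol-inserted T decreasing r valid
    -- Both tests of `shiftedCell` succeed: the new column passes through row s and lies at or left
    -- of column t, so the special cell is now `(s , suc t)`.
    ... | no r≰s rewrite ¬northeast-row T decreasing bt (≰⇒> r≰s) (rowLen-pos T valid)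
                       | ≤ᵇ-true (≤-trans (antitone decreasing (≰⇒> r≰s)) (proj₂ bt)) | ≤ᵇ-true (<⇒≤ (≰⇒> r≰s)) =
      ribbon-insertion ins (insertCol-positive T decreasing r valid (positiveRows treeLike)) (size-insertCol T r (rowLen-pos T valid))
        (proj₁ sp₀) (proj₂ sp₀)
      where
      ins = insertCol-inserted T decreasing r valid
      sp₀ = inserted-column-SW tl sp ins (≰⇒> r≰s)
    go (colBot c) valid with <-cmp c t
    ... | tri> _ _ t<c rewrite northeast-col T decreasing bt valid t<c =
      plain-insertion ins (insertRow-positive T decreasing c (positiveRows treeLike)) (size-insertRow T c)
        (inserted-row-NE tl sp ins (<⇒≤ t<c))
      where ins = insertRow-inserted T decreasing c valid
    -- Column c has a cell in row s, so the new row is placed below row s and `shiftedCell` leaves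
    -- the special cell where it was. The same holds for `c < t`.
    ... | tri≈ _ refl _ rewrite ¬northeast-col T decreasing bt valid ≤-refl
          | ≤ᵇ-false (colHeight-complete T decreasing {c} {s} (proj₁ bt)) =
      trivial-insertion (colHeight-bottom T decreasing bt) ins
        (insertRow-positive T decreasing c (positiveRows treeLike)) (size-insertRow T c)
        (inserted-row-NE tl sp ins ≤-refl)
      where ins = insertRow-inserted T decreasing c valid
    ... | tri< c<t _ _ rewrite ¬northeast-col T decreasing bt valid (<⇒≤ c<t)
          | ≤ᵇ-false (colHeight-complete T decreasing {c} {s} (<-trans c<t (proj₁ bt))) =
      ribbon-insertion ins (insertRow-positive T decreasing c (positiveRows treeLike)) (size-insertRow T c)
        c<t (inserted-row-SW tl sp ins c<t)
      where ins = insertRow-inserted T decreasing c valid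

module _ {T : Tab} {e : Edge} {T′ : Tab} (treeLike : IsTreeLike T) (I : Insertion T e T′) where
  open Insertion I
  private
    tl : TreeLike (rowLen T) (cell T)
    tl = treeLike⁺ treeLike

  insertion-corner : Corner l₀ a b
  insertion-corner = inserted-corner (TreeLike.decreasing tl) inserted

  insertion-treeLike₀ : TreeLike l₀ (cell T′)
  insertion-treeLike₀ = inserted-treeLike tl inserted

  insertion-treeLike : TreeLike (rowLen T′) (cell T′)
  insertion-treeLike = completed-treeLike insertion-treeLike₀ insertion-corner completed

  insertion-special : Special (rowLen T′) (cell T′) a b
  insertion-special = completed-special (TreeLike.decreasing insertion-treeLike₀)
    (TreeLike.supported insertion-treeLike₀) insertion-corner (inserted-point inserted) completed

  insertion-isTreeLike : IsTreeLike T′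
  insertion-isTreeLike = treeLike⁻ insertion-treeLike positive

insertion-injective : ∀ {S T X e f} → IsTreeLike S → IsTreeLike T → Insertion S e X → Insertion T f X → S ≡ T × e ≡ f
insertion-injective {S} {T} {X} {e} {f} s t I J =
  go (Insertion.inserted J) (Insertion.completed J) (insertion-special t J) (insertion-treeLike₀ t J) (insertion-corner t J)
  where
  open Insertion I
  -- The fields of `J` become arguments so that its new point has variable coordinates, which
  -- `special-unique` can identify with those of `I`.
  go : ∀ {a′ b′ m₀} → Inserted (rowLen T) (cell T) m₀ (cell X) a′ b′ f → Completed m₀ (cell X) a′ b′ (rowLen X) →
       Special (rowLen X) (cell X) a′ b′ → TreeLike m₀ (cell X) → Corner m₀ a′ b′ → S ≡ T × e ≡ f
  go ins comp sp tl₀ corner with special-unique (TreeLike.decreasing (insertion-treeLike s I)) (insertion-special s I) sp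
  ... | refl , refl with inserted-injective (treeLike⁺ s) (treeLike⁺ t)
                         (completed-injective (TreeLike.decreasing (insertion-treeLike₀ s I)) (TreeLike.supported (insertion-treeLike₀ s I))
                            (insertion-corner s I) (TreeLike.decreasing tl₀) (TreeLike.supported tl₀) corner completed comp)
                         inserted ins
  ...   | e≡ , l≡ , P≡ = Tab-ext (positiveRows s) (positiveRows t) l≡ P≡ , e≡

-- Every tableau but the unit one arises by an insertion

module _ {l m : ℕ → ℕ} {P Q : Matrix} (l≡ : ∀ i → m i ≡ l i) (P≡ : ∀ i j → Q i j ≡ P i j) where

  Bottom-resp : ∀ {i j} → Bottom l i j → Bottom m i j
  Bottom-resp {i} {j} (u , v) = subst (j <_) (sym (l≡ i)) u , subst (_≤ j) (sym (l≡ _)) v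

  Bottom-resp⁻ : ∀ {i j} → Bottom m i j → Bottom l i j
  Bottom-resp⁻ {i} {j} (u , v) = subst (j <_) (l≡ i) u , subst (_≤ j) (l≡ _) v

  NoBottomPointAfter-resp : ∀ {b} → NoBottomPointAfter l P b → NoBottomPointAfter m Q b
  NoBottomPointAfter-resp clear i j lt bt = trans (P≡ i j) (clear i j lt (Bottom-resp⁻ bt))

  Completed-resp : ∀ {a b l′} → Completed l P a b l′ → Completed m Q a b l′
  Completed-resp (none clear eq) = none (NoBottomPointAfter-resp clear) λ i → trans (eq i) (sym (l≡ i))
  Completed-resp (ribbon i₀ j₀ lt (special-at bt p clear) r) = ribbon i₀ j₀ lt
    (special-at (Bottom-resp bt) (trans (P≡ _ _) p) (NoBottomPointAfter-resp clear))
    record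
      { above   = λ i u → trans (above i u) (sym (l≡ i))
      ; end     = end
      ; between = λ i u v → trans (between i u v) (cong suc (sym (l≡ i)))
      ; below   = λ i u → trans (below i u) (sym (l≡ i)) }
    where open Ribbon r

  -- `build` realises an abstract pair `(l , P)` up to pointwise equality, so results of a deletion
  -- reach the list it builds through transports of this kind.
  TreeLike-resp : TreeLike l P → TreeLike m Q
  TreeLike-resp tl = record
    { decreasing = λ i → subst₂ _≤_ (sym (l≡ _)) (sym (l≡ i)) (decreasing i)
    ; supported  = λ i j p → subst (j <_) (sym (l≡ i)) (supported i j (from p))
    ; points     = record
      { root   = to root
      ; parent = λ i j p nr → Data.Sum.map
          (λ { ((k , lt , q) , ¬r) → (k , lt , to q) , λ { (h , lt′ , r) → ¬r (h , lt′ , from r) } })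
          (λ { (¬r , (k , lt , q)) → (λ { (h , lt′ , r) → ¬r (h , lt′ , from r) }) , (k , lt , to q) })
          (parent i j (from p) nr) }
    ; rows       = λ i lt → Data.Product.map₂ to (rows i (subst (0 <_) (l≡ i) lt))
    ; columns    = λ j lt → Data.Product.map₂ to (columns j (subst (j <_) (l≡ 0) lt)) }
    where
    open TreeLike tl
    open Points points
    to : ∀ {i j} → P i j ≡ true → Q i j ≡ true
    to p = trans (P≡ _ _) p
    from : ∀ {i j} → Q i j ≡ true → P i j ≡ true
    from p = trans (sym (P≡ _ _)) p

  Inserted-resp-source : ∀ {l₀ P₀ a b e} → Inserted l P l₀ P₀ a b e → Inserted m Q l₀ P₀ a b e
  Inserted-resp-source (column 0<b la le gt ci) = column 0<b (trans (l≡ _) la)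
    (λ i u → trans (le i u) (cong suc (sym (l≡ i)))) (λ i u → trans (gt i u) (sym (l≡ i)))
    record { old = λ i j → trans (old i j) (sym (P≡ i j)) ; new = new ; new-≢ = new-≢
           ; no-right = λ j u → trans (P≡ _ j) (no-right j u) }
    where open ColInserted ci
  Inserted-resp-source (row 0<a la long eq end ci) = row 0<a (subst (_≤ _) (sym (l≡ _)) la)
    (λ i u → subst (_ <_) (sym (l≡ i)) (long i u)) (λ i → trans (eq i) (sym (l≡ i))) end
    record { old = λ j i → trans (old j i) (sym (P≡ i j)) ; new = new ; new-≢ = new-≢
           ; no-right = λ i u → trans (P≡ i _) (no-right i u) }
    where open ColInserted ci

ColInserted-functional : ∀ {a b P P₀ P₁} → ColInserted a b P P₀ → ColInserted a b P P₁ → ∀ i j → P₀ i j ≡ P₁ i j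
ColInserted-functional {a} {b} c d i j with skipView b j
... | off k = trans (ColInserted.old c i k) (sym (ColInserted.old d i k))
... | at with i ≟ a
...   | yes refl = trans (ColInserted.new c) (sym (ColInserted.new d))
...   | no neq   = trans (ColInserted.new-≢ c i neq) (sym (ColInserted.new-≢ d i neq))

-- For a column the edge gives a, and then b is the length of row a. For a row the edge gives b, and
-- a is recovered as the first row that does not reach column b.
inserted-functional : ∀ {l P l₀ l₁ P₀ P₁ a b a′ b′ e} → Inserted l P l₀ P₀ a b e → Inserted l P l₁ P₁ a′ b′ e →
  a ≡ a′ × b ≡ b′ × (∀ i → l₀ i ≡ l₁ i) × (∀ i j → P₀ i j ≡ P₁ i j)
inserted-functional {l₀ = l₀} {l₁} {a = a} (column _ refl le gt ci) (column _ refl le′ gt′ ci′) =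
  refl , refl , same , ColInserted-functional ci ci′
  where
  same : ∀ i → l₀ i ≡ l₁ i
  same i with i ≤? a
  ... | yes i≤a = trans (le i i≤a) (sym (le′ i i≤a))
  ... | no i≰a  = trans (gt i (≰⇒> i≰a)) (sym (gt′ i (≰⇒> i≰a)))
inserted-functional {l₀ = l₀} {l₁} {a = a} {a′ = a′} (row _ la long old new ci) (row _ la′ long′ old′ new′ ci′) with <-cmp a a′
... | tri< lt _ _ = contradiction la (<⇒≱ (long′ a lt))
... | tri> _ _ gt = contradiction la′ (<⇒≱ (long a′ gt))
... | tri≈ _ refl _ = refl , refl , same , λ i j → ColInserted-functional ci ci′ j i
  where
  same : ∀ i → l₀ i ≡ l₁ i
  same i with skipView a i
  ... | at    = trans new (sym new′)
  ... | off k = trans (old k) (sym (old′ k))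

inserted-grows : ∀ {l P l₀ P₀ a b e} → Decreasing l₀ → Inserted l P l₀ P₀ a b e → ∀ i → l i ≤ l₀ i
inserted-grows {a = a} dec (column _ _ le gt _) i with i ≤? a
... | yes i≤a = subst (_ ≤_) (sym (le i i≤a)) (n≤1+n _)
... | no i≰a  = ≤-reflexive (sym (gt i (≰⇒> i≰a)))
inserted-grows {l₀ = l₀} {a = a} dec (row _ _ _ old _ _) i with i <? a
... | yes i<a = ≤-reflexive (sym (row-before l₀ old i<a))
... | no i≮a  = subst (_≤ l₀ i) (row-after l₀ old (≮⇒≥ i≮a)) (dec i)

inserted-valid : ∀ {l P l₀ P₀ a b e} → Inserted l P l₀ P₀ a b e → ValidEdge l e
inserted-valid (column 0<b refl _ _ _)    = 0<b
inserted-valid (row 0<a _ long _ _ _) = long 0 0<a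

-- Column 0 ends in row 0, so there is only one row. A further column would need a point in that
-- row, and this would be a bottom point right of the root.
special-root⇒unitTab : ∀ {T} → IsTreeLike T → Special (rowLen T) (cell T) 0 0 → T ≡ unitTab
special-root⇒unitTab {T} treeLike (special-at (_ , l1≤0) p clear) =
  Tab-ext (positiveRows treeLike) (λ { zero _ → s≤s z≤n ; (suc i) (s≤s ()) }) len cells
  where
  open TreeLike (treeLike⁺ treeLike)
  l-suc : ∀ i → rowLen T (suc i) ≡ 0
  l-suc i = n≤0⇒n≡0 (≤-trans (antitone decreasing (s≤s z≤n)) l1≤0)
  only-column : ∀ j → ¬ (suc j < rowLen T 0)
  only-column j lt with columns (suc j) lt
  ... | zero  , q = true≢false q (clear 0 (suc j) (s≤s z≤n) (lt , ≤-trans l1≤0 z≤n))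
  ... | suc i , q = contradiction (subst (suc j <_) (l-suc i) (supported (suc i) (suc j) q)) λ ()
  len : ∀ i → rowLen T i ≡ rowLen unitTab i
  len zero    = ≤-antisym (≮⇒≥ (only-column 0)) (supported 0 0 p)
  len (suc i) = l-suc i
  cells : ∀ i j → cell T i j ≡ cell unitTab i j
  cells zero    zero    = p
  cells zero    (suc j) = cell-≥ T {0} (≮⇒≥ (only-column j))
  cells (suc i) j       = cell-≥ T {suc i} (≤-trans (≤-reflexive (l-suc i)) z≤n)

-- Ribbon and line are removed on the level of `(l , P)`, and the result is built as a list S. Both
-- X and `insertpoint S e` then arise from S by `Inserted` and `Completed` at the same edge, hence
-- are equal.
remove-special : ∀ {X a b} → IsTreeLike X → ¬ (a ≡ 0 × b ≡ 0) → Special (rowLen X) (cell X) a b →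
  ∃₂ λ S e → IsTreeLike S × ValidEdge (rowLen S) e × insertpoint S e ≡ X
remove-special {X} {a} {b} treeLike non-root sp =
  S , e , isTreeLike , valid ,
  same (Insertion.inserted I) (Insertion.completed I)
  where
  tl′ : TreeLike (rowLen X) (cell X)
  tl′ = treeLike⁺ treeLike
  open Uncompleted (uncompleted (TreeLike.decreasing tl′) (TreeLike.supported tl′) sp (TreeLike.columns tl′))
    renaming (l to l₀)
  tl₀ : TreeLike l₀ (cell X)
  tl₀ = uncompleted-treeLike tl′ decreasing supported corner completed
  open Uninserted (uninserted tl₀ corner (Special.pointed sp) non-root) renaming (treeLike to tl)
  -- Enough rows for `build`: each row of l is at most as long as the row of X with the same index.
  n : ℕ
  n = length X
  l-zero : l n ≡ 0
  l-zero = n≤0⇒n≡0 (≤-trans (inserted-grows decreasing inserted n)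
    (≤-trans (completed-grows decreasing supported corner completed n) (≤-reflexive (rowLen-≥ X ≤-refl))))
  S : Tab
  S = build n l P
  len : ∀ i → rowLen S i ≡ l i
  len = rowLen-build n l P (TreeLike.decreasing tl) l-zero
  cells : ∀ i j → cell S i j ≡ P i j
  cells = cell-build n l P (TreeLike.decreasing tl) (TreeLike.supported tl) l-zero
  isTreeLike : IsTreeLike S
  isTreeLike = treeLike⁻ (TreeLike-resp len cells tl) (positiveRows-build n l P)
  ins : Inserted (rowLen S) (cell S) l₀ (cell X) a b e
  ins = Inserted-resp-source len cells inserted
  valid : ValidEdge (rowLen S) e
  valid = inserted-valid ins
  I : Insertion S e (insertpoint S e)
  I = insertpoint-insertion isTreeLike valid
  same : ∀ {a′ b′ l₁} → Inserted (rowLen S) (cell S) l₁ (cell (insertpoint S e)) a′ b′ e →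
         Completed l₁ (cell (insertpoint S e)) a′ b′ (rowLen (insertpoint S e)) → insertpoint S e ≡ X
  same ins₁ comp₁ with inserted-functional ins ins₁
  ... | refl , refl , l≡ , P≡ = Tab-ext (Insertion.positive I) (positiveRows treeLike)
    (completed-functional decreasing supported corner (Completed-resp l≡ P≡ comp₁) completed)
    (λ i j → sym (P≡ i j))

unit-or-insertpoint : ∀ {X} → IsTreeLike X →
  X ≡ unitTab ⊎ (∃₂ λ T e → IsTreeLike T × ValidEdge (rowLen T) e × insertpoint T e ≡ X)
unit-or-insertpoint {X} treeLike with special-exists {X} (treeLike⁺ treeLike)
... | zero  , zero  , _ , sp = inj₁ (special-root⇒unitTab treeLike sp)
... | zero  , suc t , _ , sp = inj₂ (remove-special treeLike (λ ()) sp)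
... | suc s , t     , _ , sp = inj₂ (remove-special treeLike (λ ()) sp)

-- The fuelled search agrees with `Tree`

firstPointed-rangeFrom : ∀ Q a n →
  (firstPointed Q (rangeFrom a n) ≡ nothing × (∀ k → a ≤ k → k < a + n → Q k ≡ false))
  ⊎ (∃ λ k → firstPointed Q (rangeFrom a n) ≡ just k × a ≤ k × Q k ≡ true × (∀ h → a ≤ h → h < k → Q h ≡ false))
firstPointed-rangeFrom Q a zero = inj₁ (refl , λ k u v → contradiction (<-≤-trans v (≤-reflexive (+-identityʳ a))) (≤⇒≯ u))
firstPointed-rangeFrom Q a (suc n) with Q a in eq
... | true  = inj₂ (a , refl , ≤-refl , eq , λ h u v → contradiction v (≤⇒≯ u))
... | false with firstPointed-rangeFrom Q (suc a) n
...   | inj₁ (e , empty) = inj₁ (e , empty′)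
  where
  empty′ : ∀ k → a ≤ k → k < a + suc n → Q k ≡ false
  empty′ k u v with m≤n⇒m<n∨m≡n u
  ... | inj₁ lt   = empty k lt (subst (k <_) (+-suc a n) v)
  ... | inj₂ refl = eq
...   | inj₂ (k , e , le , q , before) = inj₂ (k , e , <⇒≤ le , q , before′)
  where
  before′ : ∀ h → a ≤ h → h < k → Q h ≡ false
  before′ h u v with m≤n⇒m<n∨m≡n u
  ... | inj₁ lt   = before h lt v
  ... | inj₂ refl = eq

firstPointed-range : ∀ Q i n → (∀ k → n ≤ k → Q k ≡ false) →
  (firstPointed Q (range (suc i) n) ≡ nothing × (∀ k → i < k → Q k ≡ false))
  ⊎ (∃ λ k → firstPointed Q (range (suc i) n) ≡ just k × i < k × Q k ≡ true × (∀ h → i < h → h < k → Q h ≡ false))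
firstPointed-range Q i n beyond rewrite range≡rangeFrom (suc i) n with firstPointed-rangeFrom Q (suc i) (n ∸ suc i)
... | inj₂ found = inj₂ found
... | inj₁ (e , empty) = inj₁ (e , empty′)
  where
  empty′ : ∀ k → i < k → Q k ≡ false
  empty′ k u with k <? n
  ... | yes k<n = empty k u (<-≤-trans k<n (m≤n+m∸n n (suc i)))
  ... | no k≮n  = beyond k (≮⇒≥ k≮n)

fuel-below : ∀ {n i j f k} → n ≤ i + j + suc f → i < k → n ≤ k + j + f
fuel-below {n} {i} {j} {f} {k} le lt = ≤-trans le (≤-trans (≤-reflexive (+-suc (i + j) f))
  (+-monoˡ-≤ f (+-monoˡ-≤ j lt)))

fuel-right : ∀ {n i j f k} → n ≤ i + j + suc f → j < k → n ≤ i + k + f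
fuel-right {n} {i} {j} {f} {k} le lt = subst (λ x → n ≤ x + f) (+-comm k i)
  (fuel-below {n} {j} {i} {f} {k} (subst (λ x → n ≤ x + suc f) (+-comm i j) le) lt)

module _ {T : Tab} (dec : Decreasing (rowLen T)) where

  -- Each step to a child raises `i + j` by at least the unit of fuel it costs, and at a point
  -- `i + j` stays below `length T + rowLen T 0`. Hence the fuel does not run out.
  treeFrom-Tree : ∀ f i j → Pointed T i j → length T + rowLen T 0 ≤ i + j + f → Tree (cell T) i j (treeFrom T f i j)
  treeFrom-Tree zero i j p le = contradiction
    (≤-trans le (≤-reflexive (+-identityʳ (i + j))))
    (<⇒≱ (+-mono-<-≤ (rowLen-pos T j<) (<⇒≤ (<-≤-trans j< (antitone dec z≤n)))))
    where
    j< : j < rowLen T i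
    j< = cell-supported T i j p
  treeFrom-Tree (suc f) i j p le
    with nextBelow T i j | nextRight T i j
       | firstPointed-range (λ i' → cell T i' j) i (length T) (λ k u → cell-≥ T {k} (≤-trans (≤-reflexive (rowLen-≥ T u)) z≤n))
       | firstPointed-range (λ j' → cell T i j') j (rowLen T i) (λ k u → cell-≥ T {i} u)
  ... | _ | _ | inj₁ (refl , empty) | inj₁ (refl , empty′) = tree (no-more empty) (no-more empty′)
  ... | _ | _ | inj₂ (k , refl , lt , q , before) | inj₁ (refl , empty′) =
    tree (next k lt q before (treeFrom-Tree f k j q (fuel-below le lt))) (no-more empty′)
  ... | _ | _ | inj₁ (refl , empty) | inj₂ (k , refl , lt , q , before) =
    tree (no-more empty) (next k lt q before (treeFrom-Tree f i k q (fuel-right le lt)))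
  ... | _ | _ | inj₂ (k , refl , lt , q , before) | inj₂ (k′ , refl , lt′ , q′ , before′) =
    tree (next k lt q before (treeFrom-Tree f k j q (fuel-below le lt)))
         (next k′ lt′ q′ before′ (treeFrom-Tree f i k′ q′ (fuel-right le lt′)))

  treeE-Tree : Pointed T 0 0 → Tree (cell T) 0 0 (treeE T)
  treeE-Tree p = treeFrom-Tree (length T + rowLen T 0) 0 0 p ≤-refl

-- Leaves of the tree

lookupD-++ˡ : ∀ {A : Set} (xs ys : List A) {p d} → p < length xs → lookupD (xs ++ ys) p d ≡ lookupD xs p d
lookupD-++ˡ (x ∷ xs) ys {zero}  _        = refl
lookupD-++ˡ (x ∷ xs) ys {suc p} (s≤s lt) = lookupD-++ˡ xs ys lt

lookupD-++ʳ : ∀ {A : Set} (xs ys : List A) p {d} → lookupD (xs ++ ys) (length xs + p) d ≡ lookupD ys p d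
lookupD-++ʳ []       ys p = refl
lookupD-++ʳ (x ∷ xs) ys p = lookupD-++ʳ xs ys p

lookupD-∈ : ∀ {A : Set} (xs : List A) {p d} → p < length xs → lookupD xs p d ∈ xs
lookupD-∈ (x ∷ xs) {zero}  _        = here refl
lookupD-∈ (x ∷ xs) {suc p} (s≤s lt) = there (lookupD-∈ xs lt)

∈-lookupD : ∀ {A : Set} {x : A} {xs} d → x ∈ xs → ∃ λ p → p < length xs × lookupD xs p d ≡ x
∈-lookupD d (here refl) = 0 , s≤s z≤n , refl
∈-lookupD d (there x∈)  with ∈-lookupD d x∈
... | p , lt , eq = suc p , s≤s lt , eq

lookupD-injective : ∀ {A : Set} {xs : List A} {p q d} → Unique xs → p < length xs → q < length xs →
                    lookupD xs p d ≡ lookupD xs q d → p ≡ q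
lookupD-injective {p = zero}  {zero}  _ _ _ _ = refl
lookupD-injective {xs = x ∷ xs} {zero}  {suc q} (x∉ ∷ _) _ (s≤s lt) eq = contradiction eq (All.lookup x∉ (lookupD-∈ xs lt))
lookupD-injective {xs = x ∷ xs} {suc p} {zero}  (x∉ ∷ _) (s≤s lt) _ eq = contradiction (sym eq) (All.lookup x∉ (lookupD-∈ xs lt))
lookupD-injective {p = suc p} {suc q} (_ ∷ u) (s≤s lt) (s≤s lt′) eq = cong suc (lookupD-injective u lt lt′ eq)

Unique-++⁻ : ∀ {A : Set} (xs : List A) {ys} → Unique (xs ++ ys) → Unique xs × Unique ys × (∀ {x} → x ∈ xs → ¬ (x ∈ ys))
Unique-++⁻ []       u        = [] , u , λ ()
Unique-++⁻ (x ∷ xs) (x∉ ∷ u) with Unique-++⁻ xs u | All-++⁻ xs x∉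
... | uxs , uys , disj | x∉xs , x∉ys = (x∉xs ∷ uxs) , uys ,
  λ { (here refl) y∈ → All.lookup x∉ys y∈ refl ; (there x∈) y∈ → disj x∈ y∈ }

Unique-concatMap : ∀ {A B : Set} (g : A → List B) {xs} → (∀ x → Unique (g x)) →
  (∀ {x y z} → z ∈ g x → z ∈ g y → x ≡ y) → Unique xs → Unique (concatMap g xs)
Unique-concatMap g {[]}     ug disj []       = []
Unique-concatMap g {x ∷ xs} ug disj (x∉ ∷ u) = Unique-++⁺ (ug x) (Unique-concatMap g ug disj u) λ (z∈gx , z∈rest) →
  let y , y∈ , z∈gy = find (∈-concatMap⁻ g {xs} z∈rest) in All.lookup x∉ y∈ (disj z∈gx z∈gy)

leaves-bind : ∀ t f → leaves (bind t f) ≡ concatMap (leaves ∘ f) (leaves t)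
leaves-bind (eleaf e)   f = sym (++-identityʳ (leaves (f e)))
leaves-bind (enode s t) f = trans (cong₂ _++_ (leaves-bind s f) (leaves-bind t f))
                                  (sym (concatMap-++ (leaves ∘ f) (leaves s) (leaves t)))

nleaves : BTree → ℕ
nleaves leaf       = 1
nleaves (node l r) = nleaves l + nleaves r

length-leaves : ∀ t → length (leaves t) ≡ nleaves (eshape t)
length-leaves (eleaf e)   = refl
length-leaves (enode s t) = trans (length-++ (leaves s)) (cong₂ _+_ (length-leaves s) (length-leaves t))

-- Graft p t t′: replacing leaf number p (from 0) of t by a node gives t′.
data Graft : ℕ → BTree → BTree → Set where
  here  : Graft 0 leaf (node leaf leaf)
  left  : ∀ {p l l′ r} → Graft p l l′ → Graft p (node l r) (node l′ r)
  right : ∀ {p l r r′} → Graft p r r′ → Graft (nleaves l + p) (node l r) (node l r′)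

Graft-< : ∀ {p t t′} → Graft p t t′ → p < nleaves t
Graft-< here              = s≤s z≤n
Graft-< (left g)          = <-≤-trans (Graft-< g) (m≤m+n _ _)
Graft-< (right {l = l} g) = +-monoʳ-< (nleaves l) (Graft-< g)

-- The positions are equated by an argument because the index `nleaves l + p` of `right` does not
-- unify with that of another grafting.
Graft-functional : ∀ {p q t t′ t″} → Graft p t t′ → Graft q t t″ → p ≡ q → t′ ≡ t″
Graft-functional here here _ = refl
Graft-functional (left g) (left h) eq = cong (λ l → node l _) (Graft-functional g h eq)
Graft-functional (right {l = l} g) (right h) eq = cong (node l) (Graft-functional g h (+-cancelˡ-≡ (nleaves l) _ _ eq))
Graft-functional (left g) (right {l = l} h) refl = contradiction (Graft-< g) (≤⇒≯ (m≤m+n (nleaves l) _))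
Graft-functional (right {l = l} g) (left h) refl = contradiction (Graft-< h) (≤⇒≯ (m≤m+n (nleaves l) _))

module _ {f : Edge → ETree} {e : Edge} (hit : eshape (f e) ≡ node leaf leaf)
         (miss : ∀ {x} → x ≢ e → eshape (f x) ≡ leaf) where

  eshape-bind : ∀ t → ¬ (e ∈ leaves t) → eshape (bind t f) ≡ eshape t
  eshape-bind (eleaf x)   e∉ = miss λ { refl → e∉ (here refl) }
  eshape-bind (enode s t) e∉ = cong₂ node (eshape-bind s (e∉ ∘ ∈-++⁺ˡ)) (eshape-bind t (e∉ ∘ ∈-++⁺ʳ (leaves s)))

  -- Since the leaves are distinct, e occurs at position p only. The subtree without it is merely
  -- relabelled, which leaves its shape unchanged.
  Graft-bind : ∀ t {p d} → Unique (leaves t) → p < length (leaves t) → lookupD (leaves t) p d ≡ e →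
               Graft p (eshape t) (eshape (bind t f))
  Graft-bind (eleaf x) {zero} _ _ refl = subst (Graft 0 leaf) (sym hit) here
  Graft-bind (eleaf x) {suc p} _ (s≤s ()) _
  Graft-bind (enode s t) {p} {d} u lt eq with Unique-++⁻ (leaves s) u | p <? length (leaves s)
  ... | us , ut , disj | yes p< = subst (λ r → Graft p (node (eshape s) (eshape t)) (node (eshape (bind s f)) r))
      (sym (eshape-bind t (disj (subst (_∈ leaves s) eq′ (lookupD-∈ (leaves s) p<)))))
      (left (Graft-bind s us p< eq′))
    where
    eq′ : lookupD (leaves s) p d ≡ e
    eq′ = trans (sym (lookupD-++ˡ (leaves s) (leaves t) p<)) eq
  ... | us , ut , disj | no p≮ = subst₂ (λ n l → Graft n (node (eshape s) (eshape t)) (node l (eshape (bind t f))))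
      (trans (cong (_+ q) (sym (length-leaves s))) p≡)
      (sym (eshape-bind s λ e∈ → disj e∈ (subst (_∈ leaves t) eq′ (lookupD-∈ (leaves t) q<))))
      (right (Graft-bind t ut q< eq′))
    where
    q : ℕ
    q = p ∸ length (leaves s)
    p≡ : length (leaves s) + q ≡ p
    p≡ = m+[n∸m]≡n (≮⇒≥ p≮)
    q< : q < length (leaves t)
    q< = +-cancelˡ-< (length (leaves s)) _ _ (subst₂ _<_ (sym p≡) (length-++ (leaves s)) lt)
    eq′ : lookupD (leaves t) q d ≡ e
    eq′ = trans (sym (lookupD-++ʳ (leaves s) (leaves t) q))
            (trans (cong (λ n → lookupD (leaves s ++ leaves t) n d) p≡) eq)

-- y is a leaf of the tree that replaces the leaf x
data Origin (a b : ℕ) : Edge → Edge → Edge → Set where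
  column-old  : ∀ {e} j → Origin a b (rowEnd e) (colBot (skip b j)) (colBot j)
  column-row  : ∀ {e} i → Origin a b (rowEnd e) (rowEnd i) (rowEnd i)
  column-new  : ∀ {e} → Origin a b (rowEnd e) (colBot b) (rowEnd a)
  row-old     : ∀ {e} i → Origin a b (colBot e) (rowEnd (skip a i)) (rowEnd i)
  row-column  : ∀ {e} j → Origin a b (colBot e) (colBot j) (colBot j)
  row-new     : ∀ {e} → Origin a b (colBot e) (rowEnd a) (colBot b)

∈⇒Origin : ∀ {a b} e x {y} → y ∈ leaves (insertLeaf a b e x) → Origin a b e y x
∈⇒Origin (rowEnd _) (colBot j) (here refl) = column-old j
∈⇒Origin {a} (rowEnd _) (rowEnd i) y∈ with i ≟ a
∈⇒Origin (rowEnd _) (rowEnd i) (here refl)         | yes refl = column-new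
∈⇒Origin (rowEnd _) (rowEnd i) (there (here refl)) | yes refl = column-row i
∈⇒Origin (rowEnd _) (rowEnd i) (here refl)         | no _     = column-row i
∈⇒Origin (colBot _) (rowEnd i) (here refl) = row-old i
∈⇒Origin {b = b} (colBot _) (colBot j) y∈ with j ≟ b
∈⇒Origin (colBot _) (colBot j) (here refl)         | yes refl = row-column j
∈⇒Origin (colBot _) (colBot j) (there (here refl)) | yes refl = row-new
∈⇒Origin (colBot _) (colBot j) (here refl)         | no _     = row-column j

Origin⇒∈ : ∀ {a b e y x} → Origin a b e y x → y ∈ leaves (insertLeaf a b e x)
Origin⇒∈ (column-old j) = here refl
Origin⇒∈ {a} (column-row i) with i ≟ a
... | yes refl = there (here refl)
... | no _     = here refl
Origin⇒∈ {a} column-new with a ≟ a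
... | yes _  = here refl
... | no neq = contradiction refl neq
Origin⇒∈ (row-old i) = here refl
Origin⇒∈ {b = b} (row-column j) with j ≟ b
... | yes refl = here refl
... | no _     = here refl
Origin⇒∈ {b = b} row-new with b ≟ b
... | yes _  = there (here refl)
... | no neq = contradiction refl neq

origin : ∀ a b e y → ∃ (Origin a b e y)
origin a b (rowEnd _) (rowEnd i) = rowEnd i , column-row i
origin a b (rowEnd _) (colBot j) with skipView b j
... | at    = rowEnd a , column-new
... | off k = colBot k , column-old k
origin a b (colBot _) (colBot j) = colBot j , row-column j
origin a b (colBot _) (rowEnd i) with skipView a i
... | at    = colBot b , row-new
... | off k = rowEnd k , row-old k

colBot-injective : ∀ {m n} → colBot m ≡ colBot n → m ≡ n
colBot-injective refl = refl

rowEnd-injective : ∀ {m n} → rowEnd m ≡ rowEnd n → m ≡ n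
rowEnd-injective refl = refl

-- No edge arises from two old leaves, which is why the new leaves are again distinct.
Origin-functional : ∀ {a b e y y′ x x′} → Origin a b e y x → Origin a b e y′ x′ → y ≡ y′ → x ≡ x′
Origin-functional {b = b} (column-old j) (column-old k) eq = cong colBot (skip-injective b (colBot-injective eq))
Origin-functional {b = b} (column-old j) column-new eq = contradiction (colBot-injective eq) (skip-≢ b)
Origin-functional {b = b} column-new (column-old j) eq = contradiction (sym (colBot-injective eq)) (skip-≢ b)
Origin-functional (column-row i) (column-row .i) refl = refl
Origin-functional column-new column-new refl = refl
Origin-functional {a} (row-old j) (row-old k) eq = cong rowEnd (skip-injective a (rowEnd-injective eq))
Origin-functional {a} (row-old j) row-new eq = contradiction (rowEnd-injective eq) (skip-≢ a)
Origin-functional {a} row-new (row-old j) eq = contradiction (sym (rowEnd-injective eq)) (skip-≢ a)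
Origin-functional (row-column i) (row-column .i) refl = refl
Origin-functional row-new row-new refl = refl

insertLeaf-unique : ∀ a b e x → Unique (leaves (insertLeaf a b e x))
insertLeaf-unique a b (rowEnd _) (colBot j) = [] ∷ []
insertLeaf-unique a b (rowEnd _) (rowEnd i) with i ≟ a
... | yes _ = ((λ ()) ∷ []) ∷ [] ∷ []
... | no _  = [] ∷ []
insertLeaf-unique a b (colBot _) (rowEnd i) = [] ∷ []
insertLeaf-unique a b (colBot _) (colBot j) with j ≟ b
... | yes _ = ((λ ()) ∷ []) ∷ [] ∷ []
... | no _  = [] ∷ []

hit-leaf : ∀ {l P l₀ P₀ a b e} → Inserted l P l₀ P₀ a b e → eshape (insertLeaf a b e e) ≡ node leaf leaf
hit-leaf {a = a} (column _ _ _ _ _) with a ≟ a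
... | yes _  = refl
... | no neq = contradiction refl neq
hit-leaf {b = b} (row _ _ _ _ _ _) with b ≟ b
... | yes _  = refl
... | no neq = contradiction refl neq

miss-leaf : ∀ {l P l₀ P₀ a b e} → Inserted l P l₀ P₀ a b e → ∀ {x} → x ≢ e → eshape (insertLeaf a b e x) ≡ leaf
miss-leaf (column _ _ _ _ _) {colBot j} neq = refl
miss-leaf {a = a} (column _ _ _ _ _) {rowEnd i} neq with i ≟ a
... | yes refl = contradiction refl neq
... | no _     = refl
miss-leaf (row _ _ _ _ _ _) {rowEnd i} neq = refl
miss-leaf {b = b} (row _ _ _ _ _ _) {colBot j} neq with j ≟ b
... | yes refl = contradiction refl neq
... | no _     = refl

module _ {l l₀ l′ : ℕ → ℕ} {P P₀ : Matrix} {a b : ℕ} {e : Edge} (tl : TreeLike l P) (ins : Inserted l P l₀ P₀ a b e)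
         (comp : Completed l₀ P₀ a b l′) where

  private
    open TreeLike tl
    tl₀ : TreeLike l₀ P₀
    tl₀ = inserted-treeLike tl ins
    corner : Corner l₀ a b
    corner = inserted-corner decreasing ins
    grows : ∀ i → l₀ i ≤ l′ i
    grows = completed-grows (TreeLike.decreasing tl₀) (TreeLike.supported tl₀) corner comp
    first : l′ 0 ≡ l₀ 0
    first = completed-0 (TreeLike.decreasing tl₀) (TreeLike.supported tl₀) corner comp
    positive⁻ : ∀ i → 0 < l′ i → 0 < l₀ i
    positive⁻ i pos with i ≤? a
    ... | yes le = ≤-trans (s≤s z≤n) (≤-trans (≤-reflexive (sym (proj₁ corner))) (antitone (TreeLike.decreasing tl₀) le))
    ... | no ≰   = subst (0 <_) (completed-below comp i (≰⇒> ≰)) pos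
    corner-positive : 0 < l′ a
    corner-positive = ≤-trans (s≤s z≤n) (≤-trans (≤-reflexive (sym (proj₁ corner))) (grows a))

  -- A ribbon changes neither the length of row 0 nor which rows are nonempty, so the valid edges of
  -- `l′` are those of `l₀`, and these correspond to those of l through their origins.
  origin-valid : ∀ {x y} → Origin a b e y x → ValidEdge l x → ValidEdge l′ y
  origin-valid = go ins
    where
    go : ∀ {e x y} → Inserted l P l₀ P₀ a b e → Origin a b e y x → ValidEdge l x → ValidEdge l′ y
    go (column _ refl le _ _) (column-old j) v = subst (skip b j <_) (sym (trans first (le 0 z≤n))) (skip-suc⁺ b v)
    go (column _ refl le _ _) (column-row i) v = <-≤-trans v (≤-trans (inserted-grows (TreeLike.decreasing tl₀) ins i) (grows i))
    go (column _ refl le _ _) column-new v = subst (b <_) (sym (trans first (le 0 z≤n))) (s≤s (antitone decreasing z≤n))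
    go (row _ _ _ old _ _) (row-old i) v = <-≤-trans (subst (0 <_) (sym (old i)) v) (grows (skip a i))
    go (row 0<a _ _ old _ _) (row-column j) v = subst (j <_) (sym (trans first (row-before l₀ old 0<a))) v
    go (row _ _ _ _ _ _) row-new v = corner-positive

  origin-valid⁻ : ∀ {x y} → Origin a b e y x → ValidEdge l′ y → ValidEdge l x
  origin-valid⁻ = go ins
    where
    go : ∀ {e x y} → Inserted l P l₀ P₀ a b e → Origin a b e y x → ValidEdge l′ y → ValidEdge l x
    go (column _ refl le _ _) (column-old j) v =
      skip-suc⁻ b (antitone decreasing z≤n) (subst (skip b j <_) (trans first (le 0 z≤n)) v)
    go (column 0<b refl _ _ _) column-new v = 0<b
    go (row _ _ _ old _ _) (row-old i) v = subst (0 <_) (old i) (positive⁻ (skip a i) v)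
    go (row 0<a _ _ old _ _) (row-column j) v = subst (j <_) (trans first (row-before l₀ old 0<a)) v
    go (row 0<a _ long _ _ _) row-new v = long 0 0<a
    go (column 0<b refl _ gt _) (column-row i) v with i ≤? a
    ... | yes i≤a = <-≤-trans 0<b (antitone decreasing i≤a)
    ... | no i≰a  = subst (0 <_) (gt i (≰⇒> i≰a)) (positive⁻ i v)

record Labelled (T : Tab) : Set where
  field
    unique   : Unique (leaves (treeE T))
    complete : ∀ {e} → ValidEdge (rowLen T) e → e ∈ leaves (treeE T)
    valid    : ∀ {e} → e ∈ leaves (treeE T) → ValidEdge (rowLen T) e

labelled-unitTab : Labelled unitTab
labelled-unitTab = record
  { unique   = ((λ ()) ∷ []) ∷ [] ∷ []
  ; complete = λ { {colBot zero} _ → here refl ; {colBot (suc j)} (s≤s ())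
                 ; {rowEnd zero} _ → there (here refl) ; {rowEnd (suc i)} () }
  ; valid    = λ { (here refl) → s≤s z≤n ; (there (here refl)) → s≤s z≤n } }

module _ {T : Tab} {e : Edge} {X : Tab} (treeLike : IsTreeLike T) (I : Insertion T e X) where
  open Insertion I
  private
    tl : TreeLike (rowLen T) (cell T)
    tl = treeLike⁺ treeLike

    f : Edge → ETree
    f = insertLeaf a b e

  -- `inserted` already speaks of the points of the completed tableau X, and `Tree` reads points
  -- alone, so a derivation for X comes directly from the one for T.
  treeE-insertion : treeE X ≡ bind (treeE T) f
  treeE-insertion = Tree-functional
    (treeE-Tree {X} (TreeLike.decreasing tl′) (Points.root (TreeLike.points tl′)))
    (Tree-inserted (TreeLike.points tl) inserted (treeE-Tree {T} (TreeLike.decreasing tl) (Points.root (TreeLike.points tl))))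
    where
    tl′ : TreeLike (rowLen X) (cell X)
    tl′ = insertion-treeLike treeLike I

  leaves-insertion : leaves (treeE X) ≡ concatMap (leaves ∘ f) (leaves (treeE T))
  leaves-insertion = trans (cong leaves treeE-insertion) (leaves-bind (treeE T) f)

  module _ (lab : Labelled T) where
    open Labelled lab

    insertion-Graft : ∀ {p d} → p < length (leaves (treeE T)) → lookupD (leaves (treeE T)) p d ≡ e →
                      Graft p (treeTab T) (treeTab X)
    insertion-Graft {p} lt eq = subst (Graft p (treeTab T)) (cong eshape (sym treeE-insertion))
      (Graft-bind (hit-leaf inserted) (miss-leaf inserted) (treeE T) unique lt eq)

    insertion-labelled : Labelled X
    insertion-labelled = record
      { unique   = subst Unique (sym leaves-insertion)
          (Unique-concatMap (leaves ∘ f) (insertLeaf-unique a b e)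
            (λ {x} {y} z∈x z∈y → Origin-functional (∈⇒Origin e x z∈x) (∈⇒Origin e y z∈y) refl) unique)
      ; complete = λ {y} v → let x , o = origin a b e y in
          subst (y ∈_) (sym leaves-insertion)
            (∈-concatMap⁺ (leaves ∘ f) (lose (complete (origin-valid⁻ tl inserted completed o v)) (Origin⇒∈ o)))
      ; valid    = λ {y} y∈ →
          let x , x∈ , y∈x = find (∈-concatMap⁻ (leaves ∘ f) (subst (y ∈_) leaves-insertion y∈)) in
          origin-valid tl inserted completed (∈⇒Origin e x y∈x) (valid x∈) }

-- Permutations and increasing trees

minimum-∈ : ∀ x xs → minimum (x ∷ xs) ∈ x ∷ xs
minimum-∈ x []       = here refl
minimum-∈ x (y ∷ ys) with ⊓-sel x (minimum (y ∷ ys))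
... | inj₁ eq = here eq
... | inj₂ eq = there (subst (_∈ y ∷ ys) (sym eq) (minimum-∈ y ys))

minimum-insertAt : ∀ p m x xs → All (_< m) (x ∷ xs) → minimum (insertAt p m (x ∷ xs)) ≡ minimum (x ∷ xs)
minimum-insertAt zero m x xs lt = m≥n⇒m⊓n≡n (<⇒≤ (All.lookup lt (minimum-∈ x xs)))
minimum-insertAt (suc zero)    m x []       (lt ∷ []) = m≤n⇒m⊓n≡m (<⇒≤ lt)
minimum-insertAt (suc (suc p)) m x []       (lt ∷ []) = m≤n⇒m⊓n≡m (<⇒≤ lt)
minimum-insertAt (suc zero)    m x (y ∷ ys) (_ ∷ lt)  = cong (x ⊓_) (minimum-insertAt zero m y ys lt)
minimum-insertAt (suc (suc p)) m x (y ∷ ys) (_ ∷ lt)  = cong (x ⊓_) (minimum-insertAt (suc p) m y ys lt)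

before after : ℕ → List ℕ → List ℕ
before μ w = proj₁ (splitAt μ w)
after μ w = proj₂ (splitAt μ w)

splitAt-length : ∀ {μ} w → μ ∈ w → length (before μ w) + suc (length (after μ w)) ≡ length w
splitAt-length {μ} (x ∷ w) μ∈ with x ≡ᵇ μ in eq
... | true = refl
splitAt-length {μ} (x ∷ w) (here refl) | false = contradiction eq (true≢false (≡ᵇ-true x))
splitAt-length {μ} (x ∷ w) (there μ∈)  | false = cong suc (splitAt-length w μ∈)

splitAt-All : ∀ {Q : ℕ → Set} μ {w} → All Q w → All Q (before μ w) × All Q (after μ w)
splitAt-All μ {[]}    []       = [] , []
splitAt-All μ {x ∷ w} (q ∷ qs) with x ≡ᵇ μ
... | true  = [] , qs
... | false = (q ∷ proj₁ (splitAt-All μ qs)) , proj₂ (splitAt-All μ qs)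

-- Matches the constructors of `Graft`. With k letters before μ the left subtree has k + 1 leaves:
-- positions 0 to k belong to it, position k being directly before μ, and position `suc (k + q)` is
-- leaf q of the right subtree.
data SplitInsert (μ m p : ℕ) (w : List ℕ) : Set where
  in-before : p ≤ length (before μ w) →
    before μ (insertAt p m w) ≡ insertAt p m (before μ w) → after μ (insertAt p m w) ≡ after μ w → SplitInsert μ m p w
  in-after  : ∀ q → q ≤ length (after μ w) → suc (length (before μ w) + q) ≡ p →
    before μ (insertAt p m w) ≡ before μ w → after μ (insertAt p m w) ≡ insertAt q m (after μ w) → SplitInsert μ m p w

splitAt-insertAt : ∀ {μ m} p w → m ≢ μ → μ ∈ w → p ≤ length w → SplitInsert μ m p w
splitAt-insertAt {μ} {m} zero (x ∷ w) neq μ∈ le = in-before z≤n (cong proj₁ eq) (cong proj₂ eq)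
  where
  eq : splitAt μ (m ∷ x ∷ w) ≡ (m ∷ before μ (x ∷ w) , after μ (x ∷ w))
  eq rewrite ≡ᵇ-false neq = refl
splitAt-insertAt {μ} {m} (suc p) (x ∷ w) neq μ∈ (s≤s le) = go (x ≡ᵇ μ) refl
  where
  yes-eq : (x ≡ᵇ μ) ≡ true → ∀ v → splitAt μ (x ∷ v) ≡ ([] , v)
  yes-eq eq v rewrite eq = refl
  no-eq : (x ≡ᵇ μ) ≡ false → ∀ v → splitAt μ (x ∷ v) ≡ (x ∷ before μ v , after μ v)
  no-eq eq v rewrite eq = refl
  tail-∈ : (x ≡ᵇ μ) ≡ false → μ ∈ x ∷ w → μ ∈ w
  tail-∈ eq (here refl) = contradiction eq (true≢false (≡ᵇ-true x))
  tail-∈ eq (there μ∈)  = μ∈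
  go : ∀ b → (x ≡ᵇ μ) ≡ b → SplitInsert μ m (suc p) (x ∷ w)
  go true eq = in-after p
    (subst (p ≤_) (cong (length ∘ proj₂) (sym (yes-eq eq w))) le)
    (cong (λ s → suc (length (proj₁ s) + p)) (yes-eq eq w))
    (trans (cong proj₁ (yes-eq eq (insertAt p m w))) (sym (cong proj₁ (yes-eq eq w))))
    (trans (cong proj₂ (yes-eq eq (insertAt p m w))) (cong (insertAt p m ∘ proj₂) (sym (yes-eq eq w))))
  go false eq with splitAt-insertAt p w neq (tail-∈ eq μ∈) le
  ... | in-before le′ e₁ e₂ = in-before
    (subst (suc p ≤_) (cong (length ∘ proj₁) (sym (no-eq eq w))) (s≤s le′))
    (trans (cong proj₁ (no-eq eq (insertAt p m w))) (trans (cong (x ∷_) e₁) (cong (insertAt (suc p) m ∘ proj₁) (sym (no-eq eq w)))))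
    (trans (cong proj₂ (no-eq eq (insertAt p m w))) (trans e₂ (cong proj₂ (sym (no-eq eq w)))))
  ... | in-after q le′ refl e₁ e₂ = in-after q
    (subst (q ≤_) (cong (length ∘ proj₂) (sym (no-eq eq w))) le′)
    (cong (λ s → suc (length (proj₁ s) + q)) (no-eq eq w))
    (trans (cong proj₁ (no-eq eq (insertAt _ m w))) (trans (cong (x ∷_) e₁) (cong proj₁ (sym (no-eq eq w)))))
    (trans (cong proj₂ (no-eq eq (insertAt _ m w))) (trans e₂ (cong (insertAt q m ∘ proj₂) (sym (no-eq eq w)))))

splitAt-≤ : ∀ x xs {f} → length (x ∷ xs) ≤ suc f → let μ = minimum (x ∷ xs) in
            length (before μ (x ∷ xs)) ≤ f × length (after μ (x ∷ xs)) ≤ f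
splitAt-≤ x xs {f} le =
  ≤-trans (m≤m+n _ _) sum≤ , ≤-trans (m≤n+m _ _) sum≤
  where
  μ : ℕ
  μ = minimum (x ∷ xs)
  sum≤ : length (before μ (x ∷ xs)) + length (after μ (x ∷ xs)) ≤ f
  sum≤ = s≤s⁻¹ (≤-trans (≤-reflexive (trans (sym (+-suc _ _)) (splitAt-length (x ∷ xs) (minimum-∈ x xs)))) le)

-- An insertion lengthens the word and thus raises the fuel also for the subword that it does not
-- touch; its tree has to be compared at the two amounts.
inctreeF-fuel : ∀ f g w → length w ≤ f → length w ≤ g → inctreeF f w ≡ inctreeF g w
inctreeF-fuel f g [] _ _ = refl
inctreeF-fuel (suc f) (suc g) (x ∷ xs) u v with splitAt-≤ x xs u | splitAt-≤ x xs v
... | uL , uR | vL , vR = cong₂ (λ l r → inode l (minimum (x ∷ xs)) r)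
  (inctreeF-fuel f g (before (minimum (x ∷ xs)) (x ∷ xs)) uL vL)
  (inctreeF-fuel f g (after (minimum (x ∷ xs)) (x ∷ xs)) uR vR)

nleaves-inctreeF : ∀ f w → length w ≤ f → nleaves (forget (inctreeF f w)) ≡ suc (length w)
nleaves-inctreeF f [] _ = refl
nleaves-inctreeF (suc f) (x ∷ xs) le with splitAt-≤ x xs le
... | uL , uR = trans (cong₂ _+_ (nleaves-inctreeF f (before (minimum (x ∷ xs)) (x ∷ xs)) uL)
                                  (nleaves-inctreeF f (after (minimum (x ∷ xs)) (x ∷ xs)) uR))
  (cong suc (splitAt-length (x ∷ xs) (minimum-∈ x xs)))

inctreeF-node : ∀ f w → 0 < length w → forget (inctreeF (suc f) w) ≡
  node (forget (inctreeF f (before (minimum w) w))) (forget (inctreeF f (after (minimum w) w)))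
inctreeF-node f (x ∷ xs) _ = refl

-- As m exceeds all letters, the minimum stays the root label. The insertion falls into one of the
-- two subwords, where the induction applies, and the other subtree only receives more fuel.
Graft-inctreeF : ∀ f m w p → length w ≤ f → All (_< m) w → p ≤ length w →
  Graft p (forget (inctreeF f w)) (forget (inctreeF (suc f) (insertAt p m w)))
Graft-inctreeF f m [] zero _ _ _ rewrite ≡ᵇ-true m with f
... | zero  = here
... | suc _ = here
Graft-inctreeF (suc f) m (x ∷ xs) p le lt p≤ =
  subst (Graft p (node (tree-of f L) (tree-of f R))) (sym eq) (go (splitAt-insertAt p (x ∷ xs) m≢μ (minimum-∈ x xs) p≤))
  where
  tree-of : ℕ → List ℕ → BTree
  tree-of f w = forget (inctreeF f w)
  μ : ℕ
  μ = minimum (x ∷ xs)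
  L R w′ : List ℕ
  L = before μ (x ∷ xs)
  R = after μ (x ∷ xs)
  w′ = insertAt p m (x ∷ xs)
  m≢μ : m ≢ μ
  m≢μ = >⇒≢ (All.lookup lt (minimum-∈ x xs))
  eq : tree-of (suc (suc f)) w′ ≡ node (tree-of (suc f) (before μ w′)) (tree-of (suc f) (after μ w′))
  eq = trans (inctreeF-node (suc f) w′ (subst (0 <_) (sym (length-insertAt p m (x ∷ xs))) (s≤s z≤n)))
    (cong (λ ν → node (tree-of (suc f) (before ν w′)) (tree-of (suc f) (after ν w′))) (minimum-insertAt p m x xs lt))
  lenL : length L ≤ f
  lenL = proj₁ (splitAt-≤ x xs le)
  lenR : length R ≤ f
  lenR = proj₂ (splitAt-≤ x xs le)
  go : SplitInsert μ m p (x ∷ xs) → Graft p (node (tree-of f L) (tree-of f R))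
         (node (tree-of (suc f) (before μ w′)) (tree-of (suc f) (after μ w′)))
  go (in-before p≤L e₁ e₂) = subst₂ (λ l r → Graft p (node (tree-of f L) (tree-of f R)) (node l r))
    (cong (tree-of (suc f)) (sym e₁))
    (cong forget (trans (inctreeF-fuel f (suc f) R lenR (m≤n⇒m≤1+n lenR)) (cong (inctreeF (suc f)) (sym e₂))))
    (left (Graft-inctreeF f m L p lenL (proj₁ (splitAt-All μ lt)) p≤L))
  go (in-after q q≤R p≡ e₁ e₂) = subst₂ (λ n t → Graft n (node (tree-of f L) (tree-of f R)) t)
    (trans (cong (_+ q) (nleaves-inctreeF f L lenL)) p≡)
    (cong₂ node
      (cong forget (trans (inctreeF-fuel f (suc f) L lenL (m≤n⇒m≤1+n lenL)) (cong (inctreeF (suc f)) (sym e₁))))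
      (cong (tree-of (suc f)) (sym e₂)))
    (right (Graft-inctreeF f m R q lenR (proj₂ (splitAt-All μ lt)) q≤R))

Graft-treePerm : ∀ m w p → All (_< m) w → p ≤ length w → Graft p (treePerm w) (treePerm (insertAt p m w))
Graft-treePerm m w p lt p≤ = subst (λ n → Graft p (treePerm w) (forget (inctreeF n (insertAt p m w))))
  (sym (length-insertAt p m w)) (Graft-inctreeF (length w) m w p ≤-refl lt p≤)

insertAt-length : ∀ {A : Set} (m : A) xs ys → insertAt (length xs) m (xs ++ ys) ≡ xs ++ m ∷ ys
insertAt-length m []       ys = refl
insertAt-length m (x ∷ xs) ys = cong (x ∷_) (insertAt-length m xs ys)

insertAt-↭ : ∀ {A : Set} p (m : A) xs → insertAt p m xs ↭ m ∷ xs
insertAt-↭ zero    m xs       = ↭-refl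
insertAt-↭ (suc p) m []       = ↭-refl
insertAt-↭ (suc p) m (x ∷ xs) = ↭-trans (prep x (insertAt-↭ p m xs)) (↭-swap x m ↭-refl)

position-insertAt : ∀ p m w → All (_< m) w → p ≤ length w → position m (insertAt p m w) ≡ p
position-insertAt zero    m w       _        _ rewrite ≡ᵇ-true m = refl
position-insertAt (suc p) m (x ∷ w) (lt ∷ a) (s≤s le) rewrite ≡ᵇ-false (<⇒≢ lt) = cong suc (position-insertAt p m w a le)

deleteLetter-none : ∀ m w → All (_< m) w → deleteLetter m w ≡ w
deleteLetter-none m w lt = filter-all (λ x → ¬? (x ≟ m)) (All.map <⇒≢ lt)

deleteLetter-insertAt : ∀ p m w → All (_< m) w → deleteLetter m (insertAt p m w) ≡ w
deleteLetter-insertAt zero m w lt =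
  trans (filter-reject (λ x → ¬? (x ≟ m)) {m} {w} (λ neq → neq refl)) (deleteLetter-none m w lt)
deleteLetter-insertAt (suc p) m [] lt = filter-reject (λ x → ¬? (x ≟ m)) {m} {[]} (λ neq → neq refl)
deleteLetter-insertAt (suc p) m (x ∷ w) (lt ∷ a) =
  trans (filter-accept (λ x → ¬? (x ≟ m)) {x} {insertAt p m w} (<⇒≢ lt)) (cong (x ∷_) (deleteLetter-insertAt p m w a))

letters-suc : ∀ n → map suc (upTo (suc n)) ≡ map suc (upTo n) ++ [ suc n ]
letters-suc n = trans (cong (map suc) (sym (upTo-∷ʳ n))) (map-++ suc (upTo n) [ n ])

IsPerm-length : ∀ {n w} → IsPerm n w → length w ≡ n
IsPerm-length {n} perm = trans (↭-length perm) (trans (length-map suc (upTo n)) (length-upTo n))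

IsPerm-< : ∀ {n w} → IsPerm n w → All (_< suc n) w
IsPerm-< {n} perm = All-resp-↭ (↭-sym perm) (All-map⁺ (All.map s≤s (all-upTo n)))

IsPerm-insertAt : ∀ {n w} p → IsPerm n w → IsPerm (suc n) (insertAt p (suc n) w)
IsPerm-insertAt {n} {w} p perm = subst (insertAt p (suc n) w ↭_) (sym (letters-suc n))
  (↭-trans (insertAt-↭ p (suc n) w) (↭-trans (prep (suc n) perm) (∷↭∷ʳ (suc n) (map suc (upTo n)))))

-- Presents a permutation in the form on which `phi2F` recurses, with τ and the position as data
-- instead of results of `deleteLetter` and `position`.
data InsertView (n : ℕ) : List ℕ → Set where
  inserted-at : ∀ p w → IsPerm n w → p ≤ n → InsertView n (insertAt p (suc n) w)

insertView : ∀ n σ → IsPerm (suc n) σ → InsertView n σ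
insertView n σ perm with ∈-∃++ (∈-resp-↭ (↭-sym perm′) (∈-++⁺ʳ (map suc (upTo n)) (here refl)))
  where
  perm′ : σ ↭ map suc (upTo n) ++ [ suc n ]
  perm′ = subst (σ ↭_) (letters-suc n) perm
... | xs , ys , refl = subst (InsertView n) (insertAt-length (suc n) xs ys)
    (inserted-at (length xs) (xs ++ ys) perm″ (subst (length xs ≤_) len (m≤m+n _ _)))
  where
  perm″ : IsPerm n (xs ++ ys)
  perm″ = subst (xs ++ ys ↭_) (++-identityʳ _) (drop-mid xs (map suc (upTo n)) (subst (σ ↭_) (letters-suc n) perm))
  len : length xs + length ys ≡ n
  len = trans (sym (length-++ xs)) (IsPerm-length perm″)

-- Induction along the recursion of `phi2F`

phi2F-insertAt : ∀ k p w → IsPerm (suc k) w → p ≤ suc k →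
                 phi2F (suc (suc k)) (insertAt p (suc (suc k)) w) ≡ insertAtLeaf (phi2F (suc k) w) p
phi2F-insertAt k p w perm p≤ = cong₂ (λ v q → insertAtLeaf (phi2F (suc k) v) q)
  (deleteLetter-insertAt p _ w (IsPerm-< perm))
  (position-insertAt p _ w (IsPerm-< perm) (subst (p ≤_) (sym (IsPerm-length perm)) p≤))

-- The invariant of the induction. `shape` gives the tableau's tree as many leaves as there are
-- positions for the next letter, and `labelled` makes each of these leaves a boundary edge at which
-- insertion is possible.
record Good (n : ℕ) (σ : List ℕ) (T : Tab) : Set where
  field
    isTreeLike : IsTreeLike T
    size≡      : size T ≡ n
    labelled   : Labelled T
    shape      : treePerm σ ≡ treeTab T

  open Labelled labelled public

  leaf-count : length (leaves (treeE T)) ≡ suc (length σ)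
  leaf-count = trans (length-leaves (treeE T)) (trans (cong nleaves (sym shape)) (nleaves-inctreeF (length σ) σ ≤-refl))

  leafEdge : ℕ → Edge
  leafEdge p = lookupD (leaves (treeE T)) p (rowEnd 0)

  insertion : ∀ {p} → p ≤ length σ → Insertion T (leafEdge p) (insertAtLeaf T p)
  insertion {p} p≤ = insertpoint-insertion isTreeLike (valid (lookupD-∈ (leaves (treeE T)) (subst (p <_) (sym leaf-count) (s≤s p≤))))

  good-insertion : ∀ {m p} → All (_< m) σ → p ≤ length σ → Good (suc n) (insertAt p m σ) (insertAtLeaf T p)
  good-insertion {m} {p} lt p≤ = record
    { isTreeLike = insertion-isTreeLike isTreeLike I
    ; size≡      = trans (Insertion.size-suc I) (cong suc size≡)
    ; labelled   = insertion-labelled isTreeLike I labelled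
    ; shape      = Graft-functional (Graft-treePerm m σ p lt p≤)
        (subst (λ t → Graft p t (treeTab (insertAtLeaf T p))) (sym shape)
          (insertion-Graft isTreeLike I labelled (subst (p <_) (sym leaf-count) (s≤s p≤)) refl)) refl }
    where
    I : Insertion T (leafEdge p) (insertAtLeaf T p)
    I = insertion p≤

unitTab-isTreeLike : IsTreeLike unitTab
unitTab-isTreeLike =
  ((λ ()) , (s≤s z≤n ∷ []) , [-]) , refl ,
  (λ { zero zero _ nr → contradiction (refl , refl) nr ; zero (suc j) () _ ; (suc i) j () _ }) ,
  (λ { zero _ → 0 , refl ; (suc i) (s≤s ()) }) , (λ { zero _ → 0 , refl ; (suc j) (s≤s ()) })

phi2F-good : ∀ n σ → IsPerm (suc n) σ → Good (suc n) σ (phi2F (suc n) σ)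
phi2F-good zero σ perm with ↭-singleton-inv perm
... | refl = record { isTreeLike = unitTab-isTreeLike ; size≡ = refl ; labelled = labelled-unitTab ; shape = refl }
phi2F-good (suc n) σ perm with insertView (suc n) σ perm
... | inserted-at p τ perm′ p≤ = subst (Good _ _) (sym (phi2F-insertAt n p τ perm′ p≤))
  (Good.good-insertion (phi2F-good n τ perm′) (IsPerm-< perm′) (subst (p ≤_) (sym (IsPerm-length perm′)) p≤))

phi2F-injective : ∀ n σ σ′ → IsPerm (suc n) σ → IsPerm (suc n) σ′ → phi2F (suc n) σ ≡ phi2F (suc n) σ′ → σ ≡ σ′
phi2F-injective zero σ σ′ perm perm′ _ = trans (↭-singleton-inv perm) (sym (↭-singleton-inv perm′))
phi2F-injective (suc n) σ σ′ perm perm′ eq with insertView (suc n) σ perm | insertView (suc n) σ′ perm′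
... | inserted-at p τ permτ p≤ | inserted-at p′ τ′ permτ′ p′≤
  with insertion-injective (Good.isTreeLike g) (Good.isTreeLike g′) (Good.insertion g p≤τ)
         (subst (Insertion (phi2F (suc n) τ′) _) (sym eq′) (Good.insertion g′ p′≤τ′))
  where
  g = phi2F-good n τ permτ
  g′ = phi2F-good n τ′ permτ′
  p≤τ = subst (p ≤_) (sym (IsPerm-length permτ)) p≤
  p′≤τ′ = subst (p′ ≤_) (sym (IsPerm-length permτ′)) p′≤
  eq′ : insertAtLeaf (phi2F (suc n) τ) p ≡ insertAtLeaf (phi2F (suc n) τ′) p′
  eq′ = trans (sym (phi2F-insertAt n p τ permτ p≤)) (trans eq (phi2F-insertAt n p′ τ′ permτ′ p′≤))
-- Only once the induction has identified τ and τ′ are both edges entries of one list of leaves; its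
-- distinctness then turns equal edges into equal positions.
... | T≡ , e≡ with phi2F-injective n τ τ′ permτ permτ′ T≡
...   | refl = cong (λ q → insertAt q (suc (suc n)) τ) (lookupD-injective (Good.unique g) (in-range p≤) (in-range p′≤) e≡)
  where
  g = phi2F-good n τ permτ
  in-range : ∀ {q} → q ≤ suc n → q < length (leaves (treeE (phi2F (suc n) τ)))
  in-range le = subst (_ <_) (sym (Good.leaf-count g)) (s≤s (subst (_ ≤_) (sym (IsPerm-length permτ)) le))

size-positive : ∀ T → Pointed T 0 0 → 0 < size T
size-positive ((true ∷ r) ∷ T) _ = s≤s z≤n

phi2F-surjective : ∀ n T → IsTreeLike T → size T ≡ suc n → ∃ λ σ → IsPerm (suc n) σ × phi2F (suc n) σ ≡ T
phi2F-surjective n T treeLike sz with unit-or-insertpoint treeLike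
phi2F-surjective zero    _ _ sz | inj₁ refl = [ 1 ] , ↭-refl , refl
phi2F-surjective (suc n) _ _ () | inj₁ refl
phi2F-surjective n T _ sz | inj₂ (S , e , treeLike , valid , refl)
  with suc-injective (trans (sym (Insertion.size-suc (insertpoint-insertion treeLike valid))) sz)
phi2F-surjective zero T _ sz | inj₂ (S , e , treeLike , valid , refl) | size≡ =
  contradiction (size-positive S (proj₁ (proj₂ treeLike))) (<-irrefl (sym size≡))
phi2F-surjective (suc n) T _ sz | inj₂ (S , e , treeLike , valid , refl) | size≡ with phi2F-surjective n S treeLike size≡
-- Every valid edge is a leaf of the tree, so e has a leaf number p, and this is where the new
-- largest letter is inserted.
... | τ , perm , refl with ∈-lookupD (rowEnd 0) (Good.complete (phi2F-good n τ perm) valid)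
...   | p , lt , e≡ = insertAt p (suc (suc n)) τ , IsPerm-insertAt p perm ,
        trans (phi2F-insertAt n p τ perm p≤) (cong (insertpoint (phi2F (suc n) τ)) e≡)
  where
  p≤ : p ≤ suc n
  p≤ = subst (p ≤_) (IsPerm-length perm) (s≤s⁻¹ (subst (p <_) (Good.leaf-count (phi2F-good n τ perm)) lt))

Φ₂≡phi2F : ∀ {n σ} → IsPerm n σ → Φ₂ σ ≡ phi2F n σ
Φ₂≡phi2F {σ = σ} perm = cong (λ k → phi2F k σ) (IsPerm-length perm)

theorem4p3 : (n : ℕ) → 1 ≤ n →
    ((σ : List ℕ) → IsPerm n σ → IsTreeLike (Φ₂ σ) × size (Φ₂ σ) ≡ n) ×
    ((σ σ′ : List ℕ) → IsPerm n σ → IsPerm n σ′ → Φ₂ σ ≡ Φ₂ σ′ → σ ≡ σ′) ×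
    ((T : Tab) → IsTreeLike T → size T ≡ n → ∃ λ σ → IsPerm n σ × Φ₂ σ ≡ T) ×
    ((σ : List ℕ) → IsPerm n σ → treePerm σ ≡ treeTab (Φ₂ σ))
theorem4p3 (suc n) _ =
  (λ σ perm → Good.isTreeLike (good σ perm) , Good.size≡ (good σ perm)) ,
  (λ σ σ′ perm perm′ eq → phi2F-injective n σ σ′ perm perm′
    (trans (sym (Φ₂≡phi2F perm)) (trans eq (Φ₂≡phi2F perm′)))) ,
  (λ T treeLike sz → let σ , perm , eq = phi2F-surjective n T treeLike sz in σ , perm , trans (Φ₂≡phi2F perm) eq) ,
  (λ σ perm → Good.shape (good σ perm))
  where
  good : ∀ σ → IsPerm (suc n) σ → Good (suc n) σ (Φ₂ σ)
  good σ perm = subst (Good (suc n) σ) (sym (Φ₂≡phi2F perm)) (phi2F-good n σ perm)
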